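{- Let $\lambda$ be a partition of a positive integer and let $K_\lambda$ be the complete multipartite graph whose partite-set sizes are the parts of $\lambda$. Then the chromatic symmetric function $X_{K_\lambda}$ is $e$-positive if and only if at least one of the following holds: (i) the partition $\lambda$ has length one (exactly one part); (ii) every part of $\lambda$ belongs to $\{1,2\}$; (iii) $\lambda=(3,2^\beta)$ for some integer $\beta\ge 1$.
   Context: The partition $(3,2^\beta)$ has one part equal to $3$ and $\beta$ parts equal to $2$. When $\lambda=(n)$ has length one, $K_\lambda$ is the edgeless graph on $n$ vertices. For a finite simple graph $G=(V,E)$, the chromatic symmetric function is $X_G(x)=\sum_{\kappa}\prod_{v\in V}x_{\kappa(v)}$, where $x=(x_1,x_2,\dots)$ are commuting indeterminates and the sum is over all proper colorings $\kappa\colon V\to\mathbb Z_{>0}$ (adjacent vertices get distinct colors). A symmetric function is $e$-positive if all coefficients in its expansion in the basis of elementary symmetric functions $e_\mu=e_{\mu_1}e_{\mu_2}\cdots$ are nonnegative. -}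

module Defs where

open import Data.Bool.Base using (if_then_else_)
open import Data.Fin.Base using (Fin; zero; suc; splitAt)
open import Data.Fin.Properties using (all?) renaming (_≟_ to _≟ᶠ_)
open import Data.Integer.Base as ℤ using (ℤ; +_; 0ℤ; 1ℤ)
open import Data.List.Base
  using (List; []; _∷_; length; map; foldr; filter; upTo; allFin; cartesianProductWith)
open import Data.List.Membership.Propositional using (_∉_)
open import Data.List.Relation.Unary.All using (All)
open import Data.List.Relation.Unary.Linked using (Linked)
open import Data.List.Relation.Unary.Unique.Propositional using (Unique)
open import Data.Nat.Base using (ℕ; zero; suc; _∸_; _≤_; _<_; _≥_)
open import Data.Nat.ListAction using (sum)
open import Data.Nat.Properties using (_≟_; _≤?_)
open import Data.Product.Base using (Σ-syntax; _×_; _,_)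
open import Data.Sum.Base using ([_,_]′)
open import Data.Vec.Base as Vec using (Vec; []; _∷_; lookup; tabulate; count)
import Data.Vec.Properties as Vec
import Data.Vec.Relation.Unary.All as VecAll
open import Function.Base using (_∘_)
open import Relation.Binary.Definitions using (Decidable; Symmetric; Irreflexive)
open import Relation.Binary.PropositionalEquality using (_≡_; _≢_; refl; sym)
open import Relation.Nullary.Decidable using (Dec; does; ¬?; _×-dec_; _→-dec_)

record Partition : Set where
  constructor partition
  field
    parts       : List ℕ
    .positive   : All (0 <_) parts
    .decreasing : Linked _≥_ parts

open Partition public

size : Partition → ℕ
size μ = sum (parts μ)

record SimpleGraph (n : ℕ) : Set₁ where
  field
    Adj       : Fin n → Fin n → Set
    adj?      : Decidable Adj
    symmetric : Symmetric Adj
    loopless  : Irreflexive _≡_ Adj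

open SimpleGraph public

-- Vertices are numbered consecutively, part after part; `block ps v` is the
-- index of the partite set containing v.
block : (ps : List ℕ) → Fin (sum ps) → Fin (length ps)
block (p ∷ ps) v = [ (λ _ → zero) , suc ∘ block ps ]′ (splitAt p v)

completeMultipartite : (ps : List ℕ) → SimpleGraph (sum ps)
completeMultipartite ps = record
  { Adj       = λ u v → block ps u ≢ block ps v
  ; adj?      = λ u v → ¬? (block ps u ≟ᶠ block ps v)
  ; symmetric = λ u≢v → u≢v ∘ sym
  ; loopless  = λ { refl u≢u → u≢u refl }
  }

K : (μ : Partition) → SimpleGraph (size μ)
K μ = completeMultipartite (parts μ)

-- Formal power series over ℤ in x₁ , … , xₘ, given by the coefficient of each
-- monomial x₁^α₁ ⋯ xₘ^αₘ.
Series : ℕ → Set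
Series m = Vec ℕ m → ℤ

-- A formal power series in x₁ , x₂ , … is represented by its specialisations
-- f m = f(x₁ , … , xₘ , 0 , 0 , …).  Every monomial involves finitely many
-- variables, so these record all of its coefficients.
Series∞ : Set
Series∞ = (m : ℕ) → Series m

∑ : List ℤ → ℤ
∑ = foldr ℤ._+_ 0ℤ

-- All pairs (β , γ) with β + γ ≡ α componentwise.
splittings : ∀ {m} → Vec ℕ m → List (Vec ℕ m × Vec ℕ m)
splittings []      = ([] , []) ∷ []
splittings (a ∷ α) =
  cartesianProductWith (λ (b , c) (β , γ) → b ∷ β , c ∷ γ)
    (map (λ b → b , a ∸ b) (upTo (suc a))) (splittings α)

one : Series∞
one m α = if does (Vec.sum α ≟ 0) then 1ℤ else 0ℤ

infixl 7 _⊛_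

_⊛_ : Series∞ → Series∞ → Series∞
(f ⊛ g) m α = ∑ (map (λ (β , γ) → f m β ℤ.* g m γ) (splittings α))

-- eₖ is the sum of all squarefree monomials of degree k.
elementary : ℕ → Series∞
elementary k m α =
  if does (VecAll.all? (_≤? 1) α ×-dec (Vec.sum α ≟ k)) then 1ℤ else 0ℤ

e : Partition → Series∞
e μ = foldr _⊛_ one (map elementary (parts μ))

colourings : (m n : ℕ) → List (Vec (Fin m) n)
colourings m zero    = [] ∷ []
colourings m (suc n) = cartesianProductWith _∷_ (allFin m) (colourings m n)

Proper : ∀ {m n} → SimpleGraph n → Vec (Fin m) n → Set
Proper G κ = ∀ u v → Adj G u v → lookup κ u ≢ lookup κ v

proper? : ∀ {m n} (G : SimpleGraph n) (κ : Vec (Fin m) n) → Dec (Proper G κ)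
proper? G κ = all? λ u → all? λ v →
  adj? G u v →-dec ¬? (lookup κ u ≟ᶠ lookup κ v)

-- The exponent vector of the monomial ∏ᵥ x_{κ(v)}.
content : ∀ {m n} → Vec (Fin m) n → Vec ℕ m
content κ = tabulate λ i → count (i ≟ᶠ_) κ

-- The coefficient of x^α in ∑_κ ∏ᵥ x_{κ(v)} is the number of proper colourings
-- of content α.  Setting x_{m+1} = x_{m+2} = … = 0 leaves exactly the
-- colourings with colours among the first m.
chromatic : ∀ {n} → SimpleGraph n → Series∞
chromatic {n} G m α =
  + length (filter (λ κ → proper? G κ ×-dec Vec.≡-dec _≟_ (content κ) α)
                   (colourings m n))

-- An expansion of f as a finite ℤ-linear combination of the e μ.  The e μ are
-- linearly independent, so f determines `coeff`.
record EExpansion (f : Series∞) : Set where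
  field
    coeff    : Partition → ℤ
    support  : List Partition
    distinct : Unique support
    vanishes : ∀ μ → μ ∉ support → coeff μ ≡ 0ℤ
    expands  : ∀ m (α : Vec ℕ m) →
               f m α ≡ ∑ (map (λ μ → coeff μ ℤ.* e μ m α) support)

open EExpansion public

EPositive : Series∞ → Set
EPositive f = Σ[ E ∈ EExpansion f ] (∀ μ → 0ℤ ℤ.≤ coeff E μ)

{-# OPTIONS --safe #-}

-- All symmetric functions are handled through their coefficients.
--
-- Necessity.  The coefficient of x^α in e_μ can only grow when two exponents
-- α_i > α_j are replaced by α_i - 1 and α_j + 1, so the same holds for every
-- e-positive function.  Giving each part of λ its own colour shows that x^λ
-- occurs in X_{K_λ}.  If λ has parts a ≥ b + 2, or a repeated part ≥ 3, or
-- consecutive parts z + 1, z with z ≥ 4, then balancing these parts (and an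
-- exponent 0) reaches a monomial whose exponents cannot be grouped into the
-- parts of λ.  This leaves λ = (4,3), where x₁³x₂³x₃ has coefficient 8 but
-- x₁³x₂²x₃² only 6.
--
-- Sufficiency.  The functions Σⱼ cⱼ e_{n-j} e_j with cⱼ ≥ 0 are closed under
-- joining the graph with one vertex or with two nonadjacent vertices, which
-- settles parts 1 and 2.  For (3,2^β), let Z = X_{K_(2^(β+1))} / (β + 1); then Z
-- has integral coefficients cⱼ ≥ 0 and X_{K_(3,2^β)} = e₁ Z + β Z′, where Z′ is
-- obtained from Z by joining one vertex.

module Submission where

open import Defs
open import Data.List.Base using (_∷_; length; replicate)
open import Data.List.Relation.Unary.All using (All)
open import Data.Nat.Base using (ℕ; _<_; _≤_)
open import Data.Product.Base using (∃-syntax; _×_)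
open import Data.Sum.Base using (_⊎_)
open import Function.Bundles using (_⇔_)
open import Relation.Binary.PropositionalEquality using (_≡_)

open import Data.Bool.Base using (true; false; if_then_else_)
open import Data.Empty using (⊥; ⊥-elim)
open import Data.Fin.Base using (Fin; zero; suc; _↑ˡ_; _↑ʳ_; splitAt)
open import Data.Fin.Properties as Fin using (splitAt-↑ˡ; splitAt-↑ʳ) renaming (_≟_ to _≟ᶠ_)
open import Data.Integer.Base as ℤ using (ℤ; 0ℤ; 1ℤ)
import Data.Integer.Properties as ℤ
open import Data.List.Base
  using (List; []; _++_; map; foldr; filter; applyUpTo; upTo; allFin; cartesianProductWith)
import Data.List.Membership.DecPropositional as DecMembership
open import Data.List.Membership.Propositional using (_∈_; _∉_)
import Data.List.Properties as List
open import Data.List.Relation.Unary.All as All using ([]; _∷_)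
import Data.List.Relation.Unary.All.Properties as All
open import Data.List.Relation.Unary.AllPairs using ([]; _∷_)
open import Data.List.Relation.Unary.Any using (Any; here; there)
open import Data.List.Relation.Unary.Linked as Linked using (Linked; []; [-]; _∷_)
open import Data.List.Relation.Unary.Unique.Propositional using (Unique)
open import Data.Nat.Base hiding (ℕ; _<_; _≤_)
open import Data.Nat.Combinatorics using (_C_; nC1≡n; nCn≡1; k>n⇒nCk≡0; nCk+nC[k+1]≡[n+1]C[k+1])
open import Data.Nat.Divisibility using (_∣_; divides; ∣m+n∣m⇒∣n)
open import Data.Nat.ListAction using (sum)
import Data.Nat.ListAction.Properties as Sum
open import Data.Nat.Properties
open import Data.Nat.Tactic.RingSolver using (solve-∀)
open import Data.Product.Base using (Σ-syntax; _,_; proj₁; proj₂)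
open import Data.Sum.Base using (inj₁; inj₂; [_,_]′)
open import Data.Vec.Base as Vec using (Vec; []; _∷_; lookup; updateAt; count)
import Data.Vec.Properties as Vec
import Data.Vec.Relation.Unary.All as VecAll
open import Data.Vec.Relation.Unary.All using ([]; _∷_)
open import Function.Base using (_∘_; id)
open import Function.Bundles using (mk⇔; module Equivalence)
open import Algebra.Properties.CommutativeSemigroup +-commutativeSemigroup using (interchange; x∙yz≈y∙xz)
open import Algebra.Properties.CommutativeSemigroup ℤ.+-commutativeSemigroup
  using () renaming (interchange to ℤ-interchange)
open import Relation.Binary.PropositionalEquality
  using (_≢_; refl; sym; trans; cong; cong₂; subst; subst₂; module ≡-Reasoning)
open import Relation.Nullary.Decidable
  using (Dec; yes; no; does; dec-true; dec-false; _×-dec_; map′; recompute; from-no)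
open import Relation.Nullary.Negation using (¬_)

-- All coefficients are natural numbers computed by recursion on the exponent vector: removing one
-- variable of exponent a turns e_μ into the operator `T a`, and adding a partite set into
-- `addPart`.
--
-- For necessity, "cannot be grouped" is certified by a weight with values 0, 1, 2 and a threshold
-- x, chosen separately in each case. The partition (4,3) escapes because (3,2,2) regroups as 3 and
-- 2 + 2, so only a comparison of counts rules it out.
--
-- For sufficiency all parts are at most 3 (apart from edgeless graphs), so a coefficient depends
-- only on the numbers a, b, c of exponents 1, 2, 3, and identities of symmetric functions become
-- arithmetic in a, b, c. For instance, e_{n-j} e_j has coefficient C(a, j-b) when c = 0 and a + 2b
-- = n, and X_{K_(2^β)} has coefficient a! β! / (a/2)! when a + 2b = 2β. Ratios of the latter values
-- give the formula for (3,2^β), but only multiplied by β + 1. Dividing the values is not enough,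
-- since the expansion itself must stay integral; hence divisibility is transferred from the values
-- to the cⱼ.

private variable
  A B D : Set
  m n : ℕ

-- Finite sums of natural numbers

sumOver : List A → (A → ℕ) → ℕ
sumOver xs f = sum (map f xs)

sumOver-cong : ∀ (xs : List A) {f g : A → ℕ} → (∀ x → f x ≡ g x) → sumOver xs f ≡ sumOver xs g
sumOver-cong []       f≗g = refl
sumOver-cong (x ∷ xs) f≗g = cong₂ _+_ (f≗g x) (sumOver-cong xs f≗g)

sumOver-zero : ∀ (xs : List A) {f : A → ℕ} → (∀ x → f x ≡ 0) → sumOver xs f ≡ 0
sumOver-zero []       f≗0 = refl
sumOver-zero (x ∷ xs) f≗0 = cong₂ _+_ (f≗0 x) (sumOver-zero xs f≗0)

sumOver-+ : ∀ (xs : List A) (f g : A → ℕ) →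
            sumOver xs (λ x → f x + g x) ≡ sumOver xs f + sumOver xs g
sumOver-+ []       f g = refl
sumOver-+ (x ∷ xs) f g =
  trans (cong (λ s → f x + g x + s) (sumOver-+ xs f g)) (interchange (f x) (g x) _ _)

sumOver-*ˡ : ∀ c (xs : List A) (f : A → ℕ) → sumOver xs (λ x → c * f x) ≡ c * sumOver xs f
sumOver-*ˡ c []       f = sym (*-zeroʳ c)
sumOver-*ˡ c (x ∷ xs) f =
  trans (cong (λ s → c * f x + s) (sumOver-*ˡ c xs f)) (sym (*-distribˡ-+ c (f x) _))

sumOver-++ : ∀ (xs ys : List A) (f : A → ℕ) → sumOver (xs ++ ys) f ≡ sumOver xs f + sumOver ys f
sumOver-++ xs ys f = trans (cong sum (List.map-++ f xs ys)) (Sum.sum-++ (map f xs) (map f ys))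

sumOver-map : ∀ (h : A → B) (xs : List A) (f : B → ℕ) → sumOver (map h xs) f ≡ sumOver xs (f ∘ h)
sumOver-map h xs f = cong sum (sym (List.map-∘ xs))

sumOver-cartesianProductWith : ∀ (h : A → B → D) (xs : List A) (ys : List B) (f : D → ℕ) →
  sumOver (cartesianProductWith h xs ys) f ≡ sumOver xs λ x → sumOver ys λ y → f (h x y)
sumOver-cartesianProductWith h []       ys f = refl
sumOver-cartesianProductWith h (x ∷ xs) ys f =
  trans (sumOver-++ (map (h x) ys) _ f)
        (cong₂ _+_ (sumOver-map (h x) ys f) (sumOver-cartesianProductWith h xs ys f))

sumOver-swap : ∀ (xs : List A) (ys : List B) (f : A → B → ℕ) →
  (sumOver xs λ x → sumOver ys λ y → f x y) ≡ (sumOver ys λ y → sumOver xs λ x → f x y)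
sumOver-swap []       ys f = sym (sumOver-zero ys λ _ → refl)
sumOver-swap (x ∷ xs) ys f =
  trans (cong (λ s → sumOver ys (f x) + s) (sumOver-swap xs ys f)) (sym (sumOver-+ ys (f x) _))

∑-pos : ∀ (xs : List A) {f : A → ℤ} {g : A → ℕ} → (∀ x → f x ≡ ℤ.+ g x) → ∑ (map f xs) ≡ ℤ.+ sumOver xs g
∑-pos []       f≗g = refl
∑-pos (x ∷ xs) {g = g} f≗g = trans (cong₂ ℤ._+_ (f≗g x) (∑-pos xs f≗g)) (sym (ℤ.pos-+ (g x) (sumOver xs g)))

-- Coefficients of products of elementary symmetric functions

-- `T a φ ks` sums φ over the lists obtained from ks by decrementing a of its
-- entries (chosen among the nonzero ones).  It extracts the coefficient of
-- x^a in one variable x, since e_k(x, y₁, y₂, …) = e_k(y) + x e_{k-1}(y).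
decr : (List ℕ → ℕ) → ℕ → List ℕ → ℕ
decr φ zero    ks = 0
decr φ (suc k) ks = φ (k ∷ ks)

T : ℕ → (List ℕ → ℕ) → List ℕ → ℕ
T zero    φ ks       = φ ks
T (suc a) φ []       = 0
T (suc a) φ (k ∷ ks) = T (suc a) (φ ∘ (k ∷_)) ks + T a (decr φ k) ks

T-cong : ∀ a {φ ψ} ks → (∀ ks → φ ks ≡ ψ ks) → T a φ ks ≡ T a ψ ks
decr-cong : ∀ {φ ψ} k ks → (∀ ks → φ ks ≡ ψ ks) → decr φ k ks ≡ decr ψ k ks

T-cong zero    ks       φ≗ψ = φ≗ψ ks
T-cong (suc a) []       φ≗ψ = refl
T-cong (suc a) (k ∷ ks) φ≗ψ =
  cong₂ _+_ (T-cong (suc a) ks (φ≗ψ ∘ (k ∷_))) (T-cong a ks λ ks′ → decr-cong k ks′ φ≗ψ)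

decr-cong zero    ks φ≗ψ = refl
decr-cong (suc k) ks φ≗ψ = φ≗ψ (k ∷ ks)

T-mono : ∀ a {φ ψ} ks → (∀ ks → φ ks ≤ ψ ks) → T a φ ks ≤ T a ψ ks
T-mono zero    ks       φ≤ψ = φ≤ψ ks
T-mono (suc a) []       φ≤ψ = z≤n
T-mono (suc a) (k ∷ ks) φ≤ψ =
  +-mono-≤ (T-mono (suc a) ks (φ≤ψ ∘ (k ∷_))) (T-mono a ks (decr-mono k))
  where
  decr-mono : ∀ k ks → decr _ k ks ≤ decr _ k ks
  decr-mono zero    ks = z≤n
  decr-mono (suc k) ks = φ≤ψ (k ∷ ks)

T-zero : ∀ a {φ} ks → (∀ ks → φ ks ≡ 0) → T a φ ks ≡ 0
T-zero zero    ks       φ≗0 = φ≗0 ks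
T-zero (suc a) []       φ≗0 = refl
T-zero (suc a) (k ∷ ks) φ≗0 =
  cong₂ _+_ (T-zero (suc a) ks (φ≗0 ∘ (k ∷_))) (T-zero a ks (decr-zero k))
  where
  decr-zero : ∀ k ks → decr _ k ks ≡ 0
  decr-zero zero    ks = refl
  decr-zero (suc k) ks = φ≗0 (k ∷ ks)

T-+ : ∀ a φ ψ ks → T a (λ ks → φ ks + ψ ks) ks ≡ T a φ ks + T a ψ ks
T-+ zero    φ ψ ks       = refl
T-+ (suc a) φ ψ []       = refl
T-+ (suc a) φ ψ (k ∷ ks) =
  trans (cong₂ _+_ (T-+ (suc a) _ _ ks)
                   (trans (T-cong a ks (decr-+ k)) (T-+ a (decr φ k) (decr ψ k) ks)))
        (interchange (T (suc a) (φ ∘ (k ∷_)) ks) _ _ _)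
  where
  decr-+ : ∀ k ks → decr (λ ks → φ ks + ψ ks) k ks ≡ decr φ k ks + decr ψ k ks
  decr-+ zero    ks = refl
  decr-+ (suc k) ks = refl

T-* : ∀ a c φ ks → T a (λ ks → c * φ ks) ks ≡ c * T a φ ks
T-* zero    c φ ks       = refl
T-* (suc a) c φ []       = sym (*-zeroʳ c)
T-* (suc a) c φ (k ∷ ks) =
  trans (cong₂ _+_ (T-* (suc a) c _ ks) (trans (T-cong a ks (decr-* k)) (T-* a c (decr φ k) ks)))
        (sym (*-distribˡ-+ c (T (suc a) (φ ∘ (k ∷_)) ks) _))
  where
  decr-* : ∀ k ks → decr (λ ks → c * φ ks) k ks ≡ c * decr φ k ks
  decr-* zero    ks = sym (*-zeroʳ c)
  decr-* (suc k) ks = refl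

T-sumOver : ∀ a (xs : List A) (w : A → ℕ) (φ : A → List ℕ → ℕ) ks →
  (sumOver xs λ x → w x * T a (φ x) ks) ≡ T a (λ ks → sumOver xs λ x → w x * φ x ks) ks
T-sumOver a []       w φ ks = sym (T-zero a ks λ _ → refl)
T-sumOver a (x ∷ xs) w φ ks =
  trans (cong₂ _+_ (sym (T-* a (w x) (φ x) ks)) (T-sumOver a xs w φ ks))
        (sym (T-+ a _ _ ks))

decr² : (List ℕ → ℕ) → ℕ → List ℕ → ℕ
decr² φ zero    ks = 0
decr² φ (suc k) ks = decr φ k ks

-- The four terms record whether the first entry is decremented by neither operator, by one of them,
-- or by both.
TT-cons : ∀ a b φ k ks → T (suc a) (T (suc b) φ) (k ∷ ks) ≡
  (T (suc a) (T (suc b) (φ ∘ (k ∷_))) ks + T (suc a) (T b (decr φ k)) ks) +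
  (T a (T (suc b) (decr φ k)) ks + T a (T b (decr² φ k)) ks)
TT-cons a b φ k ks =
  cong₂ _+_ (T-+ (suc a) _ _ ks) (trans (T-cong a ks (lemma k)) (T-+ a _ _ ks))
  where
  lemma : ∀ k ks → decr (T (suc b) φ) k ks ≡ T (suc b) (decr φ k) ks + T b (decr² φ k) ks
  lemma zero    ks = sym (cong₂ _+_ (T-zero (suc b) ks λ _ → refl) (T-zero b ks λ _ → refl))
  lemma (suc k) ks = refl

-- This is the symmetry of e_μ in two variables: exchanging a and b swaps the two middle terms of
-- `TT-cons`.
T-comm : ∀ a b φ ks → T a (T b φ) ks ≡ T b (T a φ) ks
T-comm zero    b       φ ks       = refl
T-comm (suc a) zero    φ ks       = refl
T-comm (suc a) (suc b) φ []       = refl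
T-comm (suc a) (suc b) φ (k ∷ ks) = begin
  T (suc a) (T (suc b) φ) (k ∷ ks)
    ≡⟨ TT-cons a b φ k ks ⟩
  (T (suc a) (T (suc b) (φ ∘ (k ∷_))) ks + T (suc a) (T b (decr φ k)) ks) +
  (T a (T (suc b) (decr φ k)) ks + T a (T b (decr² φ k)) ks)
    ≡⟨ cong₂ _+_ (cong₂ _+_ (T-comm (suc a) (suc b) _ ks) (T-comm (suc a) b _ ks))
                 (cong₂ _+_ (T-comm a (suc b) _ ks) (T-comm a b _ ks)) ⟩
  (T (suc b) (T (suc a) (φ ∘ (k ∷_))) ks + T b (T (suc a) (decr φ k)) ks) +
  (T (suc b) (T a (decr φ k)) ks + T b (T a (decr² φ k)) ks)
    ≡⟨ interchange (T (suc b) (T (suc a) (φ ∘ (k ∷_))) ks) _ _ _ ⟩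
  (T (suc b) (T (suc a) (φ ∘ (k ∷_))) ks + T (suc b) (T a (decr φ k)) ks) +
  (T b (T (suc a) (decr φ k)) ks + T b (T a (decr² φ k)) ks)
    ≡⟨ TT-cons b a φ k ks ⟨
  T (suc b) (T (suc a) φ) (k ∷ ks) ∎
  where open ≡-Reasoning

-- In the expansion by the first entry, the terms decrementing it never or twice are instances of
-- the same inequality. Those decrementing it once share the exponents (1 + a, 1 + b), so what
-- remains is to compare (2 + a, b) with (a, 2 + b).
T-balance : ∀ a b φ ks → b ≤ a → T (suc a) (T b φ) ks ≤ T a (T (suc b) φ) ks
T-balance zero    zero    φ ks       z≤n = ≤-refl
T-balance (suc a) zero    φ []       z≤n = z≤n
T-balance (suc a) zero    φ (k ∷ ks) z≤n = begin
  T (2 + a) (φ ∘ (k ∷_)) ks + T (suc a) (decr φ k) ks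
    ≤⟨ +-monoˡ-≤ _ (T-balance (suc a) 0 _ ks z≤n) ⟩
  T (suc a) (T 1 (φ ∘ (k ∷_))) ks + T (suc a) (decr φ k) ks
    ≤⟨ m≤m+n _ _ ⟩
  (T (suc a) (T 1 (φ ∘ (k ∷_))) ks + T (suc a) (decr φ k) ks) + _
    ≡⟨ TT-cons a 0 φ k ks ⟨
  T (suc a) (T 1 φ) (k ∷ ks) ∎
  where open ≤-Reasoning
T-balance (suc a) (suc b) φ []       (s≤s b≤a) = z≤n
T-balance (suc a) (suc b) φ (k ∷ ks) (s≤s b≤a) = begin
  T (2 + a) (T (suc b) φ) (k ∷ ks)
    ≡⟨ TT-cons (suc a) b φ k ks ⟩
  (T (2 + a) (T (suc b) φₖ) ks + T (2 + a) (T b (decr φ k)) ks) +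
  (T (suc a) (T (suc b) (decr φ k)) ks + T (suc a) (T b (decr² φ k)) ks)
    ≡⟨ interchange (T (2 + a) (T (suc b) φₖ) ks) _ _ _ ⟩
  (T (2 + a) (T (suc b) φₖ) ks + T (suc a) (T (suc b) (decr φ k)) ks) +
  (T (2 + a) (T b (decr φ k)) ks + T (suc a) (T b (decr² φ k)) ks)
    ≤⟨ +-mono-≤ (+-monoˡ-≤ _ (T-balance (suc a) (suc b) φₖ ks (s≤s b≤a)))
                (+-mono-≤ (middle (b ≟ a)) (T-balance a b (decr² φ k) ks b≤a)) ⟩
  (T (suc a) (T (2 + b) φₖ) ks + T (suc a) (T (suc b) (decr φ k)) ks) +
  (T a (T (2 + b) (decr φ k)) ks + T a (T (suc b) (decr² φ k)) ks)
    ≡⟨ TT-cons a (suc b) φ k ks ⟨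
  T (suc a) (T (2 + b) φ) (k ∷ ks) ∎
  where
  open ≤-Reasoning
  φₖ = φ ∘ (k ∷_)
  -- For b = a the two exponents merely trade places; for b < a there is room for two unit
  -- transfers.
  middle : Dec (b ≡ a) → T (2 + a) (T b (decr φ k)) ks ≤ T a (T (2 + b) (decr φ k)) ks
  middle (yes refl) = ≤-reflexive (T-comm (2 + a) a (decr φ k) ks)
  middle (no b≢a)   = ≤-trans (T-balance (suc a) b (decr φ k) ks (m≤n⇒m≤1+n b≤a))
                              (T-balance a (suc b) (decr φ k) ks (≤∧≢⇒< b≤a b≢a))

allZero : List ℕ → ℕ
allZero []           = 1
allZero (zero  ∷ ks) = allZero ks
allZero (suc _ ∷ ks) = 0

eCoeff : Vec ℕ m → List ℕ → ℕ
eCoeff []      = allZero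
eCoeff (a ∷ α) = T a (eCoeff α)

elem : ℕ → Vec ℕ m → ℕ
elem zero    []                 = 1
elem (suc k) []                 = 0
elem k       (zero ∷ α)         = elem k α
elem zero    (suc zero ∷ α)     = 0
elem (suc k) (suc zero ∷ α)     = elem k α
elem k       (suc (suc _) ∷ α)  = 0

Squarefree : ℕ → Vec ℕ m → Set
Squarefree k α = VecAll.All (_≤ 1) α × Vec.sum α ≡ k

elem-squarefree : ∀ k (α : Vec ℕ m) → Squarefree k α → elem k α ≡ 1
elem-squarefree zero    []             _                = refl
elem-squarefree (suc k) []             (_ , ())
elem-squarefree zero    (zero ∷ α)     (_ ∷ α≤1 , eq)   = elem-squarefree zero α (α≤1 , eq)
elem-squarefree (suc k) (zero ∷ α)     (_ ∷ α≤1 , eq)   = elem-squarefree (suc k) α (α≤1 , eq)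
elem-squarefree (suc k) (suc zero ∷ α) (_ ∷ α≤1 , eq)   = elem-squarefree k α (α≤1 , suc-injective eq)
elem-squarefree k (suc (suc _) ∷ α)    (s≤s () ∷ _ , _)

elem-¬squarefree : ∀ k (α : Vec ℕ m) → ¬ Squarefree k α → elem k α ≡ 0
elem-¬squarefree zero    []             ¬p = ⊥-elim (¬p ([] , refl))
elem-¬squarefree (suc k) []             ¬p = refl
elem-¬squarefree zero    (zero ∷ α)     ¬p = elem-¬squarefree zero α λ (p , eq) → ¬p (z≤n ∷ p , eq)
elem-¬squarefree (suc k) (zero ∷ α)     ¬p = elem-¬squarefree (suc k) α λ (p , eq) → ¬p (z≤n ∷ p , eq)
elem-¬squarefree zero    (suc zero ∷ α) ¬p = refl
elem-¬squarefree (suc k) (suc zero ∷ α) ¬p =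
  elem-¬squarefree k α λ (p , eq) → ¬p (s≤s z≤n ∷ p , cong suc eq)
elem-¬squarefree zero    (suc (suc _) ∷ α) ¬p = refl
elem-¬squarefree (suc k) (suc (suc _) ∷ α) ¬p = refl

elementary≡elem : ∀ k (α : Vec ℕ m) → elementary k m α ≡ ℤ.+ elem k α
elementary≡elem k α = lemma (VecAll.all? (_≤? 1) α ×-dec (Vec.sum α ≟ k))
  where
  lemma : (d : Dec (Squarefree k α)) → (if does d then ℤ.+ 1 else ℤ.+ 0) ≡ ℤ.+ elem k α
  lemma (yes p) = cong ℤ.+_ (sym (elem-squarefree k α p))
  lemma (no ¬p) = cong ℤ.+_ (sym (elem-¬squarefree k α ¬p))

one≡eCoeff : ∀ (α : Vec ℕ m) → one m α ≡ ℤ.+ eCoeff α []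
one≡eCoeff []          = refl
one≡eCoeff (zero ∷ α)  = one≡eCoeff α
one≡eCoeff (suc a ∷ α) = refl

-- The leading variable has exponent 0 or 1 in e_k, so only the first two rows of the convolution
-- survive; they are the two summands in the recursion of `T`.
elem-⊛-eCoeff : ∀ k ks (α : Vec ℕ m) →
  (sumOver (splittings α) λ (β , γ) → elem k β * eCoeff γ ks) ≡ eCoeff α (k ∷ ks)
elem-⊛-eCoeff zero    ks [] = solve₀ (allZero ks)
  where
  solve₀ : ∀ n → n + 0 + 0 ≡ n
  solve₀ = solve-∀
elem-⊛-eCoeff (suc k) ks [] = refl
elem-⊛-eCoeff k ks (a ∷ α) =
  trans (sumOver-cartesianProductWith _ (map (λ b → b , a ∸ b) (upTo (suc a))) (splittings α) _)
        (trans (sumOver-map (λ b → b , a ∸ b) (upTo (suc a)) _) (by-head a))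
  where
  row : ℕ → ℕ → ℕ
  row a b = sumOver (splittings α) λ (β , γ) → elem k (b ∷ β) * T (a ∸ b) (eCoeff γ) ks

  row-0 : ∀ a → row a 0 ≡ T a (eCoeff α ∘ (k ∷_)) ks
  row-0 a = begin
    row a 0
      ≡⟨ sumOver-cong (splittings α) (λ (β , γ) → cong (_* T a (eCoeff γ) ks) (elem-0 k β)) ⟩
    (sumOver (splittings α) λ (β , γ) → elem k β * T a (eCoeff γ) ks)
      ≡⟨ T-sumOver a (splittings α) (elem k ∘ proj₁) (eCoeff ∘ proj₂) ks ⟩
    T a (λ ks → sumOver (splittings α) λ (β , γ) → elem k β * eCoeff γ ks) ks
      ≡⟨ T-cong a ks (λ ks → elem-⊛-eCoeff k ks α) ⟩
    T a (eCoeff α ∘ (k ∷_)) ks ∎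
    where
    open ≡-Reasoning
    elem-0 : ∀ k (β : Vec ℕ m) → elem k (0 ∷ β) ≡ elem k β
    elem-0 zero    β = refl
    elem-0 (suc k) β = refl

  row-1 : ∀ a → row (suc a) 1 ≡ T a (decr (eCoeff α) k) ks
  row-1 a = with-k k
    where
    with-k : ∀ k → (sumOver (splittings α) λ (β , γ) → elem k (1 ∷ β) * T a (eCoeff γ) ks)
                   ≡ T a (decr (eCoeff α) k) ks
    with-k zero    = trans (sumOver-zero (splittings α) λ _ → refl) (sym (T-zero a ks λ _ → refl))
    with-k (suc k) =
      trans (T-sumOver a (splittings α) (elem k ∘ proj₁) (eCoeff ∘ proj₂) ks)
            (T-cong a ks λ ks → elem-⊛-eCoeff k ks α)

  elem-≥2 : ∀ k b (β : Vec ℕ m) → elem k (2 + b ∷ β) ≡ 0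
  elem-≥2 zero    b β = refl
  elem-≥2 (suc k) b β = refl

  sumOver-applyUpTo-zero : ∀ (f g : ℕ → ℕ) n → (∀ i → f (g i) ≡ 0) → sumOver (applyUpTo g n) f ≡ 0
  sumOver-applyUpTo-zero f g zero    f∘g≗0 = refl
  sumOver-applyUpTo-zero f g (suc n) f∘g≗0 =
    cong₂ _+_ (f∘g≗0 0) (sumOver-applyUpTo-zero f (g ∘ suc) n (f∘g≗0 ∘ suc))

  by-head : ∀ a → sumOver (upTo (suc a)) (row a) ≡ T a (eCoeff α) (k ∷ ks)
  by-head zero    = trans (+-identityʳ _) (row-0 0)
  by-head (suc a) = cong₂ _+_ (row-0 (suc a)) (trans (cong₂ _+_ (row-1 a) rest) (+-identityʳ _))
    where
    rest : sumOver (applyUpTo (λ i → 2 + i) a) (row (suc a)) ≡ 0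
    rest = sumOver-applyUpTo-zero (row (suc a)) (λ i → 2 + i) a λ i →
      sumOver-zero (splittings α) λ (β , γ) → cong (_* T (suc a ∸ (2 + i)) (eCoeff γ) ks) (elem-≥2 k i β)

foldr-elementary : ∀ ks (α : Vec ℕ m) → foldr _⊛_ one (map elementary ks) m α ≡ ℤ.+ eCoeff α ks
foldr-elementary []       α = one≡eCoeff α
foldr-elementary (k ∷ ks) α =
  trans (∑-pos (splittings α) λ (β , γ) →
           trans (cong₂ ℤ._*_ (elementary≡elem k β) (foldr-elementary ks γ)) (sym (ℤ.pos-* (elem k β) _)))
        (cong ℤ.+_ (elem-⊛-eCoeff k ks α))

e≡eCoeff : ∀ μ (α : Vec ℕ m) → e μ m α ≡ ℤ.+ eCoeff α (parts μ)
e≡eCoeff μ = foldr-elementary (parts μ)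

-- Unit transfers between exponents

infix 4 _⊵_

-- `balance` is the transfer that generates the dominance order; `exchange` and `prep` let it act on
-- any two variables.
data _⊵_ : Vec ℕ m → Vec ℕ m → Set where
  balance  : ∀ {a b} {α : Vec ℕ m} → b ≤ a → suc a ∷ b ∷ α ⊵ a ∷ suc b ∷ α
  exchange : ∀ {a b} {α : Vec ℕ m} → a ∷ b ∷ α ⊵ b ∷ a ∷ α
  prep     : ∀ a {α β : Vec ℕ m} → α ⊵ β → a ∷ α ⊵ a ∷ β
  _then_   : ∀ {α β γ : Vec ℕ m} → α ⊵ β → β ⊵ γ → α ⊵ γ

infixr 4 _then_

eCoeff-⊵ : ∀ {α β : Vec ℕ m} → α ⊵ β → ∀ ks → eCoeff α ks ≤ eCoeff β ks
eCoeff-⊵ (balance {α = α} b≤a)         ks = T-balance _ _ (eCoeff α) ks b≤a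
eCoeff-⊵ (exchange {a = a} {b} {α})    ks = ≤-reflexive (T-comm a b (eCoeff α) ks)
eCoeff-⊵ (prep a α⊵β)                  ks = T-mono a ks (eCoeff-⊵ α⊵β)
eCoeff-⊵ (α⊵β then β⊵γ)                ks = ≤-trans (eCoeff-⊵ α⊵β ks) (eCoeff-⊵ β⊵γ ks)

-- The coefficients of X_{K_λ} by colour

-- If `f` counts the proper colourings of a graph by content, then `addPart p f`
-- does so for its join with p isolated vertices: the first colour is used either
-- outside the new part or on a + 1 of its vertices, and then nowhere else.
addPart : ℕ → (Vec ℕ m → ℕ) → Vec ℕ m → ℕ
addPart zero    f []          = f []
addPart (suc p) f []          = 0
addPart p       f (zero ∷ α)  = addPart p (f ∘ (0 ∷_)) α
addPart p       f (suc a ∷ α) = addPart p (f ∘ (suc a ∷_)) α + (p C suc a) * addPart (p ∸ suc a) (f ∘ (0 ∷_)) α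

addPart-0∷ : ∀ p (f : Vec ℕ (suc m) → ℕ) α → addPart p f (0 ∷ α) ≡ addPart p (f ∘ (0 ∷_)) α
addPart-0∷ zero    f α = refl
addPart-0∷ (suc p) f α = refl

addPart-suc∷ : ∀ p (f : Vec ℕ (suc m) → ℕ) a α → addPart p f (suc a ∷ α) ≡
  addPart p (f ∘ (suc a ∷_)) α + (p C suc a) * addPart (p ∸ suc a) (f ∘ (0 ∷_)) α
addPart-suc∷ zero    f a α = refl
addPart-suc∷ (suc p) f a α = refl

addPart-cong : ∀ p {f g : Vec ℕ m → ℕ} → (∀ α → f α ≡ g α) → ∀ α → addPart p f α ≡ addPart p g α
addPart-cong zero    f≗g []          = f≗g []
addPart-cong (suc p) f≗g []          = refl
addPart-cong zero    f≗g (zero ∷ α)  = addPart-cong zero (f≗g ∘ (0 ∷_)) α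
addPart-cong (suc p) f≗g (zero ∷ α)  = addPart-cong (suc p) (f≗g ∘ (0 ∷_)) α
addPart-cong p {f} {g} f≗g (suc a ∷ α) = begin
  addPart p f (suc a ∷ α)
    ≡⟨ addPart-suc∷ p f a α ⟩
  addPart p (f ∘ (suc a ∷_)) α + (p C suc a) * addPart (p ∸ suc a) (f ∘ (0 ∷_)) α
    ≡⟨ cong₂ _+_ (addPart-cong p (f≗g ∘ (suc a ∷_)) α)
                 (cong ((p C suc a) *_) (addPart-cong (p ∸ suc a) (f≗g ∘ (0 ∷_)) α)) ⟩
  addPart p (g ∘ (suc a ∷_)) α + (p C suc a) * addPart (p ∸ suc a) (g ∘ (0 ∷_)) α
    ≡⟨ addPart-suc∷ p g a α ⟨
  addPart p g (suc a ∷ α) ∎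
  where open ≡-Reasoning

unit : Vec ℕ m → ℕ
unit α = eCoeff α []

χ : List ℕ → Vec ℕ m → ℕ
χ []       = unit
χ (p ∷ ps) = addPart p (χ ps)

-- Sums over all colourings of an edgeless graph

inc : Fin m → Vec ℕ m → Vec ℕ m
inc i β = updateAt β i suc

tabulate-inc : ∀ (x : Fin m) (h : Fin m → ℕ) →
  Vec.tabulate (λ i → (if does (i ≟ᶠ x) then suc else id) (h i)) ≡ inc x (Vec.tabulate h)
tabulate-inc zero    h = refl
tabulate-inc (suc x) h = cong (h zero ∷_) (tabulate-inc x (h ∘ suc))

content-∷ : ∀ (x : Fin m) (κ : Vec (Fin m) n) → content (x ∷ κ) ≡ inc x (content κ)
content-∷ x κ = tabulate-inc x λ i → count (i ≟ᶠ_) κ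

below : ℕ → (ℕ → ℕ) → ℕ
below zero    f = 0
below (suc n) f = f 0 + below n (f ∘ suc)

below-cong : ∀ n {f g : ℕ → ℕ} → (∀ i → i < n → f i ≡ g i) → below n f ≡ below n g
below-cong zero    f≗g = refl
below-cong (suc n) f≗g = cong₂ _+_ (f≗g 0 z<s) (below-cong n λ i i<n → f≗g (suc i) (s<s i<n))

below-zero : ∀ n {f : ℕ → ℕ} → (∀ i → i < n → f i ≡ 0) → below n f ≡ 0
below-zero zero    f≗0 = refl
below-zero (suc n) f≗0 = cong₂ _+_ (f≗0 0 z<s) (below-zero n λ i i<n → f≗0 (suc i) (s<s i<n))

below-+ : ∀ n (f g : ℕ → ℕ) → below n (λ i → f i + g i) ≡ below n f + below n g
below-+ zero    f g = refl
below-+ (suc n) f g =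
  trans (cong (λ s → f 0 + g 0 + s) (below-+ n (f ∘ suc) (g ∘ suc))) (interchange (f 0) (g 0) _ _)

below-last : ∀ n (f : ℕ → ℕ) → below (suc n) f ≡ below n f + f n
below-last zero    f = +-comm (f 0) 0
below-last (suc n) f = trans (cong (f 0 +_) (below-last n (f ∘ suc))) (sym (+-assoc (f 0) _ _))

below-single : ∀ n {f : ℕ → ℕ} j → j < n → (∀ i → i < n → i ≢ j → f i ≡ 0) → below n f ≡ f j
below-single (suc n) {f} zero    _         f≗0 =
  trans (cong (f 0 +_) (below-zero n λ i i<n → f≗0 (suc i) (s<s i<n) λ ())) (+-identityʳ (f 0))
below-single (suc n) (suc j) (s<s j<n) f≗0 =
  cong₂ _+_ (f≗0 0 z<s λ ())
            (below-single n j j<n λ i i<n i≢j → f≗0 (suc i) (s<s i<n) (i≢j ∘ suc-injective))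

sumOver-below : ∀ (xs : List A) n (f : ℕ → A → ℕ) →
  below n (λ b → sumOver xs (f b)) ≡ sumOver xs λ x → below n λ b → f b x
sumOver-below xs zero    f = sym (sumOver-zero xs λ _ → refl)
sumOver-below xs (suc n) f =
  trans (cong (λ s → sumOver xs (f 0) + s) (sumOver-below xs n (f ∘ suc))) (sym (sumOver-+ xs (f 0) _))

sumOver-allFin : ∀ m (f : Fin (suc m) → ℕ) →
  sumOver (allFin (suc m)) f ≡ f zero + sumOver (allFin m) (f ∘ suc)
sumOver-allFin m f = cong (λ s → f zero + sum s)
  (trans (List.map-tabulate suc f) (sym (List.map-tabulate id (f ∘ suc))))

-- `placements m p H` sums H(β) with multinomial weight p! / β! over the β with |β| = p.
placements : ∀ m → ℕ → (Vec ℕ m → ℕ) → ℕ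
placements zero    zero    H = H []
placements zero    (suc p) H = 0
placements (suc m) p       H = below (suc p) λ b → (p C b) * placements m (p ∸ b) (H ∘ (b ∷_))

placements-cong : ∀ m p {H I : Vec ℕ m → ℕ} → (∀ β → H β ≡ I β) → placements m p H ≡ placements m p I
placements-cong zero    zero    H≗I = H≗I []
placements-cong zero    (suc p) H≗I = refl
placements-cong (suc m) p       H≗I = below-cong (suc p) λ b _ →
  cong ((p C b) *_) (placements-cong m (p ∸ b) (H≗I ∘ (b ∷_)))

placements-zero : ∀ m p {H : Vec ℕ m → ℕ} → (∀ β → H β ≡ 0) → placements m p H ≡ 0
placements-zero zero    zero    H≗0 = H≗0 []
placements-zero zero    (suc p) H≗0 = refl
placements-zero (suc m) p       H≗0 = below-zero (suc p) λ b _ →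
  trans (cong ((p C b) *_) (placements-zero m (p ∸ b) (H≗0 ∘ (b ∷_)))) (*-zeroʳ (p C b))

-- Condition on the colour of one extra vertex: it is the first colour or a later one, and Pascal's
-- rule distributes the binomial weights accordingly.
placements-suc : ∀ m p (H : Vec ℕ m → ℕ) →
  placements m (suc p) H ≡ sumOver (allFin m) λ x → placements m p (H ∘ inc x)
placements-suc zero    p H = refl
placements-suc (suc m) p H = begin
  second 0 + below (suc p) (λ b → (suc p C suc b) * P (p ∸ b) (suc b))
    ≡⟨ cong (second 0 +_) (trans (below-cong (suc p) λ b _ → pascal b) (below-+ (suc p) first (second ∘ suc))) ⟩
  second 0 + (below (suc p) first + below (suc p) (second ∘ suc))
    ≡⟨ x∙yz≈y∙xz (second 0) (below (suc p) first) _ ⟩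
  below (suc p) first + below (2 + p) second
    -- The sum of `second` runs one term too far, to `suc p`, where the binomial coefficient
    -- vanishes.
    ≡⟨ cong (below (suc p) first +_) (trans (below-last (suc p) second)
         (trans (cong (below (suc p) second +_) vanish) (+-identityʳ (below (suc p) second)))) ⟩
  below (suc p) first + below (suc p) second
    ≡⟨ cong (below (suc p) first +_) (below-cong (suc p) λ b b≤p → by-IH b (s≤s⁻¹ b≤p)) ⟩
  below (suc p) first + below (suc p) (λ b → sumOver (allFin m) (third b))
    ≡⟨ cong (below (suc p) first +_) (sumOver-below (allFin m) (suc p) third) ⟩
  placements (suc m) p (H ∘ inc zero) +
    sumOver (allFin m) (λ x → placements (suc m) p (H ∘ inc (suc x)))
    ≡⟨ sumOver-allFin m (λ x → placements (suc m) p (H ∘ inc x)) ⟨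
  sumOver (allFin (suc m)) (λ x → placements (suc m) p (H ∘ inc x)) ∎
  where
  open ≡-Reasoning
  P : ℕ → ℕ → ℕ
  P q b = placements m q (H ∘ (b ∷_))
  first : ℕ → ℕ
  first b = (p C b) * P (p ∸ b) (suc b)
  second : ℕ → ℕ
  second b = (p C b) * P (suc p ∸ b) b
  third : ℕ → Fin m → ℕ
  third b x = (p C b) * placements m (p ∸ b) (H ∘ (b ∷_) ∘ inc x)
  pascal : ∀ b → (suc p C suc b) * P (p ∸ b) (suc b) ≡ first b + (p C suc b) * P (p ∸ b) (suc b)
  pascal b = trans (cong (_* P (p ∸ b) (suc b)) (sym (nCk+nC[k+1]≡[n+1]C[k+1] p b)))
                   (*-distribʳ-+ (P (p ∸ b) (suc b)) (p C b) (p C suc b))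
  vanish : second (suc p) ≡ 0
  vanish = cong (_* P (suc p ∸ suc p) (suc p)) (k>n⇒nCk≡0 (n<1+n p))
  by-IH : ∀ b → b ≤ p → second b ≡ sumOver (allFin m) (third b)
  by-IH b b≤p = begin
    (p C b) * P (suc p ∸ b) b
      ≡⟨ cong (λ q → (p C b) * P q b) (+-∸-assoc 1 b≤p) ⟩
    (p C b) * P (suc (p ∸ b)) b
      ≡⟨ cong ((p C b) *_) (placements-suc m (p ∸ b) (H ∘ (b ∷_))) ⟩
    (p C b) * sumOver (allFin m) (λ x → placements m (p ∸ b) (H ∘ (b ∷_) ∘ inc x))
      ≡⟨ sumOver-*ˡ (p C b) (allFin m) _ ⟨
    sumOver (allFin m) (third b) ∎

content-[] : ∀ m → content {m} [] ≡ Vec.replicate m 0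
content-[] zero    = refl
content-[] (suc m) = cong (0 ∷_) (content-[] m)

sumOver-content : ∀ m p (H : Vec ℕ m → ℕ) → sumOver (colourings m p) (H ∘ content) ≡ placements m p H
sumOver-content m zero    H = trans (+-identityʳ _) (trans (cong H (content-[] m)) (base m H))
  where
  base : ∀ m (H : Vec ℕ m → ℕ) → H (Vec.replicate m 0) ≡ placements m 0 H
  base zero    H = refl
  base (suc m) H = trans (base m (H ∘ (0 ∷_)))
    (sym (trans (+-identityʳ _) (*-identityˡ _)))
sumOver-content m (suc p) H = begin
  sumOver (colourings m (suc p)) (H ∘ content)
    ≡⟨ sumOver-cartesianProductWith _∷_ (allFin m) (colourings m p) (H ∘ content) ⟩
  (sumOver (allFin m) λ x → sumOver (colourings m p) λ κ → H (content (x ∷ κ)))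
    ≡⟨ sumOver-cong (allFin m) (λ x → trans
         (sumOver-cong (colourings m p) λ κ → cong H (content-∷ x κ))
         (sumOver-content m p (H ∘ inc x))) ⟩
  (sumOver (allFin m) λ x → placements m p (H ∘ inc x))
    ≡⟨ placements-suc m p H ⟨
  placements m (suc p) H ∎
  where open ≡-Reasoning

-- For f = `χ ps`, `extend f α β` counts the ways to complete a colouring of one
-- part of content β to a proper colouring of content α: no colour of the part
-- may be used again.
extend : (Vec ℕ m → ℕ) → Vec ℕ m → Vec ℕ m → ℕ
extend f []          []          = f []
extend f (a ∷ α)     (zero ∷ β)  = extend (f ∘ (a ∷_)) α β
extend f (a ∷ α)     (suc b ∷ β) with suc b ≟ a
... | yes _ = extend (f ∘ (0 ∷_)) α β
... | no  _ = 0

extend-same : ∀ (f : Vec ℕ (suc m) → ℕ) a α β →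
  extend f (suc a ∷ α) (suc a ∷ β) ≡ extend (f ∘ (0 ∷_)) α β
extend-same f a α β with suc a ≟ suc a
... | yes _  = refl
... | no a≢a = ⊥-elim (a≢a refl)

extend-different : ∀ (f : Vec ℕ (suc m) → ℕ) a b α β → suc b ≢ a → extend f (a ∷ α) (suc b ∷ β) ≡ 0
extend-different f a b α β b≢a with suc b ≟ a
... | yes b≡a = ⊥-elim (b≢a b≡a)
... | no _    = refl

-- In each coordinate `extend` kills every use of a colour by the part except none at all and the
-- whole exponent; these are the two summands of `addPart`.
placements-extend : ∀ p (f : Vec ℕ m → ℕ) α → placements m p (extend f α) ≡ addPart p f α
placements-extend zero    f []         = refl
placements-extend (suc p) f []         = refl
placements-extend {suc m} p f (a ∷ α) = cases a
  where
  open ≡-Reasoning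
  term : ℕ → ℕ → ℕ
  term a b = (p C b) * placements m (p ∸ b) (extend f (a ∷ α) ∘ (b ∷_))
  term-0 : ∀ a → term a 0 ≡ addPart p (f ∘ (a ∷_)) α
  term-0 a = trans (*-identityˡ _) (placements-extend p (f ∘ (a ∷_)) α)
  term-different : ∀ a b → suc b ≢ a → term a (suc b) ≡ 0
  term-different a b b≢a =
    trans (cong ((p C suc b) *_)
             (placements-zero m (p ∸ suc b) λ β → extend-different f a b α β b≢a))
          (*-zeroʳ (p C suc b))
  last : ∀ a → below p (term (suc a) ∘ suc) ≡ (p C suc a) * addPart (p ∸ suc a) (f ∘ (0 ∷_)) α
  last a with a <? p
  ... | yes a<p = begin
    below p (term (suc a) ∘ suc)
      ≡⟨ below-single p a a<p (λ b _ b≢a → term-different (suc a) b (b≢a ∘ suc-injective)) ⟩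
    (p C suc a) * placements m (p ∸ suc a) (extend f (suc a ∷ α) ∘ (suc a ∷_))
      ≡⟨ cong ((p C suc a) *_) (trans (placements-cong m (p ∸ suc a) (extend-same f a α))
                                      (placements-extend (p ∸ suc a) (f ∘ (0 ∷_)) α)) ⟩
    (p C suc a) * addPart (p ∸ suc a) (f ∘ (0 ∷_)) α ∎
  ... | no a≮p = trans
    (below-zero p λ b b<p → term-different (suc a) b λ { refl → a≮p b<p })
    (sym (cong (_* addPart (p ∸ suc a) (f ∘ (0 ∷_)) α) (k>n⇒nCk≡0 (s≤s (≮⇒≥ a≮p)))))
  cases : ∀ a → placements (suc m) p (extend f (a ∷ α)) ≡ addPart p f (a ∷ α)
  cases zero    = trans (cong₂ _+_ (term-0 0) (below-zero p λ b _ → term-different 0 b λ ()))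
                        (trans (+-identityʳ _) (sym (addPart-0∷ p f α)))
  cases (suc a) = trans (cong₂ _+_ (term-0 (suc a)) (last a)) (sym (addPart-suc∷ p f a α))

-- Proper colourings of a join, sorted by content

ind : ∀ {P : Set} → Dec P → ℕ
ind P? = if does P? then 1 else 0

ind-yes : ∀ {P : Set} (P? : Dec P) → P → ind P? ≡ 1
ind-yes P? p rewrite dec-true P? p = refl

ind-no : ∀ {P : Set} (P? : Dec P) → ¬ P → ind P? ≡ 0
ind-no P? ¬p rewrite dec-false P? ¬p = refl

length-filter-ind : ∀ {P : A → Set} (P? : ∀ x → Dec (P x)) xs → length (filter P? xs) ≡ sumOver xs (ind ∘ P?)
length-filter-ind P? []       = refl
length-filter-ind P? (x ∷ xs) with does (P? x)
... | true  = cong suc (length-filter-ind P? xs)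
... | false = length-filter-ind P? xs

sumOver-colourings-+ : ∀ m p {n} (F : Vec (Fin m) (p + n) → ℕ) →
  sumOver (colourings m (p + n)) F ≡
  sumOver (colourings m p) λ κ → sumOver (colourings m n) λ κ′ → F (κ Vec.++ κ′)
sumOver-colourings-+ m zero        F = sym (+-identityʳ _)
sumOver-colourings-+ m (suc p) {n} F = begin
  sumOver (colourings m (suc p + n)) F
    ≡⟨ sumOver-cartesianProductWith _∷_ (allFin m) (colourings m (p + n)) F ⟩
  (sumOver (allFin m) λ x → sumOver (colourings m (p + n)) λ κ → F (x ∷ κ))
    ≡⟨ sumOver-cong (allFin m) (λ x → sumOver-colourings-+ m p (F ∘ (x ∷_))) ⟩
  (sumOver (allFin m) λ x → sumOver (colourings m p) λ κ → rest (x ∷ κ))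
    ≡⟨ sumOver-cartesianProductWith _∷_ (allFin m) (colourings m p) rest ⟨
  sumOver (colourings m (suc p)) rest ∎
  where
  open ≡-Reasoning
  rest : Vec (Fin m) (suc p) → ℕ
  rest κ = sumOver (colourings m n) λ κ′ → F (κ Vec.++ κ′)

-- Says that α = β + γ with β and γ of disjoint support. The positive head in `left` gives each such
-- triple exactly one derivation and matches the case split of `extend`.
data Merge : Vec ℕ m → Vec ℕ m → Vec ℕ m → Set where
  []    : Merge [] [] []
  left  : ∀ {b} {β γ α : Vec ℕ m} → Merge β γ α → Merge (suc b ∷ β) (0 ∷ γ) (suc b ∷ α)
  right : ∀ {c} {β γ α : Vec ℕ m} → Merge β γ α → Merge (0 ∷ β) (c ∷ γ) (c ∷ α)

merge-tabulate : ∀ (f g : Fin m → ℕ) → (∀ i → f i ≡ 0 ⊎ g i ≡ 0) →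
  Merge (Vec.tabulate f) (Vec.tabulate g) (Vec.tabulate λ i → f i + g i)
merge-tabulate {zero}  f g disjoint = []
merge-tabulate {suc m} f g disjoint
  with f zero | g zero | disjoint zero | merge-tabulate (f ∘ suc) (g ∘ suc) (disjoint ∘ suc)
... | zero  | _ | _         | rest = right rest
... | suc b | _ | inj₂ refl | rest =
  subst (λ c → Merge (suc b ∷ Vec.tabulate (f ∘ suc)) (0 ∷ Vec.tabulate (g ∘ suc)) (suc c ∷ _))
        (sym (+-identityʳ b)) (left rest)

merge-tabulate⁻¹ : ∀ (f g : Fin m → ℕ) {α} → Merge (Vec.tabulate f) (Vec.tabulate g) α →
  (∀ i → f i ≡ 0 ⊎ g i ≡ 0) × Vec.tabulate (λ i → f i + g i) ≡ α
merge-tabulate⁻¹ {zero}  f g []  = (λ ()) , refl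
merge-tabulate⁻¹ {suc m} f g mrg = cases (f zero) (g zero) refl refl mrg
  where
  cases : ∀ b c {α} → f zero ≡ b → g zero ≡ c →
    Merge (b ∷ Vec.tabulate (f ∘ suc)) (c ∷ Vec.tabulate (g ∘ suc)) α →
    (∀ i → f i ≡ 0 ⊎ g i ≡ 0) × Vec.tabulate (λ i → f i + g i) ≡ α
  cases _ _ f₀ g₀ (left mrg) with merge-tabulate⁻¹ (f ∘ suc) (g ∘ suc) mrg
  ... | disjoint , eq = (λ { zero → inj₂ g₀ ; (suc i) → disjoint i }) ,
                        cong₂ _∷_ (trans (cong₂ _+_ f₀ g₀) (+-identityʳ _)) eq
  cases _ _ f₀ g₀ (right mrg) with merge-tabulate⁻¹ (f ∘ suc) (g ∘ suc) mrg
  ... | disjoint , eq = (λ { zero → inj₁ f₀ ; (suc i) → disjoint i }) ,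
                        cong₂ _∷_ (cong₂ _+_ f₀ g₀) eq

count-++ : ∀ i {p n} (κ : Vec (Fin m) p) (κ′ : Vec (Fin m) n) →
  count (i ≟ᶠ_) (κ Vec.++ κ′) ≡ count (i ≟ᶠ_) κ + count (i ≟ᶠ_) κ′
count-++ i []      κ′ = refl
count-++ i (x ∷ κ) κ′ with does (i ≟ᶠ x)
... | true  = cong suc (count-++ i κ κ′)
... | false = count-++ i κ κ′

count-lookup≢0 : ∀ (κ : Vec (Fin m) n) u → count (lookup κ u ≟ᶠ_) κ ≢ 0
count-lookup≢0 (x ∷ κ) zero rewrite dec-true (x ≟ᶠ x) refl = λ ()
count-lookup≢0 (x ∷ κ) (suc u) with does (lookup κ u ≟ᶠ x)
... | true  = λ ()
... | false = count-lookup≢0 κ u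

count≢0⇒lookup : ∀ i (κ : Vec (Fin m) n) → count (i ≟ᶠ_) κ ≡ 0 ⊎ ∃[ u ] i ≡ lookup κ u
count≢0⇒lookup i []      = inj₁ refl
count≢0⇒lookup i (x ∷ κ) with i ≟ᶠ x
... | yes i≡x = inj₂ (zero , i≡x)
... | no  _   with count≢0⇒lookup i κ
...   | inj₁ count≡0     = inj₁ count≡0
...   | inj₂ (u , i≡κu)  = inj₂ (suc u , i≡κu)

Avoid : ∀ {p n} → Vec (Fin m) p → Vec (Fin m) n → Set
Avoid κ κ′ = ∀ u v → lookup κ u ≢ lookup κ′ v

avoid⇒disjoint : ∀ {p n} (κ : Vec (Fin m) p) (κ′ : Vec (Fin m) n) → Avoid κ κ′ →
  ∀ i → count (i ≟ᶠ_) κ ≡ 0 ⊎ count (i ≟ᶠ_) κ′ ≡ 0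
avoid⇒disjoint κ κ′ avoid i with count≢0⇒lookup i κ | count≢0⇒lookup i κ′
... | inj₁ eq         | _               = inj₁ eq
... | inj₂ _          | inj₁ eq         = inj₂ eq
... | inj₂ (u , i≡κu) | inj₂ (v , i≡κv) = ⊥-elim (avoid u v (trans (sym i≡κu) i≡κv))

disjoint⇒avoid : ∀ {p n} (κ : Vec (Fin m) p) (κ′ : Vec (Fin m) n) →
  (∀ i → count (i ≟ᶠ_) κ ≡ 0 ⊎ count (i ≟ᶠ_) κ′ ≡ 0) → Avoid κ κ′
disjoint⇒avoid κ κ′ disjoint u v κu≡κv with disjoint (lookup κ u)
... | inj₁ eq = count-lookup≢0 κ u eq
... | inj₂ eq = count-lookup≢0 κ′ v (trans (cong (λ i → count (i ≟ᶠ_) κ′) (sym κu≡κv)) eq)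

module _ {m} p ps (κ : Vec (Fin m) p) (κ′ : Vec (Fin m) (sum ps)) where

  proper-++⇒ : Proper (completeMultipartite (p ∷ ps)) (κ Vec.++ κ′) →
               Proper (completeMultipartite ps) κ′ × Avoid κ κ′
  proper-++⇒ proper = proper′ , avoid
    where
    block-↑ˡ : ∀ u → block (p ∷ ps) (u ↑ˡ sum ps) ≡ zero
    block-↑ˡ u rewrite splitAt-↑ˡ p u (sum ps) = refl
    block-↑ʳ : ∀ v → block (p ∷ ps) (p ↑ʳ v) ≡ suc (block ps v)
    block-↑ʳ v rewrite splitAt-↑ʳ p (sum ps) v = refl
    proper′ : Proper (completeMultipartite ps) κ′
    proper′ u v u≁v κu≡κv = proper (p ↑ʳ u) (p ↑ʳ v)
      (λ eq → u≁v (Fin.suc-injective (trans (sym (block-↑ʳ u)) (trans eq (block-↑ʳ v)))))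
      (trans (Vec.lookup-++ʳ κ κ′ u) (trans κu≡κv (sym (Vec.lookup-++ʳ κ κ′ v))))
    avoid : Avoid κ κ′
    avoid u v κu≡κv = proper (u ↑ˡ sum ps) (p ↑ʳ v)
      (λ eq → Fin.0≢1+n (trans (sym (block-↑ˡ u)) (trans eq (block-↑ʳ v))))
      (trans (Vec.lookup-++ˡ κ κ′ u) (trans κu≡κv (sym (Vec.lookup-++ʳ κ κ′ v))))

  proper-++⇐ : Proper (completeMultipartite ps) κ′ → Avoid κ κ′ →
               Proper (completeMultipartite (p ∷ ps)) (κ Vec.++ κ′)
  proper-++⇐ proper avoid u v u≁v κu≡κv = cases (splitAt p u) (splitAt p v) u≁v
    (trans (sym (Vec.lookup-splitAt p κ κ′ u)) (trans κu≡κv (Vec.lookup-splitAt p κ κ′ v)))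
    where
    blk : Fin p ⊎ Fin (sum ps) → Fin (suc (length ps))
    blk = [ (λ _ → zero) , suc ∘ block ps ]′
    colour : Fin p ⊎ Fin (sum ps) → Fin m
    colour = [ lookup κ , lookup κ′ ]′
    cases : ∀ s t → blk s ≢ blk t → colour s ≢ colour t
    cases (inj₁ s) (inj₁ t) s≁t = λ _ → s≁t refl
    cases (inj₁ s) (inj₂ t) s≁t = avoid s t
    cases (inj₂ s) (inj₁ t) s≁t = avoid t s ∘ sym
    cases (inj₂ s) (inj₂ t) s≁t = proper s t (s≁t ∘ cong suc)

  -- Every vertex of the new part is adjacent to every vertex outside it, so properness splits into
  -- properness of the rest and disjointness of the two colour sets, and the latter is visible from
  -- the contents.
  proper-content-++ : ∀ α →
    (Proper (completeMultipartite (p ∷ ps)) (κ Vec.++ κ′) × content (κ Vec.++ κ′) ≡ α) ⇔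
    (Proper (completeMultipartite ps) κ′ × Merge (content κ) (content κ′) α)
  proper-content-++ α = mk⇔ to from
    where
    content-++ : content (κ Vec.++ κ′) ≡ Vec.tabulate (λ i → count (i ≟ᶠ_) κ + count (i ≟ᶠ_) κ′)
    content-++ = Vec.tabulate-cong λ i → count-++ i κ κ′
    to : _ → _
    to (proper , eq) with proper-++⇒ proper
    ... | proper′ , avoid = proper′ , subst (Merge _ _) (trans (sym content-++) eq)
                                            (merge-tabulate _ _ (avoid⇒disjoint κ κ′ avoid))
    from : _ → _
    from (proper′ , mrg) with merge-tabulate⁻¹ (λ i → count (i ≟ᶠ_) κ) (λ i → count (i ≟ᶠ_) κ′) mrg
    ... | disjoint , eq = proper-++⇐ proper′ (disjoint⇒avoid κ κ′ disjoint) , trans content-++ eq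

-- Together with `extend-¬merge`: when f is the Kronecker delta at γ, `extend f α β` is the
-- indicator of `Merge β γ α`.
extend-merge : ∀ (α β γ : Vec ℕ m) (f : Vec ℕ m → ℕ) → f γ ≡ 1 → Merge β γ α → extend f α β ≡ 1
extend-merge _ _ _ f fγ≡1 []                = fγ≡1
extend-merge _ _ _ f fγ≡1 (left {b = b} mrg) =
  trans (extend-same f b _ _) (extend-merge _ _ _ _ fγ≡1 mrg)
extend-merge _ _ _ f fγ≡1 (right mrg)       = extend-merge _ _ _ _ fγ≡1 mrg

extend-zero : ∀ (α β : Vec ℕ m) (f : Vec ℕ m → ℕ) → (∀ δ → f δ ≡ 0) → extend f α β ≡ 0
extend-zero []      []          f f≗0 = f≗0 []
extend-zero (a ∷ α) (zero ∷ β)  f f≗0 = extend-zero α β _ (f≗0 ∘ (a ∷_))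
extend-zero (a ∷ α) (suc b ∷ β) f f≗0 with suc b ≟ a
... | yes _ = extend-zero α β _ (f≗0 ∘ (0 ∷_))
... | no  _ = refl

extend-¬merge : ∀ (α β γ : Vec ℕ m) (f : Vec ℕ m → ℕ) → (∀ δ → δ ≢ γ → f δ ≡ 0) →
  ¬ Merge β γ α → extend f α β ≡ 0
extend-¬merge []      []          []      f f≡0 ¬mrg = ⊥-elim (¬mrg [])
extend-¬merge (a ∷ α) (zero ∷ β)  (c ∷ γ) f f≡0 ¬mrg with a ≟ c
... | yes refl = extend-¬merge α β γ _ (λ δ δ≢γ → f≡0 _ (δ≢γ ∘ Vec.∷-injectiveʳ)) (¬mrg ∘ right)
... | no  a≢c  = extend-zero α β _ λ δ → f≡0 _ (a≢c ∘ Vec.∷-injectiveˡ)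
extend-¬merge (a ∷ α) (suc b ∷ β) (c ∷ γ) f f≡0 ¬mrg with suc b ≟ a
... | no _     = refl
... | yes refl with c
...   | zero  = extend-¬merge α β γ _ (λ δ δ≢γ → f≡0 _ (δ≢γ ∘ Vec.∷-injectiveʳ)) (¬mrg ∘ left)
...   | suc c = extend-zero α β _ λ δ → f≡0 _ λ ()

-- Linearity in f, used to recombine the deltas of the individual colourings of the other parts into
-- their counting function.
extend-sumOver : ∀ (xs : List A) (w : A → ℕ) (f : A → Vec ℕ m → ℕ) α β →
  (sumOver xs λ x → w x * extend (f x) α β) ≡ extend (λ γ → sumOver xs λ x → w x * f x γ) α β
extend-sumOver xs w f []      []          = refl
extend-sumOver xs w f (a ∷ α) (zero ∷ β)  = extend-sumOver xs w (λ x → f x ∘ (a ∷_)) α β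
extend-sumOver xs w f (a ∷ α) (suc b ∷ β) with suc b ≟ a
... | yes _ = extend-sumOver xs w (λ x → f x ∘ (0 ∷_)) α β
... | no  _ = sumOver-zero xs λ x → *-zeroʳ (w x)

extend-cong : ∀ {f g : Vec ℕ m → ℕ} → (∀ γ → f γ ≡ g γ) → ∀ α β → extend f α β ≡ extend g α β
extend-cong f≗g []      []          = f≗g []
extend-cong f≗g (a ∷ α) (zero ∷ β)  = extend-cong (f≗g ∘ (a ∷_)) α β
extend-cong f≗g (a ∷ α) (suc b ∷ β) with suc b ≟ a
... | yes _ = extend-cong (f≗g ∘ (0 ∷_)) α β
... | no  _ = refl

_≟ᵛ_ : (α β : Vec ℕ m) → Dec (α ≡ β)
_≟ᵛ_ = Vec.≡-dec _≟_

module _ (m : ℕ) where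

  countProper : ∀ ps → Vec ℕ m → ℕ
  countProper ps α = sumOver (colourings m (sum ps)) λ κ →
    ind (proper? (completeMultipartite ps) κ ×-dec (content κ ≟ᵛ α))

  ind-proper-++ : ∀ p ps (κ : Vec (Fin m) p) (κ′ : Vec (Fin m) (sum ps)) α →
    ind (proper? (completeMultipartite (p ∷ ps)) (κ Vec.++ κ′) ×-dec (content (κ Vec.++ κ′) ≟ᵛ α)) ≡
    ind (proper? (completeMultipartite ps) κ′) * extend (λ γ → ind (content κ′ ≟ᵛ γ)) α (content κ)
  ind-proper-++ p ps κ κ′ α = decide (proper? (completeMultipartite ps) κ′)
    where
    iff = proper-content-++ p ps κ κ′ α
    both? = proper? (completeMultipartite (p ∷ ps)) (κ Vec.++ κ′) ×-dec (content (κ Vec.++ κ′) ≟ᵛ α)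
    δ : Vec ℕ m → ℕ
    δ γ = ind (content κ′ ≟ᵛ γ)
    decide : (d : Dec (Proper (completeMultipartite ps) κ′)) → ind both? ≡ ind d * extend δ α (content κ)
    decide (no ¬proper) = ind-no both? (¬proper ∘ proj₁ ∘ Equivalence.to iff)
    decide (yes proper) = trans (same both?) (sym (*-identityˡ _))
      where
      same : (d : Dec _) → ind d ≡ extend δ α (content κ)
      same (yes both) = sym (extend-merge α (content κ) (content κ′) δ
        (ind-yes (content κ′ ≟ᵛ content κ′) refl) (proj₂ (Equivalence.to iff both)))
      same (no ¬both) = sym (extend-¬merge α (content κ) (content κ′) δ
        (λ γ γ≢ → ind-no (content κ′ ≟ᵛ γ) (γ≢ ∘ sym))
        (λ mrg → ¬both (Equivalence.from iff (proper , mrg))))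

  ind-× : ∀ {P Q : Set} (P? : Dec P) (Q? : Dec Q) → ind P? * ind Q? ≡ ind (P? ×-dec Q?)
  ind-× (yes _) (yes _) = refl
  ind-× (yes _) (no  _) = refl
  ind-× (no  _) _       = refl

  -- Once the indicator factors, the colourings of the other parts collapse into `countProper ps`
  -- inside `extend`, and those of the new part matter only through their content.
  countProper-∷ : ∀ p ps α → countProper (p ∷ ps) α ≡ addPart p (countProper ps) α
  countProper-∷ p ps α = begin
    countProper (p ∷ ps) α
      ≡⟨ sumOver-colourings-+ m p _ ⟩
    (sumOver (colourings m p) λ κ → sumOver (colourings m (sum ps)) λ κ′ → _)
      ≡⟨ (sumOver-cong (colourings m p) λ κ → trans
           (sumOver-cong (colourings m (sum ps)) λ κ′ → ind-proper-++ p ps κ κ′ α)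
           (trans (extend-sumOver (colourings m (sum ps)) (λ κ′ → ind (proper? (completeMultipartite ps) κ′))
                     (λ κ′ γ → ind (content κ′ ≟ᵛ γ)) α (content κ))
                  (extend-cong (λ γ → sumOver-cong (colourings m (sum ps)) λ κ′ →
                     ind-× (proper? (completeMultipartite ps) κ′) (content κ′ ≟ᵛ γ)) α (content κ)))) ⟩
    (sumOver (colourings m p) λ κ → extend (countProper ps) α (content κ))
      ≡⟨ sumOver-content m p (extend (countProper ps) α) ⟩
    placements m p (extend (countProper ps) α)
      ≡⟨ placements-extend p (countProper ps) α ⟩
    addPart p (countProper ps) α ∎
    where open ≡-Reasoning

  countProper-[] : ∀ α → countProper [] α ≡ unit α
  countProper-[] α = trans (+-identityʳ _) (lemma (content [] ≟ᵛ α))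
    where
    unit-replicate : ∀ m → unit (Vec.replicate m 0) ≡ 1
    unit-replicate zero    = refl
    unit-replicate (suc m) = unit-replicate m
    unit-nonzero : ∀ {m} (α : Vec ℕ m) → α ≢ Vec.replicate m 0 → unit α ≡ 0
    unit-nonzero []          α≢0 = ⊥-elim (α≢0 refl)
    unit-nonzero (zero ∷ α)  α≢0 = unit-nonzero α (α≢0 ∘ cong (0 ∷_))
    unit-nonzero (suc a ∷ α) α≢0 = refl
    lemma : (d : Dec (content [] ≡ α)) → ind d ≡ unit α
    lemma (yes refl) = sym (trans (cong unit (content-[] m)) (unit-replicate m))
    lemma (no ≢α)    = sym (unit-nonzero α λ eq → ≢α (trans (content-[] m) (sym eq)))

  countProper≡χ : ∀ ps α → countProper ps α ≡ χ ps α
  countProper≡χ []       α = countProper-[] α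
  countProper≡χ (p ∷ ps) α = trans (countProper-∷ p ps α) (addPart-cong p (countProper≡χ ps) α)

chromatic≡χ : ∀ lam (α : Vec ℕ m) → chromatic (K lam) m α ≡ ℤ.+ χ (parts lam) α
chromatic≡χ {m} lam α = cong ℤ.+_ (trans
  (length-filter-ind (λ κ → proper? (K lam) κ ×-dec (content κ ≟ᵛ α)) (colourings m (size lam)))
  (countProper≡χ m (parts lam) α))

-- Necessity

∑-mono : ∀ (xs : List A) {f g : A → ℤ} → (∀ x → f x ℤ.≤ g x) → ∑ (map f xs) ℤ.≤ ∑ (map g xs)
∑-mono []       f≤g = ℤ.≤-refl
∑-mono (x ∷ xs) f≤g = ℤ.+-mono-≤ (f≤g x) (∑-mono xs f≤g)

e-positive-⊵ : ∀ {f} → EPositive f → ∀ {m} {α β : Vec ℕ m} → α ⊵ β → f m α ℤ.≤ f m β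
e-positive-⊵ {f} (E , coeff≥0) {m} {α} {β} α⊵β =
  subst₂ ℤ._≤_ (sym (expands E m α)) (sym (expands E m β)) (∑-mono (support E) λ μ →
    ℤ.*-monoˡ-≤-nonNeg (coeff E μ) {{ℤ.nonNegative (coeff≥0 μ)}}
      (subst₂ ℤ._≤_ (sym (e≡eCoeff μ α)) (sym (e≡eCoeff μ β)) (ℤ.+≤+ (eCoeff-⊵ α⊵β (parts μ)))))

-- A subadditive weight, so that splitting a part among several colours cannot
-- lower the total weight.
weight : ℕ → ℕ → ℕ
weight x zero    = 0
weight x (suc v) = suc (ind (x ≤? suc v))

weight-small : ∀ {x v} → 0 < v → v < x → weight x v ≡ 1
weight-small {x} {suc v} _ v<x = cong suc (ind-no (x ≤? suc v) (<⇒≱ v<x))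

weight-large : ∀ {x v} → 0 < v → x ≤ v → weight x v ≡ 2
weight-large {x} {suc v} _ x≤v = cong suc (ind-yes (x ≤? suc v) x≤v)

ind≤1 : ∀ {P : Set} (P? : Dec P) → ind P? ≤ 1
ind≤1 (yes _) = ≤-refl
ind≤1 (no  _) = z≤n

weight≤2 : ∀ x v → weight x v ≤ 2
weight≤2 x zero    = z≤n
weight≤2 x (suc v) = s≤s (ind≤1 (x ≤? suc v))

-- Two positive arguments contribute at least 1 each, and no weight exceeds 2.
weight-subadditive : ∀ x a b → weight x (a + b) ≤ weight x a + weight x b
weight-subadditive x zero    b       = ≤-refl
weight-subadditive x (suc a) zero    =
  ≤-reflexive (trans (cong (weight x ∘ suc) (+-identityʳ a)) (sym (+-identityʳ _)))
weight-subadditive x (suc a) (suc b) =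
  ≤-trans (weight≤2 x (suc a + suc b)) (+-mono-≤ (s≤s {n = ind (x ≤? suc a)} z≤n) (s≤s z≤n))

weightᴸ : ℕ → List ℕ → ℕ
weightᴸ x []       = 0
weightᴸ x (p ∷ ps) = weight x p + weightᴸ x ps

weightⱽ : ℕ → Vec ℕ m → ℕ
weightⱽ x []      = 0
weightⱽ x (a ∷ α) = weight x a + weightⱽ x α

weightⱽ-fromList : ∀ x ps → weightⱽ x (Vec.fromList ps) ≡ weightᴸ x ps
weightⱽ-fromList x []       = refl
weightⱽ-fromList x (p ∷ ps) = cong (weight x p +_) (weightⱽ-fromList x ps)

0<+⇒ : ∀ a {b} → 0 < a + b → 0 < a ⊎ 0 < b
0<+⇒ zero    0<b = inj₂ 0<b
0<+⇒ (suc a) _   = inj₁ z<s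

0<*⇒ : ∀ a b → 0 < a * b → 0 < a × 0 < b
0<*⇒ zero    b       ()
0<*⇒ (suc a) zero    0<ab = ⊥-elim (<-irrefl (sym (*-zeroʳ a)) 0<ab)
0<*⇒ (suc a) (suc b) _    = z<s , z<s

0<C⇒≤ : ∀ n k → 0 < n C k → k ≤ n
0<C⇒≤ n k 0<nCk with k ≤? n
... | yes k≤n = k≤n
... | no  k≰n = ⊥-elim (<-irrefl (sym (k>n⇒nCk≡0 (≰⇒> k≰n))) 0<nCk)

-- Here γ is what the new part leaves of α: each colour it uses is used up and becomes 0. The
-- exponents used up add to p, so by subadditivity they pay for `weight x p`.
addPart-weight : ∀ x p (f : Vec ℕ m → ℕ) α → 0 < addPart p f α →
  ∃[ γ ] (0 < f γ × weight x p + weightⱽ x γ ≤ weightⱽ x α)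
addPart-weight x zero    f []          0<f = [] , 0<f , z≤n
addPart-weight x (suc p) f []          ()
addPart-weight x p f (zero ∷ α) 0<f
  with addPart-weight x p (f ∘ (0 ∷_)) α (subst (0 <_) (addPart-0∷ p f α) 0<f)
... | γ , 0<fγ , le = 0 ∷ γ , 0<fγ , le
addPart-weight x p f (suc a ∷ α) 0<f
  with 0<+⇒ (addPart p (f ∘ (suc a ∷_)) α) (subst (0 <_) (addPart-suc∷ p f a α) 0<f)
... | inj₁ 0<f₁ with addPart-weight x p (f ∘ (suc a ∷_)) α 0<f₁
...   | γ , 0<fγ , le = suc a ∷ γ , 0<fγ , (begin
  weight x p + (weight x (suc a) + weightⱽ x γ) ≡⟨ x∙yz≈y∙xz (weight x p) (weight x (suc a)) _ ⟩
  weight x (suc a) + (weight x p + weightⱽ x γ) ≤⟨ +-monoʳ-≤ (weight x (suc a)) le ⟩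
  weight x (suc a) + weightⱽ x α               ∎)
  where
  open ≤-Reasoning
addPart-weight x p f (suc a ∷ α) 0<f | inj₂ 0<f₂ with 0<*⇒ (p C suc a) _ 0<f₂
... | 0<C , 0<f₀ with addPart-weight x (p ∸ suc a) (f ∘ (0 ∷_)) α 0<f₀
...   | γ , 0<fγ , le = 0 ∷ γ , 0<fγ , (begin
  weight x p + weightⱽ x γ
    -- The truncated subtraction is exact because the binomial coefficient is nonzero.
    ≡⟨ cong (λ q → weight x q + weightⱽ x γ) (m+[n∸m]≡n (0<C⇒≤ p (suc a) 0<C)) ⟨
  weight x (suc a + (p ∸ suc a)) + weightⱽ x γ
    ≤⟨ +-monoˡ-≤ _ (weight-subadditive x (suc a) (p ∸ suc a)) ⟩
  weight x (suc a) + weight x (p ∸ suc a) + weightⱽ x γ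
    ≡⟨ +-assoc (weight x (suc a)) _ _ ⟩
  weight x (suc a) + (weight x (p ∸ suc a) + weightⱽ x γ)
    ≤⟨ +-monoʳ-≤ (weight x (suc a)) le ⟩
  weight x (suc a) + weightⱽ x α ∎)
  where open ≤-Reasoning

χ-weight : ∀ x ps (α : Vec ℕ m) → 0 < χ ps α → weightᴸ x ps ≤ weightⱽ x α
χ-weight x []       α 0<χ = z≤n
χ-weight x (p ∷ ps) α 0<χ with addPart-weight x p (χ ps) α 0<χ
... | γ , 0<χγ , le = ≤-trans (+-monoʳ-≤ (weight x p) (χ-weight x ps γ 0<χγ)) le

addPart-zero : ∀ (f : Vec ℕ m → ℕ) α → addPart 0 f α ≡ f α
addPart-zero f []          = refl
addPart-zero f (zero ∷ α)  = addPart-zero (f ∘ (0 ∷_)) α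
addPart-zero f (suc a ∷ α) = trans (+-identityʳ _) (addPart-zero (f ∘ (suc a ∷_)) α)

χ-0∷ : ∀ ps (α : Vec ℕ m) → χ ps (0 ∷ α) ≡ χ ps α
χ-0∷ []       α = refl
χ-0∷ (p ∷ ps) α = trans (addPart-0∷ p (χ ps) α) (addPart-cong p (χ-0∷ ps) α)

χ-monochromatic : ∀ ps → All (0 <_) ps → 0 < χ ps (Vec.fromList ps)
χ-monochromatic []           _         = z<s
χ-monochromatic (suc p ∷ ps) (_ ∷ 0<ps) = begin-strict
  0
    <⟨ χ-monochromatic ps 0<ps ⟩
  χ ps (Vec.fromList ps)
    ≡⟨ trans (addPart-zero (χ ps ∘ (0 ∷_)) (Vec.fromList ps)) (χ-0∷ ps (Vec.fromList ps)) ⟨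
  addPart 0 (χ ps ∘ (0 ∷_)) (Vec.fromList ps)
    ≡⟨ cong (λ q → addPart q (χ ps ∘ (0 ∷_)) (Vec.fromList ps)) (n∸n≡0 p) ⟨
  addPart (p ∸ p) (χ ps ∘ (0 ∷_)) (Vec.fromList ps)
    ≡⟨ trans (cong (_* addPart (p ∸ p) (χ ps ∘ (0 ∷_)) (Vec.fromList ps)) (nCn≡1 (suc p))) (*-identityˡ _) ⟨
  (suc p C suc p) * addPart (p ∸ p) (χ ps ∘ (0 ∷_)) (Vec.fromList ps)
    ≤⟨ m≤n+m _ _ ⟩
  χ (suc p ∷ ps) (suc p ∷ Vec.fromList ps) ∎
  where open ≤-Reasoning

-- The threshold is y itself: y falls below it and loses 1, while z + 1 still lies below. Positivity
-- of z ensures that no new positive exponent appears.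
spread : ∀ y zs → Any (λ z → 0 < z × 2 + z ≤ y) zs →
  ∃[ β ] (y ∷ Vec.fromList zs ⊵ β × weightⱽ y β < weightᴸ y (y ∷ zs))
spread (suc y) (z ∷ zs) (here (0<z , s≤s z<y)) =
  y ∷ suc z ∷ Vec.fromList zs , balance (<⇒≤ z<y) , (begin-strict
    weight (suc y) y + (weight (suc y) (suc z) + weightⱽ (suc y) (Vec.fromList zs))
      ≡⟨ cong₂ (λ a b → a + (b + weightⱽ (suc y) (Vec.fromList zs))) (weight-small (≤-<-trans z≤n z<y) ≤-refl) (weight-small z<s (s≤s z<y)) ⟩
    2 + weightⱽ (suc y) (Vec.fromList zs)
      <⟨ s≤s (s≤s (s≤s (≤-reflexive (weightⱽ-fromList (suc y) zs)))) ⟩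
    3 + weightᴸ (suc y) zs
      ≡⟨ cong₂ (λ a b → a + (b + weightᴸ (suc y) zs)) (weight-large {suc y} z<s ≤-refl) (weight-small 0<z (<-trans z<y ≤-refl)) ⟨
    weight (suc y) (suc y) + (weight (suc y) z + weightᴸ (suc y) zs) ∎)
  where open ≤-Reasoning
spread y (z ∷ zs) (there any) with spread y zs any
... | β , ⊵β , lt = z ∷ β , (exchange then prep z ⊵β) ,
  subst (weight y z + weightⱽ y β <_) (x∙yz≈y∙xz (weight y z) (weight y y) _) (+-monoʳ-< (weight y z) lt)

-- Each equal part sheds one unit into the spare variable. At threshold `2 + y` the weight falls
-- from 4 to 3, provided y > 0.
split-equal : ∀ y {α : Vec ℕ m} → 0 ∷ 2 + y ∷ 2 + y ∷ α ⊵ 1 + y ∷ 1 + y ∷ 2 ∷ α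
split-equal y = exchange then balance z≤n then prep (1 + y) (exchange then balance (s≤s z≤n))

-- The larger part sheds two units, the smaller one. At threshold `3 + y` the weight falls from 4 to
-- 3, provided y > 0; for y = 0 the exponents 2, 2, 3 regroup into 4 and 3.
split-consecutive : ∀ y {α : Vec ℕ m} → 0 ∷ 4 + y ∷ 3 + y ∷ α ⊵ 2 + y ∷ 2 + y ∷ 3 ∷ α
split-consecutive y =
  exchange then balance z≤n then balance (s≤s z≤n) then
  prep (2 + y) (exchange then balance (s≤s (s≤s z≤n)))

decreasing-≤ : ∀ {p ps} → Linked _≥_ (p ∷ ps) → All (_≤ p) ps
decreasing-≤ [-]         = []
decreasing-≤ (p≥q ∷ lnk) = p≥q ∷ All.map (λ r≤q → ≤-trans r≤q p≥q) (decreasing-≤ lnk)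

all≡⇒replicate : ∀ {x : ℕ} {xs} → All (_≡ x) xs → xs ≡ replicate (length xs) x
all≡⇒replicate []           = refl
all≡⇒replicate (refl ∷ all) = cong (_ ∷_) (all≡⇒replicate all)

Exceptional : List ℕ → Set
Exceptional ps = length ps ≡ 1
               ⊎ All (λ p → p ≡ 1 ⊎ p ≡ 2) ps
               ⊎ (∃[ β ] (1 ≤ β × ps ≡ 3 ∷ replicate β 2))

one-or-two : ∀ {p} → 0 < p → p ≤ 2 → p ≡ 1 ⊎ p ≡ 2
one-or-two {1} _ _ = inj₁ refl
one-or-two {2} _ _ = inj₂ refl
one-or-two {suc (suc (suc _))} _ (s≤s (s≤s ()))

-- For (3,3,1) the part of size 3 takes either colour of exponent 3 and the other part can be
-- coloured in C(4,3) ways, giving 2 · 4. For (3,2,2) the part of size 3 has no choice and C(4,2) =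
-- 6 ways remain.
χ-43 : ¬ χ (4 ∷ 3 ∷ []) (3 ∷ 3 ∷ 1 ∷ []) ≤ χ (4 ∷ 3 ∷ []) (3 ∷ 2 ∷ 2 ∷ [])
χ-43 le = from-no (8 ≤? 6) (subst₂ _≤_ χ-331 χ-322 le)
  where
  χ-331 : χ (4 ∷ 3 ∷ []) (3 ∷ 3 ∷ 1 ∷ []) ≡ 8
  χ-331 = refl
  χ-322 : χ (4 ∷ 3 ∷ []) (3 ∷ 2 ∷ 2 ∷ []) ≡ 6
  χ-322 = refl

-- Colourings enter only through the two weight inequalities. The one with a leading 0 provides the
-- spare variable into which two large parts shed units.
exceptional : ∀ ps → All (0 <_) ps → Linked _≥_ ps →
  (∀ x {β} → Vec.fromList ps ⊵ β → weightᴸ x ps ≤ weightⱽ x β) →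
  (∀ x {β} → 0 ∷ Vec.fromList ps ⊵ β → weightᴸ x ps ≤ weightⱽ x β) →
  ps ≢ 4 ∷ 3 ∷ [] → Exceptional ps
exceptional []       _ _ _ _ _ = inj₂ (inj₁ [])
exceptional (p ∷ []) _ _ _ _ _ = inj₁ refl
exceptional ps@(p ∷ qs@(q ∷ rs)) (0<p ∷ 0<qs) ps≥ heavy heavy-0∷ ps≢43 = by-size p refl
  where
  qs≤p : All (_≤ p) qs
  qs≤p = decreasing-≤ ps≥

  -- A part smaller than p by 2 or more would let `spread` lower the weight at threshold p.
  p≤1+qs : All (λ z → p ≤ suc z) qs
  p≤1+qs = All.zipWith
    (λ (0<z , ¬spread) → ≮⇒≥ λ z+2≤p → ¬spread (0<z , z+2≤p))
    (0<qs , All.¬Any⇒All¬ qs λ any → case-spread (spread p qs any))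
    where
    case-spread : ¬ (∃[ β ] (p ∷ Vec.fromList qs ⊵ β × weightⱽ p β < weightᴸ p ps))
    case-spread (β , ⊵β , lt) = <⇒≱ lt (heavy p ⊵β)

  p≤2⇒ : p ≤ 2 → All (λ p → p ≡ 1 ⊎ p ≡ 2) ps
  p≤2⇒ p≤2 = one-or-two 0<p p≤2 ∷
    All.zipWith (λ (0<z , z≤p) → one-or-two 0<z (≤-trans z≤p p≤2)) (0<qs , qs≤p)

  by-size : ∀ p′ → p ≡ p′ → Exceptional ps
  by-size 0 refl = inj₂ (inj₁ (p≤2⇒ z≤n))
  by-size 1 refl = inj₂ (inj₁ (p≤2⇒ (s≤s z≤n)))
  by-size 2 refl = inj₂ (inj₁ (p≤2⇒ ≤-refl))
  by-size (suc (suc (suc y))) refl with m≤n⇒m<n∨m≡n (All.head qs≤p)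
  ... | inj₂ refl = ⊥-elim (<⇒≱ lt (heavy-0∷ p (split-equal (suc y))))
    where
    open ≤-Reasoning
    lt : weightⱽ p (2 + y ∷ 2 + y ∷ 2 ∷ Vec.fromList rs) < weightᴸ p ps
    lt = begin-strict
      weightⱽ p (2 + y ∷ 2 + y ∷ 2 ∷ Vec.fromList rs)
        ≡⟨ cong₂ (λ a b → a + (a + b)) (weight-small {p} {2 + y} z<s ≤-refl)
             (cong₂ _+_ (weight-small {p} {2} z<s (s≤s (s≤s (s≤s z≤n)))) (weightⱽ-fromList p rs)) ⟩
      3 + weightᴸ p rs
        <⟨ ≤-refl ⟩
      4 + weightᴸ p rs
        ≡⟨ cong (λ a → a + (a + weightᴸ p rs)) (weight-large {p} z<s ≤-refl) ⟨
      weightᴸ p ps ∎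
  ... | inj₁ q<p with ≤-antisym (s≤s⁻¹ q<p) (s≤s⁻¹ (All.head p≤1+qs))
  ...   | refl = by-second y refl
    where
    open ≤-Reasoning
    by-second : ∀ y′ → y ≡ y′ → Exceptional ps
    by-second 0 refl = inj₂ (inj₂ (length qs , s≤s z≤n , cong (3 ∷_) (all≡⇒replicate
      (refl ∷ All.zipWith (λ (r≤2 , 3≤1+r) → ≤-antisym r≤2 (s≤s⁻¹ 3≤1+r))
                          (decreasing-≤ (Linked.tail ps≥) , All.tail p≤1+qs)))))
    by-second 1 refl = ⊥-elim (by-third rs refl)
      where
      by-third : ∀ rs′ → rs ≡ rs′ → ⊥
      by-third []       refl = ps≢43 refl
      by-third (r ∷ ts) refl
        with ≤-antisym (All.head (decreasing-≤ (Linked.tail ps≥))) (s≤s⁻¹ (All.head (All.tail p≤1+qs)))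
      -- The 4 is set aside and the two 3s are split; at threshold 3 the weight of these entries
      -- falls from 6 to 5.
      ... | refl = <⇒≱ lt (heavy-0∷ 3 (exchange then prep 4 (split-equal 1)))
        where
        lt : weightⱽ 3 (4 ∷ 2 ∷ 2 ∷ 2 ∷ Vec.fromList ts) < weightᴸ 3 ps
        lt = s≤s (≤-reflexive (cong (5 +_) (weightⱽ-fromList 3 ts)))
    -- The threshold is q rather than p, so that both consecutive parts count as large.
    by-second (suc (suc z)) refl = ⊥-elim (<⇒≱ lt (heavy-0∷ q (split-consecutive (suc z))))
      where
      lt : weightⱽ q (3 + z ∷ 3 + z ∷ 3 ∷ Vec.fromList rs) < weightᴸ q ps
      lt = begin-strict
        weightⱽ q (3 + z ∷ 3 + z ∷ 3 ∷ Vec.fromList rs)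
          ≡⟨ cong₂ (λ a b → a + (a + b)) (weight-small {q} {3 + z} z<s ≤-refl)
               (cong₂ _+_ (weight-small {q} {3} z<s (s≤s (s≤s (s≤s (s≤s z≤n))))) (weightⱽ-fromList q rs)) ⟩
        3 + weightᴸ q rs
          <⟨ ≤-refl ⟩
        4 + weightᴸ q rs
          ≡⟨ cong₂ (λ a b → a + (b + weightᴸ q rs)) (weight-large {q} z<s (n≤1+n q)) (weight-large {q} z<s ≤-refl) ⟨
        weightᴸ q ps ∎

e-positive⇒exceptional : ∀ lam → EPositive (chromatic (K lam)) → Exceptional (parts lam)
e-positive⇒exceptional lam@(partition ps pos dec) epos =
  exceptional ps 0<ps (recompute (Linked.linked? (λ a b → b ≤? a) ps) dec)
    (λ x {β} ⊵β → χ-weight x ps β (<-≤-trans 0<χ (χ-⊵ ⊵β)))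
    (λ x {β} ⊵β → χ-weight x ps β
      (<-≤-trans (subst (0 <_) (sym (χ-0∷ ps (Vec.fromList ps))) 0<χ) (χ-⊵ ⊵β)))
    (λ ps≡43 → χ-43 (subst (λ ps → χ ps (3 ∷ 3 ∷ 1 ∷ []) ≤ χ ps (3 ∷ 2 ∷ 2 ∷ [])) ps≡43
                           (χ-⊵ (prep 3 (balance (s≤s z≤n))))))
  where
  χ-⊵ : ∀ {m} {α β : Vec ℕ m} → α ⊵ β → χ ps α ≤ χ ps β
  χ-⊵ {α = α} {β} α⊵β = ℤ.drop‿+≤+
    (subst₂ ℤ._≤_ (chromatic≡χ lam α) (chromatic≡χ lam β) (e-positive-⊵ epos α⊵β))
  0<ps : All (0 <_) ps
  0<ps = recompute (All.all? (0 <?_) ps) pos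
  0<χ : 0 < χ ps (Vec.fromList ps)
  0<χ = χ-monochromatic ps 0<ps

-- Sufficiency

partition-≡ : ∀ {μ ν : Partition} → parts μ ≡ parts ν → μ ≡ ν
partition-≡ refl = refl

_≟ₚ_ : (μ ν : Partition) → Dec (μ ≡ ν)
μ ≟ₚ ν = map′ partition-≡ (cong parts) (List.≡-dec _≟_ (parts μ) (parts ν))

open DecMembership _≟ₚ_ using (_∈?_)

δ : Partition → Partition → ℤ
δ μ ν = ℤ.+ ind (ν ≟ₚ μ)

δ-≢ : ∀ {μ ν} → ν ≢ μ → δ μ ν ≡ 0ℤ
δ-≢ {μ} {ν} ν≢μ = cong ℤ.+_ (ind-no (ν ≟ₚ μ) ν≢μ)

δ-refl : ∀ μ → δ μ μ ≡ 1ℤ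
δ-refl μ = cong ℤ.+_ (ind-yes (μ ≟ₚ μ) refl)

module _ (μ : Partition) (g : Partition → ℤ) where

  δ-∑ : List Partition → ℤ
  δ-∑ = ∑ ∘ map (λ ν → δ μ ν ℤ.* g ν)

  δ-∑-∉ : ∀ {xs} → All (λ ν → ν ≢ μ) xs → δ-∑ xs ≡ 0ℤ
  δ-∑-∉ []                     = refl
  δ-∑-∉ {ν ∷ xs} (ν≢μ ∷ rest) =
    cong₂ ℤ._+_ (trans (cong (ℤ._* g ν) (δ-≢ ν≢μ)) (ℤ.*-zeroˡ (g ν))) (δ-∑-∉ rest)

  δ-∑-∈ : ∀ {xs} → Unique xs → μ ∈ xs → δ-∑ xs ≡ g μ
  δ-∑-∈ (μ≢xs ∷ _) (here refl) = trans
    (cong₂ ℤ._+_ (trans (cong (ℤ._* g μ) (δ-refl μ)) (ℤ.*-identityˡ (g μ)))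
                 (δ-∑-∉ (All.map (λ μ≢ν → μ≢ν ∘ sym) μ≢xs)))
    (ℤ.+-identityʳ (g μ))
  δ-∑-∈ {ν ∷ xs} (ν≢xs ∷ unique) (there μ∈xs) = trans
    (cong₂ ℤ._+_ (trans (cong (ℤ._* g ν) (δ-≢ (All.lookup ν≢xs μ∈xs))) (ℤ.*-zeroˡ (g ν)))
                 (δ-∑-∈ unique μ∈xs))
    (ℤ.+-identityˡ (g μ))

∑-distrib : ∀ (xs : List A) (c d g : A → ℤ) →
  ∑ (map (λ x → (c x ℤ.+ d x) ℤ.* g x) xs) ≡
  ∑ (map (λ x → c x ℤ.* g x) xs) ℤ.+ ∑ (map (λ x → d x ℤ.* g x) xs)
∑-distrib []       c d g = refl
∑-distrib (x ∷ xs) c d g = trans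
  (cong₂ ℤ._+_ (ℤ.*-distribʳ-+ (g x) (c x) (d x)) (∑-distrib xs c d g))
  (ℤ-interchange (c x ℤ.* g x) (d x ℤ.* g x) _ _)

-- The support must be free of repetitions, so it depends on whether μ already occurs if its
-- coefficient is raised or the list is enlarged.
EPositive-e+ : ∀ {f} μ → EPositive f → EPositive (λ m α → e μ m α ℤ.+ f m α)
EPositive-e+ {f} μ (E , coeff≥0) = record
  { coeff    = coeff′
  ; support  = proj₁ supp
  ; distinct = proj₁ (proj₂ supp)
  ; vanishes = proj₁ (proj₂ (proj₂ supp))
  ; expands  = proj₂ (proj₂ (proj₂ supp))
  } , λ ν → ℤ.+-mono-≤ (ℤ.+≤+ (z≤n {ind (ν ≟ₚ μ)})) (coeff≥0 ν)
  where
  coeff′ : Partition → ℤ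
  coeff′ ν = δ μ ν ℤ.+ coeff E ν

  supp : Σ[ S ∈ List Partition ] Unique S × (∀ ν → ν ∉ S → coeff′ ν ≡ 0ℤ) ×
         (∀ m (α : Vec ℕ m) → e μ m α ℤ.+ f m α ≡ ∑ (map (λ ν → coeff′ ν ℤ.* e ν m α) S))
  supp with μ ∈? support E
  ... | yes μ∈S = support E , distinct E ,
    (λ ν ν∉S → cong₂ ℤ._+_ (δ-≢ {μ} {ν} λ { refl → ν∉S μ∈S }) (vanishes E ν ν∉S)) ,
    (λ m α → sym (trans (∑-distrib (support E) (δ μ) (coeff E) (λ ν → e ν m α))
                        (cong₂ ℤ._+_ (δ-∑-∈ μ (λ ν → e ν m α) (distinct E) μ∈S) (sym (expands E m α)))))
  ... | no  μ∉S = μ ∷ support E , (All.¬Any⇒All¬ _ μ∉S ∷ distinct E) ,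
    (λ ν ν∉ → cong₂ ℤ._+_ (δ-≢ {μ} {ν} (ν∉ ∘ here)) (vanishes E ν (ν∉ ∘ there))) ,
    (λ m α → cong₂ ℤ._+_
      (sym (trans (cong (ℤ._* e μ m α) (cong₂ ℤ._+_ (δ-refl μ) (vanishes E μ μ∉S))) (ℤ.*-identityˡ _)))
      (sym (trans (∑-distrib (support E) (δ μ) (coeff E) (λ ν → e ν m α))
           (trans (cong₂ ℤ._+_ (δ-∑-∉ μ (λ ν → e ν m α) (All.map (λ μ≢ν → μ≢ν ∘ sym) (All.¬Any⇒All¬ _ μ∉S)))
                               (sym (expands E m α)))
                  (ℤ.+-identityˡ _)))))

EPositive-cong : ∀ {f g : Series∞} → (∀ m α → g m α ≡ f m α) → EPositive f → EPositive g
EPositive-cong g≗f (E , coeff≥0) = record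
  { coeff    = coeff E
  ; support  = support E
  ; distinct = distinct E
  ; vanishes = vanishes E
  ; expands  = λ m α → trans (g≗f m α) (expands E m α)
  } , coeff≥0

EPositive-0 : EPositive (λ _ _ → 0ℤ)
EPositive-0 = record
  { coeff    = λ _ → 0ℤ
  ; support  = []
  ; distinct = []
  ; vanishes = λ _ _ → refl
  ; expands  = λ _ _ → refl
  } , λ _ → ℤ.≤-refl

-- Reduces e-positivity to exhibiting a list of partitions, whose multiplicities become the
-- coefficients.
EPositive-sumOver : ∀ μs → EPositive (λ m α → ℤ.+ sumOver μs (eCoeff α ∘ parts))
EPositive-sumOver []       = EPositive-0
EPositive-sumOver (μ ∷ μs) = EPositive-cong
  (λ m α → trans (ℤ.pos-+ (eCoeff α (parts μ)) _) (cong (ℤ._+ _) (sym (e≡eCoeff μ α))))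
  (EPositive-e+ μ (EPositive-sumOver μs))

-- Zero entries

nonzeros : List ℕ → List ℕ
nonzeros []           = []
nonzeros (zero ∷ ks)  = nonzeros ks
nonzeros (suc k ∷ ks) = suc k ∷ nonzeros ks

-- Reflects e_0 = 1. Zeros arise when parts are decremented and from j = 0 in e_{n-j} e_j.
IgnoresZeros : (List ℕ → ℕ) → Set
IgnoresZeros φ = ∀ ks ls → nonzeros ks ≡ nonzeros ls → φ ks ≡ φ ls

nonzeros-idem : ∀ ks → nonzeros (nonzeros ks) ≡ nonzeros ks
nonzeros-idem []           = refl
nonzeros-idem (zero ∷ ks)  = nonzeros-idem ks
nonzeros-idem (suc k ∷ ks) = cong (suc k ∷_) (nonzeros-idem ks)

ignores-∷ : ∀ {φ} k → IgnoresZeros φ → IgnoresZeros (φ ∘ (k ∷_))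
ignores-∷ zero    ign ks ls eq = ign _ _ eq
ignores-∷ (suc k) ign ks ls eq = ign _ _ (cong (suc k ∷_) eq)

T-nonzeros : ∀ a {φ} → IgnoresZeros φ → ∀ ks → T a φ ks ≡ T a φ (nonzeros ks)
T-nonzeros zero    ign ks           = ign ks (nonzeros ks) (sym (nonzeros-idem ks))
T-nonzeros (suc a) ign []           = refl
T-nonzeros (suc a) ign (zero ∷ ks)  = trans
  (cong₂ _+_ (T-cong (suc a) ks λ ks → ign (0 ∷ ks) ks refl) (T-zero a ks λ _ → refl))
  (trans (+-identityʳ _) (T-nonzeros (suc a) ign ks))
T-nonzeros (suc a) ign (suc k ∷ ks) =
  cong₂ _+_ (T-nonzeros (suc a) (ignores-∷ (suc k) ign) ks) (T-nonzeros a (ignores-∷ k ign) ks)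

T-ignores : ∀ a {φ} → IgnoresZeros φ → IgnoresZeros (T a φ)
T-ignores a {φ} ign ks ls eq =
  trans (T-nonzeros a ign ks) (trans (cong (T a φ) eq) (sym (T-nonzeros a ign ls)))

allZero-nonzeros : ∀ ks → allZero ks ≡ allZero (nonzeros ks)
allZero-nonzeros []           = refl
allZero-nonzeros (zero ∷ ks)  = allZero-nonzeros ks
allZero-nonzeros (suc k ∷ ks) = refl

eCoeff-ignores : ∀ (α : Vec ℕ m) → IgnoresZeros (eCoeff α)
eCoeff-ignores []      ks ls eq =
  trans (allZero-nonzeros ks) (trans (cong allZero eq) (sym (allZero-nonzeros ls)))
eCoeff-ignores (a ∷ α) = T-ignores a (eCoeff-ignores α)

-- Edgeless graphs

-- The a factors of e_1^n that supply the variable can be chosen in C(n, a) ways, and they are then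
-- spent.
T-replicate-1 : ∀ a {φ} → IgnoresZeros φ → ∀ n →
  T a φ (replicate n 1) ≡ (n C a) * φ (replicate (n ∸ a) 1)
T-replicate-1 zero        ign n       = sym (*-identityˡ _)
T-replicate-1 (suc a) {φ} ign zero    = refl
T-replicate-1 (suc a) {φ} ign (suc n) = begin
  T (suc a) (φ ∘ (1 ∷_)) (replicate n 1) + T a (φ ∘ (0 ∷_)) (replicate n 1)
    ≡⟨ cong₂ _+_ (T-replicate-1 (suc a) (ignores-∷ 1 ign) n)
                 (trans (T-cong a (replicate n 1) λ ks → ign (0 ∷ ks) ks refl) (T-replicate-1 a ign n)) ⟩
  (n C suc a) * φ (1 ∷ replicate (n ∸ suc a) 1) + (n C a) * φ (replicate (n ∸ a) 1)
    ≡⟨ cong (_+ (n C a) * φ (replicate (n ∸ a) 1)) (first (suc a ≤? n)) ⟩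
  (n C suc a) * φ (replicate (n ∸ a) 1) + (n C a) * φ (replicate (n ∸ a) 1)
    ≡⟨ *-distribʳ-+ (φ (replicate (n ∸ a) 1)) (n C suc a) (n C a) ⟨
  (n C suc a + n C a) * φ (replicate (n ∸ a) 1)
    ≡⟨ cong (_* φ (replicate (n ∸ a) 1)) (trans (+-comm (n C suc a) (n C a)) (nCk+nC[k+1]≡[n+1]C[k+1] n a)) ⟩
  (suc n C suc a) * φ (replicate (n ∸ a) 1) ∎
  where
  open ≡-Reasoning
  -- The lengths agree only for `suc a ≤ n`; otherwise the binomial coefficient is 0.
  first : Dec (suc a ≤ n) →
    (n C suc a) * φ (1 ∷ replicate (n ∸ suc a) 1) ≡ (n C suc a) * φ (replicate (n ∸ a) 1)
  first (yes a<n) = cong (λ k → (n C suc a) * φ (replicate k 1)) (sym (+-∸-assoc 1 a<n))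
  first (no  a≮n) rewrite k>n⇒nCk≡0 (≰⇒> a≮n) = refl

addPart-0 : ∀ p (α : Vec ℕ m) → addPart p (λ _ → 0) α ≡ 0
addPart-0 zero    []          = refl
addPart-0 (suc p) []          = refl
addPart-0 p       (zero ∷ α)  = trans (addPart-0∷ p _ α) (addPart-0 p α)
addPart-0 p       (suc a ∷ α) = trans (addPart-suc∷ p _ a α)
  (cong₂ _+_ (addPart-0 p α) (trans (cong ((p C suc a) *_) (addPart-0 (p ∸ suc a) α)) (*-zeroʳ (p C suc a))))

edgeless : ∀ n (α : Vec ℕ m) → addPart n unit α ≡ eCoeff α (replicate n 1)
edgeless zero    []          = refl
edgeless (suc n) []          = refl
edgeless n       (zero ∷ α)  = trans (addPart-0∷ n unit α) (edgeless n α)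
edgeless n       (suc a ∷ α) = trans (addPart-suc∷ n unit a α) (trans
  (cong₂ _+_ (addPart-0 n α) (cong ((n C suc a) *_) (edgeless (n ∸ suc a) α)))
  (sym (T-replicate-1 (suc a) (eCoeff-ignores α) n)))

-- Coefficients depending only on the multiplicities of 1, 2 and 3

Profile : Set
Profile = ℕ → ℕ → ℕ → ℕ

infixr 8 _⁺¹ _⁺² _⁺³

_⁺¹ _⁺² _⁺³ : Profile → Profile
(F ⁺¹) a b c = F (suc a) b c
(F ⁺²) a b c = F a (suc b) c
(F ⁺³) a b c = F a b (suc c)

-- The coefficient of x^α is F a b c if α consists of a 1s, b 2s, c 3s and 0s,
-- and 0 if α has an entry above 3.
lift : Profile → Vec ℕ m → ℕ
lift F []      = F 0 0 0
lift F (0 ∷ α) = lift F α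
lift F (1 ∷ α) = lift (F ⁺¹) α
lift F (2 ∷ α) = lift (F ⁺²) α
lift F (3 ∷ α) = lift (F ⁺³) α
lift F (suc (suc (suc (suc _))) ∷ α) = 0

lift-cong : ∀ {F G : Profile} (α : Vec ℕ m) → (∀ a b c → F a b c ≡ G a b c) → lift F α ≡ lift G α
lift-cong []      F≗G = F≗G 0 0 0
lift-cong (0 ∷ α) F≗G = lift-cong α F≗G
lift-cong (1 ∷ α) F≗G = lift-cong α λ a b c → F≗G (suc a) b c
lift-cong (2 ∷ α) F≗G = lift-cong α λ a b c → F≗G a (suc b) c
lift-cong (3 ∷ α) F≗G = lift-cong α λ a b c → F≗G a b (suc c)
lift-cong (suc (suc (suc (suc _))) ∷ α) F≗G = refl

lift-+ : ∀ (F G : Profile) (α : Vec ℕ m) → lift (λ a b c → F a b c + G a b c) α ≡ lift F α + lift G α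
lift-+ F G []      = refl
lift-+ F G (0 ∷ α) = lift-+ F G α
lift-+ F G (1 ∷ α) = lift-+ (F ⁺¹) (G ⁺¹) α
lift-+ F G (2 ∷ α) = lift-+ (F ⁺²) (G ⁺²) α
lift-+ F G (3 ∷ α) = lift-+ (F ⁺³) (G ⁺³) α
lift-+ F G (suc (suc (suc (suc _))) ∷ α) = refl

lift-* : ∀ k (F : Profile) (α : Vec ℕ m) → lift (λ a b c → k * F a b c) α ≡ k * lift F α
lift-* k F []      = refl
lift-* k F (0 ∷ α) = lift-* k F α
lift-* k F (1 ∷ α) = lift-* k (F ⁺¹) α
lift-* k F (2 ∷ α) = lift-* k (F ⁺²) α
lift-* k F (3 ∷ α) = lift-* k (F ⁺³) α
lift-* k F (suc (suc (suc (suc _))) ∷ α) = sym (*-zeroʳ k)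

lift-0 : ∀ {F : Profile} (α : Vec ℕ m) → (∀ a b c → F a b c ≡ 0) → lift F α ≡ 0
lift-0 {F = F} α F≗0 = trans (lift-cong α F≗0) (lift-* 0 F α)

-- The first three count the ways to colour 1, 2 or 3 isolated new vertices, each colour class
-- exhausting its exponent; the factor 3 picks the vertex left alone when the other two share a
-- colour. `mulE₁` lowers one exponent. Wherever `pred` truncates, a neighbouring factor is 0.
add₁ add₂ add₃ mulE₁ : Profile → Profile
add₁  F a b c = a * F (pred a) b c
add₂  F a b c = a * (pred a * F (pred (pred a)) b c) + b * F a (pred b) c
add₃  F a b c = a * (pred a * (pred (pred a) * F (pred (pred (pred a))) b c)) +
                3 * (a * (b * F (pred a) (pred b) c)) + c * F a b (pred c)
mulE₁ F a b c = a * F (pred a) b c + b * F (suc a) (pred b) c + c * F a (suc b) (pred c)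

-- Absorbs the case a = 0, in which `suc (pred a)` differs from a.
*-shift : ∀ (f : ℕ → ℕ) a → a * f (suc (pred a)) + f a ≡ suc a * f a
*-shift f zero    = sym (*-identityˡ (f 0))
*-shift f (suc a) = +-comm (suc a * f (suc a)) (f (suc a))

addPart-1-lift : ∀ F (α : Vec ℕ m) → addPart 1 (lift F) α ≡ lift (add₁ F) α
addPart-1-lift F []      = refl
addPart-1-lift F (0 ∷ α) = addPart-1-lift F α
addPart-1-lift F (1 ∷ α) = begin
  addPart 1 (lift (F ⁺¹)) α + 1 * addPart 0 (lift F) α
    ≡⟨ cong₂ _+_ (addPart-1-lift (F ⁺¹) α) (trans (*-identityˡ _) (addPart-zero (lift F) α)) ⟩
  lift (add₁ (F ⁺¹)) α + lift F α
    ≡⟨ lift-+ _ _ α ⟨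
  lift (λ a b c → add₁ (F ⁺¹) a b c + F a b c) α
    ≡⟨ lift-cong α (λ a b c → *-shift (λ a → F a b c) a) ⟩
  lift (add₁ F ⁺¹) α ∎
  where open ≡-Reasoning
addPart-1-lift F (2 ∷ α) = trans (+-identityʳ _) (addPart-1-lift (F ⁺²) α)
addPart-1-lift F (3 ∷ α) = trans (+-identityʳ _) (addPart-1-lift (F ⁺³) α)
addPart-1-lift F (suc (suc (suc (suc _))) ∷ α) = trans (+-identityʳ _) (addPart-0 1 α)

-- A further colour of exponent 1 is left to the old graph or goes to one of the two new vertices.
-- Small a are treated apart because `pred` truncates there.
add₂-⁺¹ : ∀ F a b c → add₂ (F ⁺¹) a b c + 2 * add₁ F a b c ≡ add₂ F (suc a) b c
add₂-⁺¹ F zero          b c = +-identityʳ _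
add₂-⁺¹ F (suc zero)    b c = lemma (F 0 b c) (b * F 2 (pred b) c)
  where
  lemma : ∀ u v → 1 * 0 + v + 2 * (1 * u) ≡ 2 * (1 * u) + v
  lemma = solve-∀
add₂-⁺¹ F (suc (suc a)) b c = lemma a (F (suc a) b c) (b * F (3 + a) (pred b) c)
  where
  lemma : ∀ a u v → (2 + a) * ((1 + a) * u) + v + 2 * ((2 + a) * u) ≡ (3 + a) * ((2 + a) * u) + v
  lemma = solve-∀

add₂-⁺² : ∀ F a b c → add₂ (F ⁺²) a b c + F a b c ≡ add₂ F a (suc b) c
add₂-⁺² F a b c = trans (+-assoc (a * (pred a * F (pred (pred a)) (suc b) c)) _ _)
                        (cong (a * (pred a * F (pred (pred a)) (suc b) c) +_) (*-shift (λ b → F a b c) b))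

addPart-2-lift : ∀ F (α : Vec ℕ m) → addPart 2 (lift F) α ≡ lift (add₂ F) α
addPart-2-lift F []      = refl
addPart-2-lift F (0 ∷ α) = addPart-2-lift F α
addPart-2-lift F (1 ∷ α) = begin
  addPart 2 (lift (F ⁺¹)) α + 2 * addPart 1 (lift F) α
    ≡⟨ cong₂ _+_ (addPart-2-lift (F ⁺¹) α)
                 (trans (cong (2 *_) (addPart-1-lift F α)) (sym (lift-* 2 (add₁ F) α))) ⟩
  lift (add₂ (F ⁺¹)) α + lift (λ a b c → 2 * add₁ F a b c) α
    ≡⟨ lift-+ _ _ α ⟨
  lift (λ a b c → add₂ (F ⁺¹) a b c + 2 * add₁ F a b c) α
    ≡⟨ lift-cong α (add₂-⁺¹ F) ⟩
  lift (add₂ F ⁺¹) α ∎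
  where open ≡-Reasoning
addPart-2-lift F (2 ∷ α) = begin
  addPart 2 (lift (F ⁺²)) α + 1 * addPart 0 (lift F) α
    ≡⟨ cong₂ _+_ (addPart-2-lift (F ⁺²) α) (trans (*-identityˡ _) (addPart-zero (lift F) α)) ⟩
  lift (add₂ (F ⁺²)) α + lift F α
    ≡⟨ lift-+ _ _ α ⟨
  lift (λ a b c → add₂ (F ⁺²) a b c + F a b c) α
    ≡⟨ lift-cong α (add₂-⁺² F) ⟩
  lift (add₂ F ⁺²) α ∎
  where open ≡-Reasoning
addPart-2-lift F (3 ∷ α) = trans (+-identityʳ _) (addPart-2-lift (F ⁺³) α)
addPart-2-lift F (suc (suc (suc (suc _))) ∷ α) = trans (+-identityʳ _) (addPart-0 2 α)

add₃-⁺¹ : ∀ F a b c → add₃ (F ⁺¹) a b c + 3 * add₂ F a b c ≡ add₃ F (suc a) b c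
add₃-⁺¹ F zero                b c = lemma (b * F 0 (pred b) c) (c * F 1 b (pred c))
  where
  lemma : ∀ u v → v + 3 * u ≡ 3 * (1 * u) + v
  lemma = solve-∀
add₃-⁺¹ F (suc zero)          b c = lemma (b * F 1 (pred b) c) (c * F 2 b (pred c))
  where
  lemma : ∀ u v → 3 * (1 * u) + v + 3 * u ≡ 3 * (2 * u) + v
  lemma = solve-∀
add₃-⁺¹ F (suc (suc zero))    b c = lemma (F 0 b c) (b * F 2 (pred b) c) (c * F 3 b (pred c))
  where
  lemma : ∀ w u v → 3 * (2 * u) + v + 3 * (2 * (1 * w) + u) ≡ 3 * (2 * (1 * w)) + 3 * (3 * u) + v
  lemma = solve-∀
add₃-⁺¹ F (suc (suc (suc a))) b c =
  lemma a (F (1 + a) b c) (b * F (3 + a) (pred b) c) (c * F (4 + a) b (pred c))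
  where
  lemma : ∀ a w u v →
    (3 + a) * ((2 + a) * ((1 + a) * w)) + 3 * ((3 + a) * u) + v + 3 * ((3 + a) * ((2 + a) * w) + u) ≡
    (4 + a) * ((3 + a) * ((2 + a) * w)) + 3 * ((4 + a) * u) + v
  lemma = solve-∀

add₃-⁺² : ∀ F a b c → add₃ (F ⁺²) a b c + 3 * add₁ F a b c ≡ add₃ F a (suc b) c
add₃-⁺² F a b c = trans
  (lemma (a * (pred a * (pred (pred a) * F (pred (pred (pred a))) (suc b) c)))
         a (b * F (pred a) (suc (pred b)) c) (F (pred a) b c) (c * F a (suc b) (pred c)))
  (cong (λ u → a * (pred a * (pred (pred a) * F (pred (pred (pred a))) (suc b) c)) + 3 * (a * u) +
               c * F a (suc b) (pred c))
        (*-shift (λ b → F (pred a) b c) b))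
  where
  lemma : ∀ w a u v z → w + 3 * (a * u) + z + 3 * (a * v) ≡ w + 3 * (a * (u + v)) + z
  lemma = solve-∀

add₃-⁺³ : ∀ F a b c → add₃ (F ⁺³) a b c + F a b c ≡ add₃ F a b (suc c)
add₃-⁺³ F a b c = trans
  (+-assoc (a * (pred a * (pred (pred a) * F (pred (pred (pred a))) b (suc c))) +
            3 * (a * (b * F (pred a) (pred b) (suc c)))) _ _)
  (cong (a * (pred a * (pred (pred a) * F (pred (pred (pred a))) b (suc c))) +
         3 * (a * (b * F (pred a) (pred b) (suc c))) +_) (*-shift (F a b) c))

addPart-3-lift : ∀ F (α : Vec ℕ m) → addPart 3 (lift F) α ≡ lift (add₃ F) α
addPart-3-lift F []      = refl
addPart-3-lift F (0 ∷ α) = addPart-3-lift F α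
addPart-3-lift F (1 ∷ α) = begin
  addPart 3 (lift (F ⁺¹)) α + 3 * addPart 2 (lift F) α
    ≡⟨ cong₂ _+_ (addPart-3-lift (F ⁺¹) α)
                 (trans (cong (3 *_) (addPart-2-lift F α)) (sym (lift-* 3 (add₂ F) α))) ⟩
  lift (add₃ (F ⁺¹)) α + lift (λ a b c → 3 * add₂ F a b c) α
    ≡⟨ lift-+ _ _ α ⟨
  lift (λ a b c → add₃ (F ⁺¹) a b c + 3 * add₂ F a b c) α
    ≡⟨ lift-cong α (add₃-⁺¹ F) ⟩
  lift (add₃ F ⁺¹) α ∎
  where open ≡-Reasoning
addPart-3-lift F (2 ∷ α) = begin
  addPart 3 (lift (F ⁺²)) α + 3 * addPart 1 (lift F) α
    ≡⟨ cong₂ _+_ (addPart-3-lift (F ⁺²) α)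
                 (trans (cong (3 *_) (addPart-1-lift F α)) (sym (lift-* 3 (add₁ F) α))) ⟩
  lift (add₃ (F ⁺²)) α + lift (λ a b c → 3 * add₁ F a b c) α
    ≡⟨ lift-+ _ _ α ⟨
  lift (λ a b c → add₃ (F ⁺²) a b c + 3 * add₁ F a b c) α
    ≡⟨ lift-cong α (add₃-⁺² F) ⟩
  lift (add₃ F ⁺²) α ∎
  where open ≡-Reasoning
addPart-3-lift F (3 ∷ α) = begin
  addPart 3 (lift (F ⁺³)) α + 1 * addPart 0 (lift F) α
    ≡⟨ cong₂ _+_ (addPart-3-lift (F ⁺³) α) (trans (*-identityˡ _) (addPart-zero (lift F) α)) ⟩
  lift (add₃ (F ⁺³)) α + lift F α
    ≡⟨ lift-+ _ _ α ⟨
  lift (λ a b c → add₃ (F ⁺³) a b c + F a b c) α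
    ≡⟨ lift-cong α (add₃-⁺³ F) ⟩
  lift (add₃ F ⁺³) α ∎
  where open ≡-Reasoning
addPart-3-lift F (suc (suc (suc (suc _))) ∷ α) = trans (+-identityʳ _) (addPart-0 3 α)

-- Multiplication by e₁

e₁· : (Vec ℕ m → ℕ) → Vec ℕ m → ℕ
e₁· f []          = 0
e₁· f (zero ∷ α)  = e₁· (f ∘ (0 ∷_)) α
e₁· f (suc a ∷ α) = e₁· (f ∘ (suc a ∷_)) α + f (a ∷ α)

e₁·-cong : ∀ {f g : Vec ℕ m → ℕ} → (∀ α → f α ≡ g α) → ∀ α → e₁· f α ≡ e₁· g α
e₁·-cong f≗g []          = refl
e₁·-cong f≗g (zero ∷ α)  = e₁·-cong (f≗g ∘ (0 ∷_)) α
e₁·-cong f≗g (suc a ∷ α) = cong₂ _+_ (e₁·-cong (f≗g ∘ (suc a ∷_)) α) (f≗g (a ∷ α))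

e₁·-+ : ∀ (f g : Vec ℕ m → ℕ) α → e₁· (λ α → f α + g α) α ≡ e₁· f α + e₁· g α
e₁·-+ f g []          = refl
e₁·-+ f g (zero ∷ α)  = e₁·-+ _ _ α
e₁·-+ f g (suc a ∷ α) = trans (cong (_+ (f (a ∷ α) + g (a ∷ α))) (e₁·-+ (f ∘ (suc a ∷_)) (g ∘ (suc a ∷_)) α))
                              (interchange (e₁· (f ∘ (suc a ∷_)) α) _ _ _)

e₁·-0 : ∀ (α : Vec ℕ m) → e₁· (λ _ → 0) α ≡ 0
e₁·-0 []          = refl
e₁·-0 (zero ∷ α)  = e₁·-0 α
e₁·-0 (suc a ∷ α) = cong (_+ 0) (e₁·-0 α)

e₁·-sumOver : ∀ (xs : List A) (f : A → Vec ℕ m → ℕ) α →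
  e₁· (λ α → sumOver xs λ x → f x α) α ≡ sumOver xs λ x → e₁· (f x) α
e₁·-sumOver []       f α = e₁·-0 α
e₁·-sumOver (x ∷ xs) f α =
  trans (e₁·-+ (f x) (λ α → sumOver xs λ x → f x α) α) (cong (e₁· (f x) α +_) (e₁·-sumOver xs f α))

T-e₁· : ∀ a (f : Vec ℕ m → List ℕ → ℕ) ks α →
  T a (λ ks → e₁· (λ γ → f γ ks) α) ks ≡ e₁· (λ γ → T a (f γ) ks) α
T-e₁· a f ks []          = T-zero a ks λ _ → refl
T-e₁· a f ks (zero ∷ α)  = T-e₁· a (f ∘ (0 ∷_)) ks α
T-e₁· a f ks (suc b ∷ α) =
  trans (T-+ a _ (f (b ∷ α)) ks) (cong (_+ T a (f (b ∷ α)) ks) (T-e₁· a (f ∘ (suc b ∷_)) ks α))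

T-snoc-1 : ∀ a φ ks → T (suc a) φ (ks ++ 1 ∷ []) ≡
  T (suc a) (φ ∘ (_++ 1 ∷ [])) ks + T a (φ ∘ (_++ 0 ∷ [])) ks
T-snoc-1 zero    φ []       = refl
T-snoc-1 (suc a) φ []       = refl
T-snoc-1 zero    φ (k ∷ ks) = trans (cong (_+ decr φ k (ks ++ 1 ∷ [])) (T-snoc-1 0 (φ ∘ (k ∷_)) ks))
  (lemma (T 1 (φ ∘ (k ∷_) ∘ (_++ 1 ∷ [])) ks) (φ (k ∷ ks ++ 0 ∷ [])) (decr-snoc k))
  where
  lemma : ∀ u v {w z} → w ≡ z → u + v + w ≡ u + z + v
  lemma u v refl = trans (+-assoc u v _) (trans (cong (u +_) (+-comm v _)) (sym (+-assoc u _ v)))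
  decr-snoc : ∀ k → decr φ k (ks ++ 1 ∷ []) ≡ decr (φ ∘ (_++ 1 ∷ [])) k ks
  decr-snoc zero    = refl
  decr-snoc (suc k) = refl
T-snoc-1 (suc a) φ (k ∷ ks) = trans
  (cong₂ _+_ (T-snoc-1 (suc a) (φ ∘ (k ∷_)) ks) (T-snoc-1 a (decr φ k) ks))
  (trans (interchange (T (2 + a) (φ ∘ (k ∷_) ∘ (_++ 1 ∷ [])) ks) _ _ _)
    (cong₂ _+_ (cong (T (2 + a) (φ ∘ (k ∷_) ∘ (_++ 1 ∷ [])) ks +_) (T-cong (suc a) ks (decr-snoc k)))
               (cong (T (suc a) (φ ∘ (k ∷_) ∘ (_++ 0 ∷ [])) ks +_) (T-cong a ks (decr-snoc k)))))
  where
  decr-snoc : ∀ k {ls} ks → decr φ k (ks ++ ls) ≡ decr (φ ∘ (_++ ls)) k ks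
  decr-snoc zero    ks = refl
  decr-snoc (suc k) ks = refl

nonzeros-snoc-0 : ∀ ks → nonzeros (ks ++ 0 ∷ []) ≡ nonzeros ks
nonzeros-snoc-0 []           = refl
nonzeros-snoc-0 (zero ∷ ks)  = nonzeros-snoc-0 ks
nonzeros-snoc-0 (suc k ∷ ks) = cong (suc k ∷_) (nonzeros-snoc-0 ks)

-- The factor e_1 is put last because that is where a decreasing list of parts has its 1.
eCoeff-snoc-1 : ∀ (α : Vec ℕ m) ks → eCoeff α (ks ++ 1 ∷ []) ≡ e₁· (λ γ → eCoeff γ ks) α
eCoeff-snoc-1 []          ks = allZero-snoc-1 ks
  where
  allZero-snoc-1 : ∀ ks → allZero (ks ++ 1 ∷ []) ≡ 0
  allZero-snoc-1 []           = refl
  allZero-snoc-1 (zero ∷ ks)  = allZero-snoc-1 ks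
  allZero-snoc-1 (suc k ∷ ks) = refl
eCoeff-snoc-1 (zero ∷ α)  ks = eCoeff-snoc-1 α ks
eCoeff-snoc-1 (suc a ∷ α) ks = trans (T-snoc-1 a (eCoeff α) ks) (cong₂ _+_
  (trans (T-cong (suc a) ks λ ks → eCoeff-snoc-1 α ks) (T-e₁· (suc a) eCoeff ks α))
  (T-cong a ks λ ks → eCoeff-ignores α (ks ++ 0 ∷ []) ks (nonzeros-snoc-0 ks)))

-- Lowering an exponent 4 yields a 3, which F excludes; so the product again vanishes above exponent
-- 3, as `lift` demands.
e₁·-lift : ∀ F → (∀ a b c → F a b (suc c) ≡ 0) → ∀ (α : Vec ℕ m) → e₁· (lift F) α ≡ lift (mulE₁ F) α
e₁·-lift F F₃≡0 []      = refl
e₁·-lift F F₃≡0 (0 ∷ α) = e₁·-lift F F₃≡0 α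
e₁·-lift F F₃≡0 (1 ∷ α) = trans
  (cong (_+ lift F α) (e₁·-lift (F ⁺¹) (λ a → F₃≡0 (suc a)) α))
  (trans (sym (lift-+ _ F α)) (lift-cong α λ a b c → trans
    (lemma (a * F (suc (pred a)) b c) _ _ (F a b c))
    (cong (λ u → u + b * F (2 + a) (pred b) c + c * F (suc a) (suc b) (pred c)) (*-shift (λ a → F a b c) a))))
  where
  lemma : ∀ u v w z → u + v + w + z ≡ (u + z) + v + w
  lemma = solve-∀
e₁·-lift F F₃≡0 (2 ∷ α) = trans
  (cong (_+ lift (F ⁺¹) α) (e₁·-lift (F ⁺²) (λ a b → F₃≡0 a (suc b)) α))
  (trans (sym (lift-+ _ (F ⁺¹) α)) (lift-cong α λ a b c → trans
    (lemma (a * F (pred a) (suc b) c) (b * F (suc a) (suc (pred b)) c) _ (F (suc a) b c))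
    (cong (λ u → a * F (pred a) (suc b) c + u + c * F a (2 + b) (pred c)) (*-shift (λ b → F (suc a) b c) b))))
  where
  lemma : ∀ u v w z → u + v + w + z ≡ u + (v + z) + w
  lemma = solve-∀
e₁·-lift F F₃≡0 (3 ∷ α) = trans
  (cong (_+ lift (F ⁺²) α) (e₁·-lift (F ⁺³) (λ a b c → F₃≡0 a b (suc c)) α))
  (trans (sym (lift-+ _ (F ⁺²) α)) (lift-cong α λ a b c → trans
    (+-assoc (a * F (pred a) b (suc c) + b * F (suc a) (pred b) (suc c)) _ _)
    (cong (a * F (pred a) b (suc c) + b * F (suc a) (pred b) (suc c) +_) (*-shift (F a (suc b)) c))))
e₁·-lift F F₃≡0 (suc (suc (suc (suc zero))) ∷ α)    = cong₂ _+_ (e₁·-0 α) (lift-0 α F₃≡0)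
e₁·-lift F F₃≡0 (suc (suc (suc (suc (suc _)))) ∷ α) = cong (_+ 0) (e₁·-0 α)

-- Expansions Σⱼ cⱼ e_{n-j} e_j

before : (ℕ → ℕ) → ℕ → ℕ
before f zero    = 0
before f (suc k) = f k

-- The coefficient of a monomial with a exponents 1 and b exponents 2 in e_p e_q
pairs : ℕ → ℕ → ℕ → ℕ → ℕ
pairs a       (suc b) p    q    = before (λ p → before (λ q → pairs a b p q) q) p
pairs (suc a) zero    p    q    = before (λ p → pairs a zero p q) p + before (λ q → pairs a zero p q) q
pairs zero    zero    zero zero = 1
pairs zero    zero    _    _    = 0

-- The order of the variables is immaterial, although `pairs` consumes the exponents 2 first.
pairs-suc : ∀ a b p q →
  pairs (suc a) b p q ≡ before (λ p → pairs a b p q) p + before (λ q → pairs a b p q) q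
pairs-suc a zero    p       q       = refl
pairs-suc a (suc b) zero    zero    = refl
pairs-suc a (suc b) zero    (suc q) = refl
pairs-suc a (suc b) (suc p) zero    = sym (trans (+-identityʳ _) (lemma p))
  where
  lemma : ∀ p → pairs a (suc b) p 0 ≡ 0
  lemma zero    = refl
  lemma (suc p) = refl
pairs-suc a (suc b) (suc p) (suc q) = pairs-suc a b p q

pairProfile : ℕ → ℕ → Profile
pairProfile p q a b zero    = pairs a b p q
pairProfile p q a b (suc _) = 0

eCoeff-pair : ∀ p q (α : Vec ℕ m) → eCoeff α (p ∷ q ∷ []) ≡ lift (pairProfile p q) α
eCoeff-pair zero    zero    [] = refl
eCoeff-pair zero    (suc q) [] = refl
eCoeff-pair (suc p) q       [] = refl
eCoeff-pair p q (0 ∷ α) = eCoeff-pair p q α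
eCoeff-pair p q (1 ∷ α) = begin
  decr (eCoeff α ∘ (p ∷_)) q [] + decr (eCoeff α) p (q ∷ [])
    ≡⟨ cong₂ _+_ (second q) (first p) ⟩
  lift (λ a b c → before (λ q → pairProfile p q a b c) q) α +
  lift (λ a b c → before (λ p → pairProfile p q a b c) p) α
    ≡⟨ +-comm (lift (λ a b c → before (λ q → pairProfile p q a b c) q) α) _ ⟩
  lift (λ a b c → before (λ p → pairProfile p q a b c) p) α +
  lift (λ a b c → before (λ q → pairProfile p q a b c) q) α
    ≡⟨ lift-+ _ _ α ⟨
  lift (λ a b c → before (λ p → pairProfile p q a b c) p + before (λ q → pairProfile p q a b c) q) α
    ≡⟨ lift-cong α sum-suc ⟩
  lift (pairProfile p q ⁺¹) α ∎
  where
  open ≡-Reasoning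
  second : ∀ q → decr (eCoeff α ∘ (p ∷_)) q [] ≡ lift (λ a b c → before (λ q → pairProfile p q a b c) q) α
  second zero    = sym (lift-0 α λ _ _ _ → refl)
  second (suc q) = eCoeff-pair p q α
  first : ∀ p → decr (eCoeff α) p (q ∷ []) ≡ lift (λ a b c → before (λ p → pairProfile p q a b c) p) α
  first zero    = sym (lift-0 α λ _ _ _ → refl)
  first (suc p) = eCoeff-pair p q α
  before-0 : ∀ k → before (λ _ → 0) k ≡ 0
  before-0 zero    = refl
  before-0 (suc k) = refl
  sum-suc : ∀ a b c → before (λ p → pairProfile p q a b c) p + before (λ q → pairProfile p q a b c) q ≡
            pairProfile p q (suc a) b c
  sum-suc a b zero    = sym (pairs-suc a b p q)
  sum-suc a b (suc c) = cong₂ _+_ (before-0 p) (before-0 q)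
eCoeff-pair zero    zero    (2 ∷ α) = sym (lift-0 α λ { _ _ zero → refl ; _ _ (suc _) → refl })
eCoeff-pair zero    (suc q) (2 ∷ α) = sym (lift-0 α λ { _ _ zero → refl ; _ _ (suc _) → refl })
eCoeff-pair (suc p) zero    (2 ∷ α) = sym (lift-0 α λ { _ _ zero → refl ; _ _ (suc _) → refl })
eCoeff-pair (suc p) (suc q) (2 ∷ α) = trans (eCoeff-pair p q α)
  (lift-cong α λ { _ _ zero → refl ; _ _ (suc _) → refl })
eCoeff-pair p q (3 ∷ α) = sym (lift-0 α λ _ _ _ → refl)
eCoeff-pair p q (suc (suc (suc (suc _))) ∷ α) = refl

-- The second factor supplies q of the a variables, the first factor all the others.
pairs-0 : ∀ a p q → a ≡ p + q → pairs a 0 p q ≡ a C q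
pairs-0 zero    zero    zero    _  = refl
pairs-0 (suc a) (suc p) zero    eq = trans (+-identityʳ _) (pairs-0 a p 0 (suc-injective eq))
pairs-0 (suc a) zero    (suc q) eq = begin
  pairs a 0 0 q        ≡⟨ pairs-0 a 0 q (suc-injective eq) ⟩
  a C q                ≡⟨ trans (cong (a C_) (sym (suc-injective eq))) (nCn≡1 a) ⟩
  1                    ≡⟨ trans (cong (suc a C_) (sym eq)) (nCn≡1 (suc a)) ⟨
  suc a C suc q        ∎
  where open ≡-Reasoning
pairs-0 (suc a) (suc p) (suc q) eq = begin
  pairs a 0 p (suc q) + pairs a 0 (suc p) q
    ≡⟨ cong₂ _+_ (pairs-0 a p (suc q) (suc-injective eq))
                 (pairs-0 a (suc p) q (trans (suc-injective eq) (+-suc p q))) ⟩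
  (a C suc q) + (a C q)
    ≡⟨ trans (+-comm (a C suc q) _) (nCk+nC[k+1]≡[n+1]C[k+1] a q) ⟩
  suc a C suc q ∎
  where open ≡-Reasoning

pairs-degree : ∀ a b p q → a + (b + b) ≢ p + q → pairs a b p q ≡ 0
pairs-degree a       (suc b) zero    q       ≢ = refl
pairs-degree a       (suc b) (suc p) zero    ≢ = refl
pairs-degree a       (suc b) (suc p) (suc q) ≢ = pairs-degree a b p q λ eq → ≢ (begin
  a + (suc b + suc b)   ≡⟨ lemma a b ⟩
  2 + (a + (b + b))     ≡⟨ cong (2 +_) eq ⟩
  2 + (p + q)           ≡⟨ cong suc (+-suc p q) ⟨
  suc p + suc q         ∎)
  where
  open ≡-Reasoning
  lemma : ∀ a b → a + (suc b + suc b) ≡ 2 + (a + (b + b))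
  lemma = solve-∀
pairs-degree (suc a) zero    zero    zero    ≢ = refl
pairs-degree (suc a) zero    zero    (suc q) ≢ = pairs-degree a 0 0 q (≢ ∘ cong suc)
pairs-degree (suc a) zero    (suc p) zero    ≢ =
  trans (+-identityʳ _) (pairs-degree a 0 p 0 (≢ ∘ cong suc))
pairs-degree (suc a) zero    (suc p) (suc q) ≢ =
  cong₂ _+_ (pairs-degree a 0 p (suc q) (≢ ∘ cong suc))
            (pairs-degree a 0 (suc p) q λ eq → ≢ (cong suc (trans eq (sym (+-suc p q)))))
pairs-degree zero    zero    zero    zero    ≢ = ⊥-elim (≢ refl)
pairs-degree zero    zero    zero    (suc q) ≢ = refl
pairs-degree zero    zero    (suc p) q       ≢ = refl

-- The list c₀ ∷ c₁ ∷ … stands for Σⱼ cⱼ e_{n-j} e_j; `Fits n cs` says that 2j ≤ n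
-- for every index j in range.
data Fits : ℕ → List ℕ → Set where
  nil    : ∀ {n} → Fits n []
  single : ∀ {n c} → Fits n (c ∷ [])
  cons   : ∀ {n c cs} → Fits n cs → Fits (2 + n) (c ∷ cs)

row : ℕ → List ℕ → ℕ → ℕ
row i []       a = 0
row i (c ∷ cs) a = c * (a C i) + row (suc i) cs a

-- The coefficient of a monomial with a exponents 1 and b exponents 2, a + 2b = n
ev : List ℕ → ℕ → ℕ → ℕ
ev cs       a zero    = row 0 cs a
ev []       a (suc b) = 0
-- A squared variable lies in both factors: it kills e_n e_0 and lowers both indices of every other
-- product.
ev (c ∷ cs) a (suc b) = ev cs a b

ev-[] : ∀ a b → ev [] a b ≡ 0
ev-[] a zero    = refl
ev-[] a (suc b) = refl

-- The indicator fixes the degree, because `ev` reads the same list in any degree.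
at : ℕ → List ℕ → Profile
at n cs a b zero    = ind (a + (b + b) ≟ n) * ev cs a b
at n cs a b (suc c) = 0

at-≡ : ∀ n cs a b → a + (b + b) ≡ n → at n cs a b 0 ≡ ev cs a b
at-≡ n cs a b eq = trans (cong (_* ev cs a b) (ind-yes (a + (b + b) ≟ n) eq)) (+-identityʳ _)

at-≢ : ∀ n cs a b → a + (b + b) ≢ n → at n cs a b 0 ≡ 0
at-≢ n cs a b ≢ = cong (_* ev cs a b) (ind-no (a + (b + b) ≟ n) ≢)

at-intro : ∀ n cs a b {x} → (a + (b + b) ≡ n → x ≡ ev cs a b) → (a + (b + b) ≢ n → x ≡ 0) →
           x ≡ at n cs a b 0
at-intro n cs a b eq⇒ ≢⇒ with a + (b + b) ≟ n
... | yes eq = trans (eq⇒ eq) (sym (at-≡ n cs a b eq))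
... | no  ≢  = trans (≢⇒ ≢) (sym (at-≢ n cs a b ≢))

-- A pair (i, n) stands for e_{i+n} e_i; storing the difference makes the order of the two parts
-- evident.
columns : ℕ → ℕ → List ℕ → List (ℕ × ℕ)
columns i n []       = []
columns i n (c ∷ cs) = replicate c (i , n) ++ columns (suc i) (n ∸ 2) cs

sumOver-replicate : ∀ c (x : A) (f : A → ℕ) → sumOver (replicate c x) f ≡ c * f x
sumOver-replicate zero    x f = refl
sumOver-replicate (suc c) x f = cong (f x +_) (sumOver-replicate c x f)

columnsProfile : ℕ → ℕ → List ℕ → ℕ → ℕ → ℕ
columnsProfile i n []       a b = 0
columnsProfile i n (c ∷ cs) a b = c * pairs a b (i + n) i + columnsProfile (suc i) (n ∸ 2) cs a b

columnsProfile₃ : ℕ → ℕ → List ℕ → Profile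
columnsProfile₃ i n cs a b zero    = columnsProfile i n cs a b
columnsProfile₃ i n cs a b (suc _) = 0

sumOver-columns : ∀ i n cs (α : Vec ℕ m) →
  (sumOver (columns i n cs) λ (i , n) → eCoeff α (i + n ∷ i ∷ [])) ≡ lift (columnsProfile₃ i n cs) α
sumOver-columns i n []       α = sym (lift-0 α λ { _ _ zero → refl ; _ _ (suc _) → refl })
sumOver-columns i n (c ∷ cs) α = begin
  (sumOver (columns i n (c ∷ cs)) λ (i , n) → eCoeff α (i + n ∷ i ∷ []))
    ≡⟨ sumOver-++ (replicate c (i , n)) (columns (suc i) (n ∸ 2) cs) _ ⟩
  (sumOver (replicate c (i , n)) λ (i , n) → eCoeff α (i + n ∷ i ∷ [])) +
  (sumOver (columns (suc i) (n ∸ 2) cs) λ (i , n) → eCoeff α (i + n ∷ i ∷ []))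
    ≡⟨ cong₂ _+_ (trans (sumOver-replicate c (i , n) _)
                   (trans (cong (c *_) (eCoeff-pair (i + n) i α)) (sym (lift-* c (pairProfile (i + n) i) α))))
                 (sumOver-columns (suc i) (n ∸ 2) cs α) ⟩
  lift (λ a b d → c * pairProfile (i + n) i a b d) α + lift (columnsProfile₃ (suc i) (n ∸ 2) cs) α
    ≡⟨ lift-+ _ _ α ⟨
  lift (λ a b d → c * pairProfile (i + n) i a b d + columnsProfile₃ (suc i) (n ∸ 2) cs a b d) α
    ≡⟨ lift-cong α (λ { a b zero → refl ; a b (suc _) → trans (+-identityʳ _) (*-zeroʳ c) }) ⟩
  lift (columnsProfile₃ i n (c ∷ cs)) α ∎
  where open ≡-Reasoning

columnsProfile-suc : ∀ i n cs a b → columnsProfile (suc i) n cs a (suc b) ≡ columnsProfile i n cs a b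
columnsProfile-suc i n []       a b = refl
columnsProfile-suc i n (c ∷ cs) a b =
  cong (c * pairs a b (i + n) i +_) (columnsProfile-suc (suc i) (n ∸ 2) cs a b)

columnsProfile-row : ∀ i {n cs} a → Fits n cs → a ≡ i + n + i → columnsProfile i n cs a 0 ≡ row i cs a
columnsProfile-row i a nil    eq = refl
columnsProfile-row i {n} a (single {c = c}) eq = cong (λ x → c * x + 0) (pairs-0 a (i + n) i eq)
columnsProfile-row i {suc (suc n)} a (cons {c = c} fits) eq =
  cong₂ _+_ (cong (c *_) (pairs-0 a _ i eq))
            (columnsProfile-row (suc i) a fits (trans eq (lemma i n)))
  where
  lemma : ∀ i n → i + (2 + n) + i ≡ suc i + n + suc i
  lemma = solve-∀

columnsProfile-degree : ∀ i {n cs} a b → Fits n cs → a + (b + b) ≢ i + n + i → columnsProfile i n cs a b ≡ 0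
columnsProfile-degree i a b nil ≢ = refl
columnsProfile-degree i {n} a b (single {c = c}) ≢ =
  trans (cong (λ x → c * x + 0) (pairs-degree a b (i + n) i ≢)) (trans (+-identityʳ _) (*-zeroʳ c))
columnsProfile-degree i {suc (suc n)} a b (cons {c = c} fits) ≢ =
  cong₂ _+_ (trans (cong (c *_) (pairs-degree a b _ i ≢)) (*-zeroʳ c))
            (columnsProfile-degree (suc i) a b fits λ eq → ≢ (trans eq (lemma i n)))
  where
  lemma : ∀ i n → suc i + n + suc i ≡ i + (2 + n) + i
  lemma = solve-∀

columnsProfile-ev : ∀ {n cs} a b → Fits n cs → a + (b + b) ≡ n → columnsProfile 0 n cs a b ≡ ev cs a b
columnsProfile-ev a zero    fits   eq = columnsProfile-row 0 a fits
  (trans (sym (+-identityʳ a)) (trans eq (sym (+-identityʳ _))))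
columnsProfile-ev a (suc b) nil    eq = refl
columnsProfile-ev {n} a (suc b) (single {c = c}) eq = trans (lemma n) (sym (ev-[] a b))
  where
  lemma : ∀ n → c * pairs a (suc b) n 0 + 0 ≡ 0
  lemma zero    = trans (+-identityʳ _) (*-zeroʳ c)
  lemma (suc n) = trans (+-identityʳ _) (*-zeroʳ c)
columnsProfile-ev {suc (suc n)} {c ∷ cs} a (suc b) (cons fits) eq =
  cong₂ _+_ (*-zeroʳ c) (trans (columnsProfile-suc 0 n cs a b)
    (columnsProfile-ev a b fits (suc-injective (suc-injective (trans (sym (lemma a b)) eq)))))
  where
  lemma : ∀ a b → a + (suc b + suc b) ≡ 2 + (a + (b + b))
  lemma = solve-∀

sumOver-columns-at : ∀ {n cs} → Fits n cs → ∀ (α : Vec ℕ m) →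
  (sumOver (columns 0 n cs) λ (i , n) → eCoeff α (i + n ∷ i ∷ [])) ≡ lift (at n cs) α
sumOver-columns-at {n = n} {cs} fits α = trans (sumOver-columns 0 n cs α) (lift-cong α λ
  { a b zero    → at-intro n cs a b (columnsProfile-ev a b fits)
                    (λ ≢ → columnsProfile-degree 0 a b fits λ eq → ≢ (trans eq (+-identityʳ n)))
  ; a b (suc _) → refl })

column column,1 : ℕ × ℕ → Partition
column (zero  , zero)  = partition [] [] []
column (zero  , suc n) = partition (suc n ∷ []) (z<s ∷ []) [-]
column (suc i , n)     = partition (suc (i + n) ∷ suc i ∷ []) (z<s ∷ z<s ∷ []) (s≤s (m≤m+n i n) ∷ [-])

column,1 (zero  , zero)  = partition (1 ∷ []) (z<s ∷ []) [-]
column,1 (zero  , suc n) = partition (suc n ∷ 1 ∷ []) (z<s ∷ z<s ∷ []) (s≤s z≤n ∷ [-])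
column,1 (suc i , n)     = partition (suc (i + n) ∷ suc i ∷ 1 ∷ [])
  (z<s ∷ z<s ∷ z<s ∷ []) (s≤s (m≤m+n i n) ∷ s≤s z≤n ∷ [-])

eCoeff-column : ∀ i n (α : Vec ℕ m) → eCoeff α (parts (column (i , n))) ≡ eCoeff α (i + n ∷ i ∷ [])
eCoeff-column i n α = eCoeff-ignores α _ _ (lemma i n)
  where
  lemma : ∀ i n → nonzeros (parts (column (i , n))) ≡ nonzeros (i + n ∷ i ∷ [])
  lemma zero    zero    = refl
  lemma zero    (suc n) = refl
  lemma (suc i) n       = refl

eCoeff-column,1 : ∀ i n (α : Vec ℕ m) →
  eCoeff α (parts (column,1 (i , n))) ≡ e₁· (λ γ → eCoeff γ (i + n ∷ i ∷ [])) α
eCoeff-column,1 i n α = trans (eCoeff-ignores α _ _ (lemma i n)) (eCoeff-snoc-1 α (i + n ∷ i ∷ []))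
  where
  lemma : ∀ i n → nonzeros (parts (column,1 (i , n))) ≡ nonzeros (i + n ∷ i ∷ 1 ∷ [])
  lemma zero    zero    = refl
  lemma zero    (suc n) = refl
  lemma (suc i) n       = refl

-- Adding parts of size 1 and 2

infixl 6 _⊞_

_⊞_ : List ℕ → List ℕ → List ℕ
[]       ⊞ ds       = ds
(c ∷ cs) ⊞ []       = c ∷ cs
(c ∷ cs) ⊞ (d ∷ ds) = c + d ∷ cs ⊞ ds

-- Joining a single vertex to e_{n-q} e_q gives Σ_{j ≤ q} (n + 1 - 2j) e_{n+1-j} e_j.
join₁ : ℕ → List ℕ → List ℕ
join₁ n []       = []
join₁ n (c ∷ cs) = suc n * (c + sum cs) ∷ join₁ (n ∸ 2) cs

-- This is `join₁ n cs` minus `cs`, written without subtraction so that nonnegativity is visible.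
excess : ℕ → List ℕ → List ℕ
excess n []       = []
excess n (c ∷ cs) = n * (c + sum cs) + sum cs ∷ excess (n ∸ 2) cs

weighted : ℕ → List ℕ → List ℕ
weighted k []       = []
weighted k (c ∷ cs) = k * c ∷ weighted (suc k) cs

-- Giving both vertices the same colour contributes the weighted list minus a vertex joined to Σⱼ cⱼ
-- e_{n+1-j} e_j. The negative term is absorbed by the contribution of two different colours, which
-- is a vertex joined to `join₁ n cs`; what is left there is a vertex joined to the `excess`.
join₂ : ℕ → List ℕ → List ℕ
join₂ n cs = join₁ (suc n) (excess n cs) ⊞ (0 ∷ weighted 1 cs)

fits-⊞ : ∀ {n cs ds} → Fits n cs → Fits n ds → Fits n (cs ⊞ ds)
fits-⊞ nil      gs       = gs
fits-⊞ single   nil      = single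
fits-⊞ single   single   = single
fits-⊞ single   (cons g) = cons g
fits-⊞ (cons f) nil      = cons f
fits-⊞ (cons f) single   = cons (fits-⊞ f nil)
fits-⊞ (cons f) (cons g) = cons (fits-⊞ f g)

fits-suc : ∀ {n cs} → Fits n cs → Fits (suc n) cs
fits-suc nil      = nil
fits-suc single   = single
fits-suc (cons f) = cons (fits-suc f)

fits-join₁ : ∀ {n cs} → Fits n cs → Fits n (join₁ n cs)
fits-join₁ nil      = nil
fits-join₁ single   = single
fits-join₁ (cons f) = cons (fits-join₁ f)

fits-excess : ∀ {n cs} → Fits n cs → Fits n (excess n cs)
fits-excess nil      = nil
fits-excess single   = single
fits-excess (cons f) = cons (fits-excess f)

fits-weighted : ∀ {n cs} k → Fits n cs → Fits n (weighted k cs)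
fits-weighted k nil      = nil
fits-weighted k single   = single
fits-weighted k (cons f) = cons (fits-weighted (suc k) f)

fits-join₂ : ∀ {n cs} → Fits n cs → Fits (2 + n) (join₂ n cs)
fits-join₂ f = fits-⊞ (fits-suc (fits-join₁ (fits-suc (fits-excess f)))) (cons (fits-weighted 1 f))

row-⊞ : ∀ i cs ds a → row i (cs ⊞ ds) a ≡ row i cs a + row i ds a
row-⊞ i []       ds       a = refl
row-⊞ i (c ∷ cs) []       a = sym (+-identityʳ _)
row-⊞ i (c ∷ cs) (d ∷ ds) a = trans
  (cong₂ _+_ (*-distribʳ-+ (a C i) c d) (row-⊞ (suc i) cs ds a))
  (interchange (c * (a C i)) (d * (a C i)) _ _)

ev-⊞ : ∀ cs ds a b → ev (cs ⊞ ds) a b ≡ ev cs a b + ev ds a b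
ev-⊞ cs       ds       a zero    = row-⊞ 0 cs ds a
ev-⊞ []       ds       a (suc b) = refl
ev-⊞ (c ∷ cs) []       a (suc b) = sym (+-identityʳ _)
ev-⊞ (c ∷ cs) (d ∷ ds) a (suc b) = ev-⊞ cs ds a b

join₁-excess : ∀ n cs → join₁ n cs ≡ excess n cs ⊞ cs
join₁-excess n []       = refl
join₁-excess n (c ∷ cs) = cong₂ _∷_ (lemma n c (sum cs)) (join₁-excess (n ∸ 2) cs)
  where
  lemma : ∀ n c s → suc n * (c + s) ≡ n * (c + s) + s + c
  lemma = solve-∀

absorption : ∀ n k → suc k * (suc n C suc k) ≡ suc n * (n C k)
absorption zero    zero    = refl
absorption zero    (suc k) = *-zeroʳ (2 + k)
absorption (suc n) zero    = trans (+-identityʳ _) (trans (nC1≡n (2 + n)) (sym (*-identityʳ _)))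
absorption (suc n) (suc k) = begin
  (2 + k) * ((2 + n) C (2 + k))
    ≡⟨ cong ((2 + k) *_) (nCk+nC[k+1]≡[n+1]C[k+1] (suc n) (suc k)) ⟨
  (2 + k) * (X + (suc n C (2 + k)))
    ≡⟨ lemma₁ k X (suc n C (2 + k)) ⟩
  X + suc k * X + (2 + k) * (suc n C (2 + k))
    ≡⟨ cong₂ (λ u v → X + u + v) (absorption n k) (absorption n (suc k)) ⟩
  X + suc n * (n C k) + suc n * (n C suc k)
    ≡⟨ lemma₂ n X (n C k) (n C suc k) ⟩
  X + suc n * (n C k + n C suc k)
    ≡⟨ cong (λ u → X + suc n * u) (nCk+nC[k+1]≡[n+1]C[k+1] n k) ⟩
  (2 + n) * X ∎
  where
  open ≡-Reasoning
  X = suc n C suc k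
  lemma₁ : ∀ k x y → (2 + k) * (x + y) ≡ x + suc k * x + (2 + k) * y
  lemma₁ = solve-∀
  lemma₂ : ∀ n x y z → x + suc n * y + suc n * z ≡ x + suc n * (y + z)
  lemma₂ = solve-∀

-- (M - 2i) C(M, i) = M (C(M - 1, i) - C(M - 1, i - 1)), with M = m + 1
ballot : ∀ n m i → m ≡ n + (i + i) →
  suc n * (suc m C i) + suc m * before (m C_) i ≡ suc m * (m C i)
ballot n m zero    eq = trans (cong₂ _+_ (cong (λ k → suc k * 1) (trans (sym (+-identityʳ n)) (sym eq)))
                                         (*-zeroʳ (suc m))) (+-identityʳ _)
ballot n m (suc i) eq = +-cancelʳ-≡ (suc m * Y) _ _ (begin
  suc n * X + suc m * Y + suc m * Y
    ≡⟨ +-assoc (suc n * X) _ _ ⟩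
  suc n * X + (suc m * Y + suc m * Y)
    ≡⟨ cong (λ u → suc n * X + (u + u)) (absorption m i) ⟨
  suc n * X + (suc i * X + suc i * X)
    ≡⟨ lemma n i X ⟩
  suc (n + (suc i + suc i)) * X
    ≡⟨ cong₂ (λ k u → suc k * u) eq (nCk+nC[k+1]≡[n+1]C[k+1] m i) ⟨
  suc m * (Y + (m C suc i))
    ≡⟨ trans (*-distribˡ-+ (suc m) Y _) (+-comm (suc m * Y) _) ⟩
  suc m * (m C suc i) + suc m * Y ∎)
  where
  open ≡-Reasoning
  X = suc m C suc i
  Y = m C i
  lemma : ∀ n i x → suc n * x + (suc i * x + suc i * x) ≡ suc (n + (suc i + suc i)) * x
  lemma = solve-∀

-- Summation by parts: `ballot` turns the left side into differences of binomial coefficients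
-- weighted by tail sums of `cs`, and the term with `before` is the boundary contribution.
row-join₁ : ∀ i {n cs} m → Fits n cs → m ≡ n + (i + i) →
  row i (join₁ n cs) (suc m) + suc m * (before (m C_) i * sum cs) ≡ suc m * row i cs m
row-join₁-∷ : ∀ i {n} c cs ds m → m ≡ n + (i + i) →
  row (suc i) ds (suc m) + suc m * ((m C i) * sum cs) ≡ suc m * row (suc i) cs m →
  row i (suc n * (c + sum cs) ∷ ds) (suc m) + suc m * (before (m C_) i * sum (c ∷ cs)) ≡
  suc m * row i (c ∷ cs) m

row-join₁ i m nil  eq = cong (suc m *_) (*-zeroʳ (before (m C_) i))
row-join₁ i m (single {n} {c}) eq =
  row-join₁-∷ i {n} c [] [] m eq (cong (suc m *_) (*-zeroʳ (m C i)))
row-join₁ i {suc (suc n)} m (cons {c = c} {cs} f) eq =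
  row-join₁-∷ i {2 + n} c cs (join₁ n cs) m eq (row-join₁ (suc i) m f (trans eq (lemma n i)))
  where
  lemma : ∀ n i → 2 + n + (i + i) ≡ n + (suc i + suc i)
  lemma = solve-∀

row-join₁-∷ i {n} c cs ds m eq eqᵣ = begin
  suc n * S * X + R + suc m * (Y * S)
    ≡⟨ lemma₁ (suc n) S X R (suc m) Y ⟩
  S * (suc n * X + suc m * Y) + R
    ≡⟨ cong (λ u → S * u + R) (ballot n m i eq) ⟩
  S * (suc m * Z) + R
    ≡⟨ lemma₂ c (sum cs) (suc m) Z R ⟩
  c * (suc m * Z) + (R + suc m * (Z * sum cs))
    ≡⟨ cong (c * (suc m * Z) +_) eqᵣ ⟩
  c * (suc m * Z) + suc m * row (suc i) cs m
    ≡⟨ lemma₃ c (suc m) Z (row (suc i) cs m) ⟩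
  suc m * (c * Z + row (suc i) cs m) ∎
  where
  open ≡-Reasoning
  S = c + sum cs
  X = suc m C i
  Y = before (m C_) i
  Z = m C i
  R = row (suc i) ds (suc m)
  lemma₁ : ∀ n s x r m y → n * s * x + r + m * (y * s) ≡ s * (n * x + m * y) + r
  lemma₁ = solve-∀
  lemma₂ : ∀ c s m z r → (c + s) * (m * z) + r ≡ c * (m * z) + (r + m * (z * s))
  lemma₂ = solve-∀
  lemma₃ : ∀ c m z r → c * (m * z) + m * r ≡ m * (c * z + r)
  lemma₃ = solve-∀

degree-suc : ∀ a b → a + (suc b + suc b) ≡ 2 + (a + (b + b))
degree-suc = solve-∀

ev-join₁ : ∀ {n cs} a b → Fits n cs → a + (b + b) ≡ suc n → ev (join₁ n cs) a b ≡ a * ev cs (pred a) b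
ev-join₁ {n} {cs} a zero f eq with trans (sym (+-identityʳ a)) eq
... | refl = trans (sym (trans (cong (row 0 (join₁ n cs) (suc n) +_) (*-zeroʳ (suc n))) (+-identityʳ _)))
                   (row-join₁ 0 n f (sym (+-identityʳ n)))
ev-join₁ a (suc b) nil    eq = sym (*-zeroʳ a)
ev-join₁ a (suc b) single eq =
  trans (ev-[] a b) (sym (trans (cong (a *_) (ev-[] (pred a) b)) (*-zeroʳ a)))
ev-join₁ a (suc b) (cons f) eq =
  ev-join₁ a b f (suc-injective (suc-injective (trans (sym (degree-suc a b)) eq)))

row-weighted : ∀ i k cs a →
  row (suc i) (weighted (suc i + k) cs) a ≡ k * row (suc i) cs a + a * row i cs (pred a)
row-weighted i k []       a = sym (cong₂ _+_ (*-zeroʳ k) (*-zeroʳ a))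
row-weighted i k (c ∷ cs) a = begin
  (suc i + k) * c * (a C suc i) + row (2 + i) (weighted (2 + i + k) cs) a
    ≡⟨ cong ((suc i + k) * c * (a C suc i) +_) (row-weighted (suc i) k cs a) ⟩
  (suc i + k) * c * (a C suc i) + (k * row (2 + i) cs a + a * row (suc i) cs (pred a))
    ≡⟨ lemma₁ (suc i) k c (a C suc i) (k * row (2 + i) cs a) _ ⟩
  c * (suc i * (a C suc i)) + k * (c * (a C suc i)) + (k * row (2 + i) cs a + a * row (suc i) cs (pred a))
    ≡⟨ cong (λ u → c * u + k * (c * (a C suc i)) + (k * row (2 + i) cs a + a * row (suc i) cs (pred a)))
            (absorb a) ⟩
  c * (a * (pred a C i)) + k * (c * (a C suc i)) + (k * row (2 + i) cs a + a * row (suc i) cs (pred a))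
    ≡⟨ lemma₂ c a (pred a C i) k (a C suc i) _ _ ⟩
  k * (c * (a C suc i) + row (2 + i) cs a) + a * (c * (pred a C i) + row (suc i) cs (pred a)) ∎
  where
  open ≡-Reasoning
  absorb : ∀ a → suc i * (a C suc i) ≡ a * (pred a C i)
  absorb zero    = *-zeroʳ (suc i)
  absorb (suc a) = absorption a i
  lemma₁ : ∀ i k c x r s → (i + k) * c * x + (r + s) ≡ c * (i * x) + k * (c * x) + (r + s)
  lemma₁ = solve-∀
  lemma₂ : ∀ c a y k x r s → c * (a * y) + k * (c * x) + (k * r + a * s) ≡ k * (c * x + r) + a * (c * y + s)
  lemma₂ = solve-∀

ev-weighted : ∀ k cs a b → ev (weighted k cs) a b ≡ (k + b) * ev cs a b + a * ev cs (pred a) (suc b)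
ev-weighted k []       a b = trans (ev-[] a b)
  (sym (cong₂ _+_ (trans (cong ((k + b) *_) (ev-[] a b)) (*-zeroʳ (k + b))) (*-zeroʳ a)))
ev-weighted k (c ∷ cs) a zero = trans
  (cong (k * c * 1 +_) (row-weighted 0 k cs a))
  (lemma k c (row 1 cs a) (a * row 0 cs (pred a)))
  where
  lemma : ∀ k c x y → k * c * 1 + (k * x + y) ≡ (k + 0) * (c * 1 + x) + y
  lemma = solve-∀
ev-weighted k (c ∷ cs) a (suc b) = trans (ev-weighted (suc k) cs a b)
  (cong (λ u → u * ev cs a b + a * ev cs (pred a) (suc b)) (sym (+-suc k b)))

-- In (j + 1) e_{n+1-j} e_{j+1} the factor j + 1 marks a variable of e_{j+1}. Removing a marked
-- variable of exponent 2 lowers both indices; removing one of exponent 1 lowers only the second, so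
-- there `cs` is read one degree higher.
ev-0∷weighted : ∀ cs a b → ev (0 ∷ weighted 1 cs) a b ≡ b * ev cs a (pred b) + a * ev cs (pred a) b
ev-0∷weighted cs a zero    = row-weighted 0 0 cs a
ev-0∷weighted cs a (suc b) = ev-weighted 1 cs a b

ev-join₂ : ∀ {n cs} a b → Fits n cs → a + (b + b) ≡ 2 + n →
  ev (join₂ n cs) a b ≡ a * (pred a * ev cs (pred (pred a)) b) + b * ev cs a (pred b)
ev-join₂ {n} {cs} a b f eq = begin
  ev (join₂ n cs) a b
    ≡⟨ ev-⊞ (join₁ (suc n) (excess n cs)) (0 ∷ weighted 1 cs) a b ⟩
  ev (join₁ (suc n) (excess n cs)) a b + ev (0 ∷ weighted 1 cs) a b
    ≡⟨ cong₂ _+_ (ev-join₁ a b (fits-suc (fits-excess f)) eq) (ev-0∷weighted cs a b) ⟩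
  a * ev (excess n cs) (pred a) b + (b * ev cs a (pred b) + a * ev cs (pred a) b)
    ≡⟨ lemma a (ev (excess n cs) (pred a) b) (b * ev cs a (pred b)) (ev cs (pred a) b) ⟩
  a * (ev (excess n cs) (pred a) b + ev cs (pred a) b) + b * ev cs a (pred b)
    ≡⟨ cong (_+ b * ev cs a (pred b)) (main a eq) ⟩
  a * (pred a * ev cs (pred (pred a)) b) + b * ev cs a (pred b) ∎
  where
  open ≡-Reasoning
  lemma : ∀ a x y z → a * x + (y + a * z) ≡ a * (x + z) + y
  lemma = solve-∀
  -- Adding `cs` back to its excess restores `join₁ n cs`, read in degree n + 1.
  main : ∀ a → a + (b + b) ≡ 2 + n →
    a * (ev (excess n cs) (pred a) b + ev cs (pred a) b) ≡ a * (pred a * ev cs (pred (pred a)) b)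
  main zero    eq = refl
  main (suc a) eq = cong (suc a *_) (trans (sym (ev-⊞ (excess n cs) cs a b))
    (trans (cong (λ ds → ev ds a b) (sym (join₁-excess n cs))) (ev-join₁ a b f (suc-injective eq))))

add₂-cong : ∀ {F G : Profile} → (∀ a b c → F a b c ≡ G a b c) → ∀ a b c → add₂ F a b c ≡ add₂ G a b c
add₂-cong F≗G a b c = cong₂ _+_ (cong (λ u → a * (pred a * u)) (F≗G _ b c)) (cong (b *_) (F≗G a _ c))

at-join₁ : ∀ {n cs} → Fits n cs → ∀ a b c → add₁ (at n cs) a b c ≡ at (suc n) (join₁ n cs) a b c
at-join₁ f a b (suc c) = *-zeroʳ a
at-join₁ {n} {cs} f a b zero = at-intro (suc n) (join₁ n cs) a b
  (λ eq → trans (yes′ a eq) (sym (ev-join₁ a b f eq))) (no′ a)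
  where
  yes′ : ∀ a → a + (b + b) ≡ suc n → a * at n cs (pred a) b 0 ≡ a * ev cs (pred a) b
  yes′ zero    eq = refl
  yes′ (suc a) eq = cong (suc a *_) (at-≡ n cs a b (suc-injective eq))
  no′ : ∀ a → a + (b + b) ≢ suc n → a * at n cs (pred a) b 0 ≡ 0
  no′ zero    ≢ = refl
  no′ (suc a) ≢ = trans (cong (suc a *_) (at-≢ n cs a b (≢ ∘ cong suc))) (*-zeroʳ (suc a))

at-join₂ : ∀ {n cs} → Fits n cs → ∀ a b c → add₂ (at n cs) a b c ≡ at (2 + n) (join₂ n cs) a b c
at-join₂ f a b (suc c) = cong₂ _+_ (trans (cong (a *_) (*-zeroʳ (pred a))) (*-zeroʳ a)) (*-zeroʳ b)
at-join₂ {n} {cs} f a b zero = at-intro (2 + n) (join₂ n cs) a b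
  (λ eq → trans (cong₂ _+_ (yes₁ a eq) (yes₂ b eq)) (sym (ev-join₂ a b f eq)))
  (λ ≢ → cong₂ _+_ (no₁ a ≢) (no₂ b ≢))
  where
  yes₁ : ∀ a → a + (b + b) ≡ 2 + n →
    a * (pred a * at n cs (pred (pred a)) b 0) ≡ a * (pred a * ev cs (pred (pred a)) b)
  yes₁ zero          eq = refl
  yes₁ (suc zero)    eq = refl
  yes₁ (suc (suc a)) eq =
    cong (λ u → (2 + a) * (suc a * u)) (at-≡ n cs a b (suc-injective (suc-injective eq)))
  yes₂ : ∀ b → a + (b + b) ≡ 2 + n → b * at n cs a (pred b) 0 ≡ b * ev cs a (pred b)
  yes₂ zero    eq = refl
  yes₂ (suc b) eq = cong (suc b *_)
    (at-≡ n cs a b (suc-injective (suc-injective (trans (sym (degree-suc a b)) eq))))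
  no₁ : ∀ a → a + (b + b) ≢ 2 + n → a * (pred a * at n cs (pred (pred a)) b 0) ≡ 0
  no₁ zero          ≢ = refl
  no₁ (suc zero)    ≢ = refl
  no₁ (suc (suc a)) ≢ = trans
    (cong (λ u → (2 + a) * (suc a * u)) (at-≢ n cs a b (≢ ∘ cong (2 +_))))
    (trans (cong ((2 + a) *_) (*-zeroʳ (suc a))) (*-zeroʳ (2 + a)))
  no₂ : ∀ b → a + (b + b) ≢ 2 + n → b * at n cs a (pred b) 0 ≡ 0
  no₂ zero    ≢ = refl
  no₂ (suc b) ≢ = trans
    (cong (suc b *_) (at-≢ n cs a b λ eq → ≢ (trans (degree-suc a b) (cong (2 +_) eq))))
    (*-zeroʳ (suc b))

unit-lift : ∀ (α : Vec ℕ m) → unit α ≡ lift (at 0 (1 ∷ [])) α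
unit-lift []      = refl
unit-lift (0 ∷ α) = unit-lift α
unit-lift (1 ∷ α) = sym (lift-0 α λ { _ _ zero → refl ; _ _ (suc _) → refl })
unit-lift (2 ∷ α) = sym (lift-0 α λ
  { a b zero → at-≢ 0 (1 ∷ []) a (suc b) (λ eq → 1+n≢0 (trans (sym (degree-suc a b)) eq))
  ; _ _ (suc _) → refl })
unit-lift (3 ∷ α) = sym (lift-0 α λ _ _ _ → refl)
unit-lift (suc (suc (suc (suc _))) ∷ α) = refl

χ-two-column : ∀ {ps} → All (λ p → p ≡ 1 ⊎ p ≡ 2) ps →
  ∃[ n ] ∃[ cs ] Fits n cs × (∀ {m} (α : Vec ℕ m) → χ ps α ≡ lift (at n cs) α)
χ-two-column [] = 0 , 1 ∷ [] , single , unit-lift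
χ-two-column (inj₁ refl ∷ all) with χ-two-column all
... | n , cs , f , eq = suc n , join₁ n cs , fits-suc (fits-join₁ f) , λ α →
  trans (addPart-cong 1 eq α) (trans (addPart-1-lift (at n cs) α) (lift-cong α (at-join₁ f)))
χ-two-column (inj₂ refl ∷ all) with χ-two-column all
... | n , cs , f , eq = 2 + n , join₂ n cs , fits-join₂ f , λ α →
  trans (addPart-cong 2 eq α) (trans (addPart-2-lift (at n cs) α) (lift-cong α (at-join₂ f)))

-- The partitions (3, 2^β)

double : ℕ → ℕ
double zero    = 0
double (suc n) = 2 + double n

X : ℕ → Profile
X zero    = at 0 (1 ∷ [])
X (suc β) = add₂ (X β)

X-≥3 : ∀ β a b c → X β a b (suc c) ≡ 0
X-≥3 zero    a b c = refl
X-≥3 (suc β) a b c = cong₂ _+_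
  (trans (cong (λ u → a * (pred a * u)) (X-≥3 β (pred (pred a)) b c))
         (trans (cong (a *_) (*-zeroʳ (pred a))) (*-zeroʳ a)))
  (trans (cong (b *_) (X-≥3 β a (pred b) c)) (*-zeroʳ b))

X-0 : ∀ a b → a + b ≢ 0 → X 0 a b 0 ≡ 0
X-0 a b ≢ = at-≢ 0 (1 ∷ []) a b λ eq →
  ≢ (cong₂ _+_ (m+n≡0⇒m≡0 a eq) (m+n≡0⇒m≡0 b (m+n≡0⇒n≡0 a eq)))

X-1 : ∀ β b → X β 1 b 0 ≡ 0
X-1 zero    b       = X-0 1 b λ ()
X-1 (suc β) zero    = refl
X-1 (suc β) (suc b) = trans (cong (suc b *_) (X-1 β b)) (*-zeroʳ (suc b))

-- Homogeneity, phrased as a product so that it also holds where `X` vanishes.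
X-degree : ∀ β a b → (a + (b + b)) * X β a b 0 ≡ double β * X β a b 0
X-degree zero    zero    zero    = refl
X-degree zero    zero    (suc b) = trans (cong ((suc b + suc b) *_) (X-0 0 (suc b) λ ())) (*-zeroʳ (suc b + suc b))
X-degree zero    (suc a) b       =
  trans (cong ((suc a + (b + b)) *_) (X-0 (suc a) b λ ())) (*-zeroʳ (suc a + (b + b)))
X-degree (suc β) a b = begin
  (a + (b + b)) * (a * (pred a * U) + b * V)
    ≡⟨ *-distribˡ-+ (a + (b + b)) (a * (pred a * U)) (b * V) ⟩
  (a + (b + b)) * (a * (pred a * U)) + (a + (b + b)) * (b * V)
    ≡⟨ cong₂ _+_ (first a) (second b) ⟩
  (2 + d) * (a * (pred a * U)) + (2 + d) * (b * V)
    ≡⟨ *-distribˡ-+ (2 + d) (a * (pred a * U)) (b * V) ⟨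
  (2 + d) * (a * (pred a * U) + b * V) ∎
  where
  open ≡-Reasoning
  d = double β
  U = X β (pred (pred a)) b 0
  V = X β a (pred b) 0
  first : ∀ a → let U = X β (pred (pred a)) b 0 in
    (a + (b + b)) * (a * (pred a * U)) ≡ (2 + d) * (a * (pred a * U))
  first zero          = trans (*-zeroʳ (b + b)) (sym (*-zeroʳ (2 + d)))
  first (suc zero)    = trans (*-zeroʳ (1 + (b + b))) (sym (*-zeroʳ (2 + d)))
  first (suc (suc a)) = begin
    (2 + a + (b + b)) * ((2 + a) * (suc a * W))
      ≡⟨ lemma (a + (b + b)) (2 + a) (suc a) W ⟩
    (2 + a) * (suc a * (2 * W + (a + (b + b)) * W))
      ≡⟨ cong (λ u → (2 + a) * (suc a * (2 * W + u))) (X-degree β a b) ⟩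
    (2 + a) * (suc a * (2 * W + d * W))
      ≡⟨ lemma d (2 + a) (suc a) W ⟨
    (2 + d) * ((2 + a) * (suc a * W)) ∎
    where
    W = X β a b 0
    lemma : ∀ e a a′ w → (2 + e) * (a * (a′ * w)) ≡ a * (a′ * (2 * w + e * w))
    lemma = solve-∀
  second : ∀ b → let V = X β a (pred b) 0 in (a + (b + b)) * (b * V) ≡ (2 + d) * (b * V)
  second zero    = trans (*-zeroʳ (a + 0)) (sym (*-zeroʳ (2 + d)))
  second (suc b) = begin
    (a + (suc b + suc b)) * (suc b * W)
      ≡⟨ cong (_* (suc b * W)) (degree-suc a b) ⟩
    (2 + (a + (b + b))) * (suc b * W)
      ≡⟨ lemma (a + (b + b)) (suc b) W ⟩
    suc b * (2 * W + (a + (b + b)) * W)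
      ≡⟨ cong (λ u → suc b * (2 * W + u)) (X-degree β a b) ⟩
    suc b * (2 * W + d * W)
      ≡⟨ lemma d (suc b) W ⟨
    (2 + d) * (suc b * W) ∎
    where
    W = X β a b 0
    lemma : ∀ e b w → (2 + e) * (b * w) ≡ b * (2 * w + e * w)
    lemma = solve-∀

-- A colour of exponent 2 fills exactly one of the β + 1 parts.
X-suc : ∀ β a b → X (suc β) a (suc b) 0 ≡ suc β * X β a b 0
X-suc zero    a b = begin
  a * (pred a * X 0 (pred (pred a)) (suc b) 0) + suc b * X 0 a b 0
    ≡⟨ cong₂ _+_ (trans (cong (λ u → a * (pred a * u)) (X-0 (pred (pred a)) (suc b) λ eq →
                                1+n≢0 (trans (sym (+-suc (pred (pred a)) b)) eq)))
                        (trans (cong (a *_) (*-zeroʳ (pred a))) (*-zeroʳ a)))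
                 (only-0 b) ⟩
  1 * X 0 a b 0 ∎
  where
  open ≡-Reasoning
  only-0 : ∀ b → suc b * X 0 a b 0 ≡ 1 * X 0 a b 0
  only-0 zero    = refl
  only-0 (suc b) rewrite X-0 a (suc b) (λ eq → 1+n≢0 (trans (sym (+-suc a b)) eq)) = *-zeroʳ b
X-suc (suc β) a b = begin
  a * (pred a * X (suc β) (pred (pred a)) (suc b) 0) + suc b * X (suc β) a b 0
    ≡⟨ cong (λ u → a * (pred a * u) + suc b * X (suc β) a b 0) (X-suc β (pred (pred a)) b) ⟩
  a * (pred a * (suc β * U)) + suc b * (a * (pred a * U) + b * V)
    ≡⟨ lemma₁ a (pred a) (suc β) U b V ⟩
  (a * (pred a * U) + b * V) + (suc β * (a * (pred a * U)) + b * (b * V + a * (pred a * U)))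
    ≡⟨ cong (λ u → (a * (pred a * U) + b * V) + (suc β * (a * (pred a * U)) + u)) (shift b) ⟩
  (a * (pred a * U) + b * V) + (suc β * (a * (pred a * U)) + suc β * (b * V))
    ≡⟨ lemma₂ (suc β) (a * (pred a * U)) (b * V) ⟩
  (2 + β) * (a * (pred a * U) + b * V) ∎
  where
  open ≡-Reasoning
  U = X β (pred (pred a)) b 0
  V = X β a (pred b) 0
  lemma₁ : ∀ a a′ k u b v → a * (a′ * (k * u)) + suc b * (a * (a′ * u) + b * v) ≡
    (a * (a′ * u) + b * v) + (k * (a * (a′ * u)) + b * (b * v + a * (a′ * u)))
  lemma₁ = solve-∀
  lemma₂ : ∀ k u v → (u + v) + (k * u + k * v) ≡ suc k * (u + v)
  lemma₂ = solve-∀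
  shift : ∀ b → let U = X β (pred (pred a)) b 0 ; V = X β a (pred b) 0 in
    b * (b * V + a * (pred a * U)) ≡ suc β * (b * V)
  shift zero    = sym (*-zeroʳ (suc β))
  shift (suc b) = trans
    (cong (suc b *_) (trans (+-comm (suc b * X β a b 0) _) (X-suc β a b)))
    (lemma₃ (suc b) (suc β) (X β a b 0))
    where
    lemma₃ : ∀ b k v → b * (k * v) ≡ k * (b * v)
    lemma₃ = solve-∀

-- The constant is the ratio (a + 2)(a + 1) / (a/2 + 1) of two values of a! β! / (a/2)!.
X-trade : ∀ β a b → X β (2 + a) b 0 ≡ 2 * suc a * X β a (suc b) 0
X-trade zero    a b = trans (X-0 (2 + a) b λ ())
  (sym (trans (cong (2 * suc a *_) (X-0 a (suc b) λ eq → 1+n≢0 (trans (sym (+-suc a b)) eq))) (*-zeroʳ (2 * suc a))))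
X-trade (suc β) a b = begin
  (2 + a) * (suc a * W) + b * X β (2 + a) (pred b) 0
    ≡⟨ cong ((2 + a) * (suc a * W) +_) (trade b) ⟩
  (2 + a) * (suc a * W) + b * (2 * suc a * W)
    ≡⟨ lemma₁ a b W ⟩
  suc a * (2 * W + (a + (b + b)) * W)
    ≡⟨ cong (λ u → suc a * (2 * W + u)) (X-degree β a b) ⟩
  suc a * (2 * W + double β * W)
    ≡⟨ cong (λ u → suc a * (2 * W + u * W)) (double≡ β) ⟩
  suc a * (2 * W + 2 * β * W)
    ≡⟨ lemma₂ a β W ⟩
  2 * suc a * (suc β * W)
    ≡⟨ cong (2 * suc a *_) (X-suc β a b) ⟨
  2 * suc a * X (suc β) a (suc b) 0 ∎
  where
  open ≡-Reasoning
  W = X β a b 0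
  trade : ∀ b → b * X β (2 + a) (pred b) 0 ≡ b * (2 * suc a * X β a b 0)
  trade zero    = refl
  trade (suc b) = cong (suc b *_) (X-trade β a b)
  double≡ : ∀ n → double n ≡ 2 * n
  double≡ zero    = refl
  double≡ (suc n) = trans (cong (2 +_) (double≡ n)) (lemma n)
    where
    lemma : ∀ n → 2 + 2 * n ≡ 2 * suc n
    lemma = solve-∀
  lemma₁ : ∀ a b w → (2 + a) * (suc a * w) + b * (2 * suc a * w) ≡ suc a * (2 * w + (a + (b + b)) * w)
  lemma₁ = solve-∀
  lemma₂ : ∀ a β w → suc a * (2 * w + 2 * β * w) ≡ 2 * suc a * (suc β * w)
  lemma₂ = solve-∀

-- X_{K_(3,2^β)} = e₁ Z + β (Z joined with a vertex), where (β + 1) Z = X_{K_(2^(β+1))}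
X-identity : ∀ β a b c → suc β * add₃ (X β) a b c ≡ mulE₁ (X (suc β)) a b c + β * add₁ (X (suc β)) a b c
-- Only one term does not vanish at sight, and it has a single exponent 1, which parity excludes.
X-identity β zero    b       zero = trans (*-zeroʳ (suc β)) (sym (cong₂ _+_
  (trans (+-identityʳ _) (trans (cong (b *_) (X-1 (suc β) (pred b))) (*-zeroʳ b))) (*-zeroʳ β)))
X-identity β (suc a) zero    zero = lemma β (suc a) (a * (pred a * X β (pred (pred a)) 0 0))
  where
  lemma : ∀ β a u → suc β * (a * u + 3 * (a * 0) + 0) ≡ a * (u + 0) + 0 + 0 + β * (a * (u + 0))
  lemma = solve-∀
-- Up to the factor `suc a * suc b`, V occurs on the right 1 + β times directly and 2 (β + 1) times
-- through `X-trade`, which makes up the 3 (β + 1) coming from `add₃`.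
X-identity β (suc a) (suc b) zero = begin
  suc β * (suc a * U + 3 * (suc a * (suc b * V)) + 0)
    ≡⟨ lemma β (suc a) U (suc b) V ⟩
  suc a * (U + suc b * V) + suc b * (2 * suc a * (suc β * V)) + 0 + β * (suc a * (U + suc b * V))
    ≡⟨ cong (λ u → suc a * (U + suc b * V) + suc b * u + 0 + β * (suc a * (U + suc b * V)))
            (trans (X-trade (suc β) a b) (cong (2 * suc a *_) (X-suc β a b))) ⟨
  suc a * (U + suc b * V) + suc b * X (suc β) (2 + a) b 0 + 0 + β * (suc a * (U + suc b * V)) ∎
  where
  open ≡-Reasoning
  U = a * (pred a * X β (pred (pred a)) (suc b) 0)
  V = X β a b 0
  lemma : ∀ β a u b v → suc β * (a * u + 3 * (a * (b * v)) + 0) ≡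
    a * (u + b * v) + b * (2 * a * (suc β * v)) + 0 + β * (a * (u + b * v))
  lemma = solve-∀
-- On the left a colour of exponent 3 must fill the part of size 3; on the right only e₁ lowering
-- that exponent survives.
X-identity β a b (suc c) = begin
  suc β * (a * (pred a * (pred (pred a) * X β (pred (pred (pred a))) b (suc c))) +
           3 * (a * (b * X β (pred a) (pred b) (suc c))) + suc c * X β a b c)
    ≡⟨ cong₂ (λ u v → suc β * (a * (pred a * (pred (pred a) * u)) + 3 * (a * (b * v)) + suc c * X β a b c))
             (X-≥3 β _ b c) (X-≥3 β _ _ c) ⟩
  suc β * (a * (pred a * (pred (pred a) * 0)) + 3 * (a * (b * 0)) + suc c * X β a b c)
    ≡⟨ lemma₁ a (pred a) (pred (pred a)) b β c (X β a b c) ⟩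
  suc c * (suc β * X β a b c)
    ≡⟨ cong (suc c *_) (shift c) ⟨
  suc c * X (suc β) a (suc b) c
    ≡⟨ lemma₂ a b (suc c * X (suc β) a (suc b) c) β ⟩
  a * 0 + b * 0 + suc c * X (suc β) a (suc b) c + β * (a * 0)
    ≡⟨ cong₂ (λ u v → a * u + b * v + suc c * X (suc β) a (suc b) c + β * (a * u))
             (X-≥3 (suc β) (pred a) b c) (X-≥3 (suc β) (suc a) (pred b) c) ⟨
  mulE₁ (X (suc β)) a b (suc c) + β * add₁ (X (suc β)) a b (suc c) ∎
  where
  open ≡-Reasoning
  shift : ∀ c → X (suc β) a (suc b) c ≡ suc β * X β a b c
  shift zero    = X-suc β a b
  shift (suc c) = trans (X-≥3 (suc β) a (suc b) c)
    (sym (trans (cong (suc β *_) (X-≥3 β a b c)) (*-zeroʳ (suc β))))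
  lemma₁ : ∀ a a′ a″ b β c x →
    suc β * (a * (a′ * (a″ * 0)) + 3 * (a * (b * 0)) + suc c * x) ≡ suc c * (suc β * x)
  lemma₁ = solve-∀
  lemma₂ : ∀ a b x β → x ≡ a * 0 + b * 0 + x + β * (a * 0)
  lemma₂ = solve-∀

fits-map : ∀ {n cs} k → Fits n (map (k *_) cs) → Fits n cs
fits-map {cs = []}          k nil      = nil
fits-map {cs = _ ∷ []}      k single   = single
fits-map {cs = _ ∷ _}       k (cons f) = cons (fits-map k f)

map-fits : ∀ {n cs} k → Fits n cs → Fits n (map (k *_) cs)
map-fits k nil      = nil
map-fits k single   = single
map-fits k (cons f) = cons (map-fits k f)

row-map : ∀ k i cs a → row i (map (k *_) cs) a ≡ k * row i cs a
row-map k i []       a = sym (*-zeroʳ k)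
row-map k i (c ∷ cs) a = trans
  (cong₂ _+_ (*-assoc k c (a C i)) (row-map k (suc i) cs a))
  (sym (*-distribˡ-+ k (c * (a C i)) _))

ev-map : ∀ k cs a b → ev (map (k *_) cs) a b ≡ k * ev cs a b
ev-map k cs       a zero    = row-map k 0 cs a
ev-map k []       a (suc b) = sym (*-zeroʳ k)
ev-map k (c ∷ cs) a (suc b) = ev-map k cs a b

at-map : ∀ k n cs a b c → at n (map (k *_) cs) a b c ≡ k * at n cs a b c
at-map k n cs a b zero    = trans (cong (i *_) (ev-map k cs a b)) (lemma i k (ev cs a b))
  where
  i = ind (a + (b + b) ≟ n)
  lemma : ∀ i k x → i * (k * x) ≡ k * (i * x)
  lemma = solve-∀
at-map k n cs a b (suc c) = sym (*-zeroʳ k)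

-- The coefficients cⱼ are obtained from the values of Σⱼ cⱼ e_{n-j} e_j by solving
-- a unitriangular system, so they inherit common divisors.
coefficients-∣ : ∀ {d n cs} → Fits n cs → (∀ a b → a + (b + b) ≡ n → d ∣ ev cs a b) →
  ∃[ ds ] cs ≡ map (d *_) ds
coefficients-∣ nil _ = [] , refl
coefficients-∣ {d} {n} (single {c = c}) d∣ with d∣ n 0 (+-identityʳ n)
... | divides q eq = q ∷ [] , cong (_∷ []) (trans (lemma c) (trans eq (*-comm q d)))
  where
  lemma : ∀ c → c ≡ c * 1 + 0
  lemma = solve-∀
coefficients-∣ {d} {suc (suc n)} (cons {c = c} f) d∣
  with coefficients-∣ f (λ a b eq → d∣ a (suc b) (trans (degree-suc a b) (cong (2 +_) eq)))
... | ds , refl with ∣m+n∣m⇒∣n {d} {row 1 (map (d *_) ds) (2 + n)} {c * 1}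
         (subst (d ∣_) (+-comm (c * 1) _) (d∣ (2 + n) 0 (+-identityʳ (2 + n))))
         (divides (row 1 ds (2 + n)) (trans (row-map d 1 ds (2 + n)) (*-comm d _)))
...   | divides q eq = q ∷ ds , cong (_∷ map (d *_) ds) (trans (sym (*-identityʳ c)) (trans eq (*-comm q d)))

X-at : ∀ β → ∃[ cs ] Fits (double β) cs × (∀ a b c → X β a b c ≡ at (double β) cs a b c)
X-at zero    = 1 ∷ [] , single , λ _ _ _ → refl
X-at (suc β) with X-at β
... | cs , f , eq = join₂ (double β) cs , fits-join₂ f , λ a b c →
  trans (add₂-cong eq a b c) (at-join₂ f a b c)

-- The factor comes from `X-suc` if some exponent is 2; otherwise `X-trade` first creates one. The
-- degree rules out a ≤ 1 with b = 0.
X-∣ : ∀ β a b → a + (b + b) ≡ double (suc β) → suc β ∣ X (suc β) a b 0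
X-∣ β a             (suc b) _  = divides (X β a b 0) (trans (X-suc β a b) (*-comm (suc β) _))
X-∣ β (suc (suc a)) zero    _  = divides (2 * suc a * X β a 0 0)
  (trans (X-trade (suc β) a 0) (trans (cong (2 * suc a *_) (X-suc β a 0)) (lemma (2 * suc a) (suc β) (X β a 0 0))))
  where
  lemma : ∀ a k x → a * (k * x) ≡ a * x * k
  lemma = solve-∀
X-∣ β zero          zero    ()
X-∣ β (suc zero)    zero    ()

χ-2^ : ∀ β (α : Vec ℕ m) → χ (replicate β 2) α ≡ lift (X β) α
χ-2^ zero    α = unit-lift α
χ-2^ (suc β) α = trans (addPart-cong 2 (χ-2^ β) α) (addPart-2-lift (X β) α)

-- Lists of partitions for the exceptional shapes

SumOfE : List ℕ → Set
SumOfE ps = ∃[ μs ] (∀ {m} (α : Vec ℕ m) → χ ps α ≡ sumOver μs (eCoeff α ∘ parts))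

module _ (β : ℕ) where

  private
    deg = double (suc β)
    cs = proj₁ (X-at (suc β))

  -- The list `ds` holds the integral coefficients of Z.
  quotient-X : ∃[ ds ] Fits deg ds × (∀ a b c → X (suc β) a b c ≡ suc β * at deg ds a b c)
  quotient-X with coefficients-∣ {suc β} (proj₁ (proj₂ (X-at (suc β)))) (λ a b eq →
    subst (suc β ∣_) (trans (proj₂ (proj₂ (X-at (suc β))) a b 0) (at-≡ deg cs a b eq)) (X-∣ β a b eq))
  ... | ds , eq = ds , fits-map (suc β) (subst (Fits deg) eq (proj₁ (proj₂ (X-at (suc β))))) , λ a b c →
    trans (proj₂ (proj₂ (X-at (suc β))) a b c)
          (trans (cong (λ cs → at deg cs a b c) eq) (at-map (suc β) deg ds a b c))

  χ-3∷2^-partitions : SumOfE (3 ∷ replicate β 2)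
  χ-3∷2^-partitions with quotient-X
  ... | ds , f , eq = map column,1 (columns 0 deg ds) ++ map column (columns 0 (suc deg) es) , λ α → begin
    χ (3 ∷ replicate β 2) α
      ≡⟨ trans (addPart-cong 3 (χ-2^ β) α) (addPart-3-lift (X β) α) ⟩
    lift (add₃ (X β)) α
      ≡⟨ lift-cong α identity ⟩
    lift (λ a b c → mulE₁ (at deg ds) a b c + at (suc deg) es a b c) α
      ≡⟨ lift-+ _ _ α ⟩
    lift (mulE₁ (at deg ds)) α + lift (at (suc deg) es) α
      ≡⟨ cong₂ _+_ (e₁·-lift (at deg ds) (λ _ _ _ → refl) α) (sumOver-columns-at fits-es α) ⟨
    e₁· (lift (at deg ds)) α + (sumOver (columns 0 (suc deg) es) λ (i , k) → eCoeff α (i + k ∷ i ∷ []))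
      ≡⟨ cong₂ _+_ (trans (e₁·-cong (λ γ → sym (sumOver-columns-at f γ)) α)
                          (e₁·-sumOver (columns 0 deg ds) (λ (i , k) γ → eCoeff γ (i + k ∷ i ∷ [])) α))
                   (sumOver-cong (columns 0 (suc deg) es) λ (i , k) → sym (eCoeff-column i k α)) ⟩
    (sumOver (columns 0 deg ds) λ (i , k) → e₁· (λ γ → eCoeff γ (i + k ∷ i ∷ [])) α) +
    (sumOver (columns 0 (suc deg) es) λ x → eCoeff α (parts (column x)))
      ≡⟨ cong₂ _+_ (trans (sumOver-cong (columns 0 deg ds) λ (i , k) → sym (eCoeff-column,1 i k α))
                          (sym (sumOver-map column,1 (columns 0 deg ds) (eCoeff α ∘ parts))))
                   (sym (sumOver-map column (columns 0 (suc deg) es) (eCoeff α ∘ parts))) ⟩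
    sumOver (map column,1 (columns 0 deg ds)) (eCoeff α ∘ parts) +
    sumOver (map column (columns 0 (suc deg) es)) (eCoeff α ∘ parts)
      ≡⟨ sumOver-++ (map column,1 (columns 0 deg ds)) _ (eCoeff α ∘ parts) ⟨
    sumOver (map column,1 (columns 0 deg ds) ++ map column (columns 0 (suc deg) es)) (eCoeff α ∘ parts) ∎
    where
    open ≡-Reasoning
    es = map (β *_) (join₁ deg ds)
    fits-es : Fits (suc deg) es
    fits-es = map-fits β (fits-suc (fits-join₁ f))
    identity : ∀ a b c → add₃ (X β) a b c ≡ mulE₁ (at deg ds) a b c + at (suc deg) es a b c
    -- Substituting (β + 1) Z into `X-identity` puts the factor β + 1 on both sides, where it
    -- cancels.
    identity a b c = *-cancelˡ-≡ _ _ (suc β) (begin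
      suc β * add₃ (X β) a b c
        ≡⟨ X-identity β a b c ⟩
      a * X (suc β) (pred a) b c + b * X (suc β) (suc a) (pred b) c + c * X (suc β) a (suc b) (pred c) +
      β * (a * X (suc β) (pred a) b c)
        ≡⟨ cong₂ (λ u v → a * u + b * v + c * X (suc β) a (suc b) (pred c) + β * (a * u))
                 (eq (pred a) b c) (eq (suc a) (pred b) c) ⟩
      a * (suc β * z₁) + b * (suc β * z₂) + c * X (suc β) a (suc b) (pred c) + β * (a * (suc β * z₁))
        ≡⟨ cong (λ u → a * (suc β * z₁) + b * (suc β * z₂) + c * u + β * (a * (suc β * z₁)))
                (eq a (suc b) (pred c)) ⟩
      a * (suc β * z₁) + b * (suc β * z₂) + c * (suc β * z₃) + β * (a * (suc β * z₁))
        ≡⟨ lemma (suc β) a b c z₁ z₂ z₃ β ⟩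
      suc β * (mulE₁ (at deg ds) a b c + β * add₁ (at deg ds) a b c)
        ≡⟨ cong (λ u → suc β * (mulE₁ (at deg ds) a b c + u))
                (trans (cong (β *_) (at-join₁ f a b c)) (sym (at-map β (suc deg) (join₁ deg ds) a b c))) ⟩
      suc β * (mulE₁ (at deg ds) a b c + at (suc deg) es a b c) ∎)
      where
      z₁ = at deg ds (pred a) b c
      z₂ = at deg ds (suc a) (pred b) c
      z₃ = at deg ds a (suc b) (pred c)
      lemma : ∀ k a b c x y z β → a * (k * x) + b * (k * y) + c * (k * z) + β * (a * (k * x)) ≡
        k * (a * x + b * y + c * z + β * (a * x))
      lemma = solve-∀

χ-1-2-partitions : ∀ {ps} → All (λ p → p ≡ 1 ⊎ p ≡ 2) ps →
  SumOfE ps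
χ-1-2-partitions all with χ-two-column all
... | n , cs , f , eq = map column (columns 0 n cs) , λ α → trans (eq α) (trans (sym (sumOver-columns-at f α))
  (trans (sumOver-cong (columns 0 n cs) λ (i , n) → sym (eCoeff-column i n α))
         (sym (sumOver-map column (columns 0 n cs) (eCoeff α ∘ parts)))))

1^ : ℕ → Partition
1^ n = partition (replicate n 1) (positive′ n) (decreasing′ n)
  where
  positive′ : ∀ n → All (0 <_) (replicate n 1)
  positive′ zero    = []
  positive′ (suc n) = z<s ∷ positive′ n
  decreasing′ : ∀ n → Linked _≥_ (replicate n 1)
  decreasing′ zero          = []
  decreasing′ (suc zero)    = [-]
  decreasing′ (suc (suc n)) = ≤-refl ∷ decreasing′ (suc n)

exceptional-partitions : ∀ ps → Exceptional ps →
  SumOfE ps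
exceptional-partitions (n ∷ []) (inj₁ _) = 1^ n ∷ [] , λ α → trans (edgeless n α) (sym (+-identityʳ _))
exceptional-partitions ps (inj₂ (inj₁ all)) = χ-1-2-partitions all
exceptional-partitions ps (inj₂ (inj₂ (β , _ , ps≡))) = subst SumOfE (sym ps≡) (χ-3∷2^-partitions β)

exceptional⇒e-positive : ∀ lam → Exceptional (parts lam) → EPositive (chromatic (K lam))
exceptional⇒e-positive lam exc with exceptional-partitions (parts lam) exc
... | μs , eq = EPositive-cong (λ m α → trans (chromatic≡χ lam α) (cong ℤ.+_ (eq α))) (EPositive-sumOver μs)

corollary1p3 : (lam : Partition) → 0 < size lam →
    EPositive (chromatic (K lam)) ⇔
    ( length (parts lam) ≡ 1
    ⊎ All (λ p → p ≡ 1 ⊎ p ≡ 2) (parts lam)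
    ⊎ (∃[ β ] (1 ≤ β × parts lam ≡ 3 ∷ replicate β 2)) )
corollary1p3 lam _ = mk⇔ (e-positive⇒exceptional lam) (exceptional⇒e-positive lam)
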